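{- Let $p$ be a prime and $\mathbb{F}=\mathbb{F}_p$. For every $\varepsilon>0$ and $d\in\mathbb{N}$ there is a constant $c_{p,d,\varepsilon}$ (depending only on $p,d,\varepsilon$) such that for all $e,n\in\mathbb{N}$ with $e\le d$ and every function $g:\mathbb{F}^n\to\mathbb{F}$, $$\bigl|\{f\in\mathcal{P}_d(\mathbb{F}^n): \mathrm{dist}(f,g)\le \delta_{\mathbb{F}}(e)-\varepsilon\}\bigr|\le \exp\bigl(c_{p,d,\varepsilon}\, n^{d-e}\bigr).$$ Equivalently, $\ell_{\mathbb{F}}(n,d,\delta_{\mathbb{F}}(e)-\varepsilon)\le \exp(c_{p,d,\varepsilon} n^{d-e})$.
   Context: $\mathcal{P}_d(\mathbb{F}^n)$ denotes the set of functions $f:\mathbb{F}^n\to\mathbb{F}$ given by (classical) polynomials in $n$ variables over $\mathbb{F}$ of total degree at most $d$. $\mathrm{dist}(f,g)=\Pr_{x\in\mathbb{F}^n}[f(x)\ne g(x)]$ is the normalized Hamming distance ($x$ uniform). For $\eta>0$, $\ell_{\mathbb{F}}(n,d,\eta):=\max_{g:\mathbb{F}^n\to\mathbb{F}}|\{f\in\mathcal{P}_d(\mathbb{F}^n):\mathrm{dist}(f,g)\le\eta\}|$. For $q=|\mathbb{F}|$ and $m=a(q-1)+b$ with integers $a\ge 0$, $0\le b<q-1$, $\delta_{\mathbb{F}}(m):=\frac{1}{q^a}\bigl(1-\frac{b}{q}\bigr)$. $\mathbb{N}$ denotes the positive integers. -}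

module Defs where

open import Data.Nat using (ℕ; zero; suc; _+_; _*_; _^_; _≤_; _%_; _/_)
open import Data.Fin using (Fin; toℕ)
open import Data.Vec using (Vec; []; _∷_)
open import Data.List using (List; []; _∷_; _++_; map; concatMap; length; filter; foldr)
open import Data.Product using (Σ; _×_; _,_; ∃)
open import Data.Integer using (+_)
open import Data.Rational using (ℚ; 0ℚ; 1ℚ; _-_) renaming (_*_ to _*ℚ_; _/_ to _/ℚ_)
open import Data.Fin using (_≟_)
open import Data.Unit using (⊤)
open import Relation.Nullary.Decidable using (¬?)
open import Relation.Binary.PropositionalEquality using (_≡_; _≢_)

-- The field F_p is modelled as Fin p with arithmetic mod p.

-- reduction mod p (the p = 0 branch is never used, since p is prime)
modP : ℕ → ℕ → ℕ
modP zero    x = x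
modP (suc k) x = x % suc k

-- A monomial term in n variables: (coefficient, exponent vector).
Term : ℕ → Set
Term n = ℕ × Vec ℕ n

-- A polynomial (with coefficients represented by natural numbers, i.e. by
-- representatives of F_p) is a finite list of terms.
Poly : ℕ → Set
Poly n = List (Term n)

sumV : ∀ {n} → Vec ℕ n → ℕ
sumV []       = 0
sumV (x ∷ xs) = x + sumV xs

termDeg : ∀ {n} → Term n → ℕ
termDeg (c , es) = sumV es

DegLe : ∀ {n} → ℕ → Poly n → Set
DegLe d []      = ⊤
DegLe d (t ∷ P) = termDeg t ≤ d × DegLe d P

monVal : ∀ {p n} → Vec ℕ n → Vec (Fin p) n → ℕ
monVal []       []       = 1
monVal (e ∷ es) (x ∷ xs) = (toℕ x ^ e) * monVal es xs

evalℕ : ∀ {p n} → Poly n → Vec (Fin p) n → ℕ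
evalℕ []             x = 0
evalℕ ((c , es) ∷ P) x = c * monVal es x + evalℕ P x

evalP : ∀ {p n} → Poly n → Vec (Fin p) n → ℕ
evalP {p} P x = modP p (evalℕ P x)

InPd : (p n d : ℕ) → (Vec (Fin p) n → Fin p) → Set
InPd p n d f = Σ (Poly n) λ P → DegLe d P × (∀ x → toℕ (f x) ≡ evalP P x)

allFinL : (p : ℕ) → List (Fin p)
allFinL p = Data.List.allFin p

points : (p n : ℕ) → List (Vec (Fin p) n)
points p zero    = [] ∷ []
points p (suc n) = concatMap (λ a → map (a ∷_) (points p n)) (allFinL p)

-- a / m as a rational (m = 0 branch never used)
ratio : ℕ → ℕ → ℚ
ratio a zero    = 0ℚ
ratio a (suc m) = (+ a) /ℚ (suc m)

disagree : ∀ {p n} → (f g : Vec (Fin p) n → Fin p) → ℕ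
disagree {p} {n} f g = length (filter (λ x → ¬? (f x ≟ g x)) (points p n))

dist : ∀ {p n} → (f g : Vec (Fin p) n → Fin p) → ℚ
dist {p} {n} f g = ratio (disagree f g) (p ^ n)

-- δ_F(m) for q = p : write m = a(q-1) + b with 0 ≤ b < q-1,
-- δ = q^{-a} (1 - b/q)
deltaF : ℕ → ℕ → ℚ
deltaF p m with p Data.Nat.∸ 1
... | zero  = 0ℚ
... | suc k = ratio 1 (p ^ (m / suc k)) *ℚ (1ℚ - ratio (m % suc k) p)

Distinct : ∀ {p n} → (f g : Vec (Fin p) n → Fin p) → Set
Distinct f g = ∃ λ x → f x ≢ g x

{-# OPTIONS --safe #-}

-- Fix directions a = (a₁, …, a_N) in X = Fⁿ. The view of a point x at level j consists of the values of g on x + span(a)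
-- and of the j-fold differences of f at x in directions from span(a). The heart of the proof (determination) is that, for
-- random a and N = N(p, j, ε), almost all values f(x) are determined by the view of x at level j as soon as
-- dist(f, g) ≤ δ(j) − ε; here f is an arbitrary function.
--
-- This is proved by induction on j. Suppose that two typical points x, x′ have the same view at level j but different
-- views at level j − 1, so that the (j−1)-fold differences of f around x and x′ differ by a nonzero form κ. As the samples
-- around x and x′ represent all of X, there is a permutation τ of X which, almost everywhere, preserves g and shifts the
-- (j−1)-fold differences of f by κ. A function that is invariant under fresh random directions is almost constant; applied
-- to differences in k of f(τᵏ y) this shows that, on almost every y + span(a), f(τᵏ y) is a polynomial in k whose
-- coefficient of index i ≥ 1 has degree ≤ j − i in y. Since it depends on k, the Schwartz–Zippel argument yields
-- Pr[f(τᵏ y) ≠ g(y)] ≥ δ(j). But τ preserves g and the counting measure, so this probability is almost dist(f, g).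
--
-- For the theorem, one tuple a works for half of the list. A listed f is then determined, up to an error below the minimum
-- distance, by a function on the finite set of views and by its e-fold differences in directions from span(a), which are
-- boundedly many functions of degree ≤ d − e, each having at most exp(O(n^(d−e))) possibilities.
module Submission where

open import Defs
open import Data.Nat using (ℕ; zero; suc; _+_; _*_; _^_; _∸_; _⊔_; _≤_; _<_; z≤n; s≤s; _<?_; _≤?_; NonZero; >-nonZero)
open import Data.Nat.Properties hiding (_≟_; suc-injective; <-cmp)
open import Data.Nat.DivMod using (_%_; _/_; %-distribˡ-+; %-distribˡ-*; m<n⇒m%n≡m; n%n≡0; m%n<n; [m+kn]%n≡m%n; m≡m%n+[m/n]*n; +-distrib-/-∣ʳ; m*n/n≡m; m<n⇒m/n≡0)
open import Data.Nat.Divisibility using (n∣m*n; n∣m⇒m%n≡0; m%n≡0⇒n∣m)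
open import Data.Nat.Primality using (Prime; euclidsLemma; ¬prime[0]; ¬prime[1])
open import Data.Nat.Tactic.RingSolver using (solve-∀)
open import Data.Integer as ℤ using (ℤ; -[1+_]; ∣_∣)
import Data.Integer.Properties as ℤ
import Data.Integer.Tactic.RingSolver as ℤ
open import Data.Rational as ℚ using (ℚ; 0ℚ; 1ℚ; mkℚ; toℚᵘ; ↧ₙ_; _-_) renaming (_<_ to _<ℚ_; _≤_ to _≤ℚ_)
import Data.Rational.Properties as ℚ
open import Data.Rational.Unnormalised as ℚᵘ using (ℚᵘ; mkℚᵘ)
import Data.Rational.Unnormalised.Properties as ℚᵘ
open import Data.Bool using (Bool; true; false; not; _∨_; _∧_)
open import Data.Bool.Properties using () renaming (_≟_ to _≟ᵇ_)
open import Data.Fin using (Fin; zero; suc; toℕ; fromℕ<; punchIn; combine; remQuot; funToFin; _↑ˡ_; _↑ʳ_)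
open import Data.Fin.Properties using (_≟_; any?; punchInᵢ≢i; toℕ-fromℕ<; toℕ-injective; toℕ<n; combine-injective; remQuot-combine; combine-remQuot; suc-injective; <-cmp)
open import Data.Fin.Permutation as Perm using (Permutation; Permutation′; _⟨$⟩ʳ_)
open import Data.Vec as Vec using (Vec; []; _∷_; _++_; lookup; map; zipWith; replicate; take; drop)
open import Data.Vec.Properties using (zipWith-assoc; zipWith-comm; zipWith-identityʳ; zipWith-inverseʳ; take++drop≡id)
open import Data.Vec.Relation.Unary.All as VecAll using ([]; _∷_) renaming (All to Allᵛ)
open import Data.List as List using (List; []; _∷_; length)
open import Data.List.Properties using (filter-++; length-++)
open import Data.List.Membership.Propositional.Properties using (∈-lookup)
open import Data.List.Relation.Unary.All as All using (All)
open import Data.List.Relation.Unary.AllPairs using (AllPairs; _∷_)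
open import Data.Maybe using (nothing)
open import Data.Product using (Σ; _×_; _,_; ∃; proj₁; proj₂)
open import Data.Sum using (_⊎_; inj₁; inj₂)
open import Algebra.Bundles using (CommutativeRing)
open import Algebra.Properties.CommutativeMonoid.Sum +-0-commutativeMonoid using (sum; sum-cong-≗; ∑-distrib-+; ∑-comm; sum-permute; sum-remove)
import Algebra.Properties.Ring
import Tactic.RingSolver
open import Tactic.RingSolver.Core.AlmostCommutativeRing using (AlmostCommutativeRing; fromCommutativeRing)
open import Function using (_∘_; id; _$_)
open import Level using (0ℓ)
open import Relation.Nullary using (¬_; Dec; yes; no; does; contradiction)
open import Relation.Nullary.Decidable using (_×-dec_; decidable-stable)
open import Relation.Binary.Definitions using (Tri; tri<; tri≈; tri>)
open import Relation.Binary.PropositionalEquality hiding ([_])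

-- Finite sums and almost-everywhere statements

-- The obstacle is that τ is built from views alone and need not commute with translations, so the
-- differences of f ∘ τᵏ at y are a priori unrelated to those of f at τᵏ y. It is the induction
-- hypothesis that links them (`agree`). The directions come in nested blocks. The number of views
-- grows with the number of directions, and a block must be long enough to sample the views taken in
-- all directions inside it. So the innermost tuple, supplied by the induction hypothesis, has its
-- length fixed before the others, and blocks are added outwards. For a fixed tuple every basic
-- exceptional set has density at most 1/K₀, and the number of such sets that the argument spends
-- depends only on p and j. Hence K₀ can be chosen afterwards, so large that the total loss stays
-- below the slack in dist(f, g) ≤ δ(j) - ε. The argument about τ runs with the tuple fixed, whereas
-- randomness controls pairs of a tuple and a point; therefore a tuple for which an exceptional set
-- is too dense is rejected as a whole.

sum-mono : ∀ {n} {f g : Fin n → ℕ} → (∀ i → f i ≤ g i) → sum f ≤ sum g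
sum-mono {zero}  h = z≤n
sum-mono {suc n} h = +-mono-≤ (h zero) (sum-mono (h ∘ suc))

sum-*ˡ : ∀ {n} c (f : Fin n → ℕ) → sum (λ i → c * f i) ≡ c * sum f
sum-*ˡ {zero}  c f = sym (*-zeroʳ c)
sum-*ˡ {suc n} c f = trans (cong (c * f zero +_) (sum-*ˡ c (f ∘ suc)))
                           (sym (*-distribˡ-+ c (f zero) _))

sum-const : ∀ n c → sum {n} (λ _ → c) ≡ n * c
sum-const zero    c = refl
sum-const (suc n) c = cong (c +_) (sum-const n c)

sum-≤-const : ∀ {n} {f : Fin n → ℕ} c → (∀ i → f i ≤ c) → sum f ≤ n * c
sum-≤-const {n} c h = ≤-trans (sum-mono h) (≤-reflexive (sum-const n c))

sum-≥-const : ∀ {n} {f : Fin n → ℕ} c → (∀ i → c ≤ f i) → n * c ≤ sum f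
sum-≥-const {n} c h = ≤-trans (≤-reflexive (sym (sum-const n c))) (sum-mono h)

ind : Bool → ℕ
ind true  = 1
ind false = 0

ind-≤1 : ∀ b → ind b ≤ 1
ind-≤1 true  = ≤-refl
ind-≤1 false = z≤n

ind-∨ : ∀ a b → ind (a ∨ b) ≤ ind a + ind b
ind-∨ true  b = s≤s z≤n
ind-∨ false b = ≤-refl

∨-false : ∀ {a b} → a ∨ b ≡ false → a ≡ false × b ≡ false
∨-false {false} {false} _ = refl , refl

does-false : ∀ {A : Set} (d : Dec A) → does d ≡ false → ¬ A
does-false (no ¬a) _ = ¬a

does-true : ∀ {A : Set} (d : Dec A) → does d ≡ true → A
does-true (yes a) _ = a

*-ind-≤ : ∀ {A : Set} {a b} (d : Dec A) → (A → a ≤ b) → a * ind (does d) ≤ b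
*-ind-≤ {a = a} (yes x) h = ≤-trans (≤-reflexive (*-identityʳ a)) (h x)
*-ind-≤ {a = a} (no _)  h = ≤-trans (≤-reflexive (*-zeroʳ a)) z≤n

count : ∀ {n} → (Fin n → Bool) → ℕ
count χ = sum (ind ∘ χ)

count-≤ : ∀ {n} (χ : Fin n → Bool) → count χ ≤ n
count-≤ {n} χ = ≤-trans (sum-≤-const 1 (ind-≤1 ∘ χ)) (≤-reflexive (*-identityʳ n))

count-mono : ∀ {n} (χ ψ : Fin n → Bool) → (∀ i → χ i ≡ true → ψ i ≡ true) → count χ ≤ count ψ
count-mono χ ψ h = sum-mono pw
  where
  pw : ∀ i → ind (χ i) ≤ ind (ψ i)
  pw i with χ i | h i
  ... | true  | e = ≤-reflexive (cong ind (sym (e refl)))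
  ... | false | _ = z≤n

count-not : ∀ {n} (χ : Fin n → Bool) → count χ + count (not ∘ χ) ≡ n
count-not {zero}  χ = refl
count-not {suc n} χ with χ zero
... | true  = cong suc (count-not (χ ∘ suc))
... | false = trans (+-suc _ _) (cong suc (count-not (χ ∘ suc)))

-- P holds outside a set of density ≤ w / K.
record Most (K {q} w : ℕ) (P : Fin q → Set) : Set where
  constructor most
  field
    bad   : Fin q → Bool
    small : K * count bad ≤ w * q
    holds : ∀ y → bad y ≡ false → P y

module _ {K q : ℕ} where

  most-map : ∀ {w} {P Q : Fin q → Set} → (∀ y → P y → Q y) → Most K w P → Most K w Q
  most-map h (most bad s p) = most bad s λ y e → h y (p y e)

  most-weaken : ∀ {w w′} {P : Fin q → Set} → w ≤ w′ → Most K w P → Most K w′ P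
  most-weaken le (most bad s p) = most bad (≤-trans s (*-monoˡ-≤ q le)) p

  most-all : ∀ {P : Fin q → Set} → (∀ y → P y) → Most K 0 P
  most-all h = most (λ _ → false) (≤-reflexive (trans (cong (K *_) (trans (sum-const q 0) (*-zeroʳ q))) (*-zeroʳ K))) (λ y _ → h y)

  most-∧ : ∀ {w w′} {P Q : Fin q → Set} → Most K w P → Most K w′ Q → Most K (w + w′) (λ y → P y × Q y)
  most-∧ {w} {w′} (most b s p) (most b′ s′ p′) = most (λ y → b y ∨ b′ y) size λ y e → p y (proj₁ (∨-false e)) , p′ y (proj₂ (∨-false {b y} e))
    where
    open ≤-Reasoning
    size : K * count (λ y → b y ∨ b′ y) ≤ (w + w′) * q
    size = begin
      K * count (λ y → b y ∨ b′ y)  ≤⟨ *-monoʳ-≤ K (sum-mono (λ y → ind-∨ (b y) (b′ y))) ⟩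
      K * sum (λ y → ind (b y) + ind (b′ y))  ≡⟨ cong (K *_) (∑-distrib-+ (ind ∘ b) (ind ∘ b′)) ⟩
      K * (count b + count b′)  ≡⟨ *-distribˡ-+ K (count b) (count b′) ⟩
      K * count b + K * count b′  ≤⟨ +-mono-≤ s s′ ⟩
      w * q + w′ * q  ≡⟨ *-distribʳ-+ q w w′ ⟨
      (w + w′) * q  ∎

  most-perm : ∀ {w} {P : Fin q → Set} (π : Permutation′ q) → Most K w P → Most K w (P ∘ (π ⟨$⟩ʳ_))
  most-perm π (most b s p) = most (b ∘ (π ⟨$⟩ʳ_)) (≤-trans (≤-reflexive (cong (K *_) (sym (sum-permute (ind ∘ b) π)))) s) (λ y → p (π ⟨$⟩ʳ y))

  most-Fin : ∀ {w} r {P : Fin r → Fin q → Set} → (∀ i → Most K w (P i)) → Most K (r * w) (λ y → ∀ i → P i y)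
  most-Fin zero    h = most-all (λ y ())
  most-Fin (suc r) h = most-map (λ { y (a , b) zero → a ; y (a , b) (suc i) → b i }) (most-∧ (h zero) (most-Fin r (h ∘ suc)))

  -- Markov's inequality: averaged over y, a fraction at most w/K of the L statements fails, so the
  -- y at which more than a fraction 1/t of them fails have density at most t·w/K.
  most-markov : ∀ {w} t L {P : Fin L → Fin q → Set} → (∀ c → Most K w (P c)) →
    Most K (t * w) (λ y → Σ (Fin L → Bool) λ e → t * count e ≤ L × (∀ c → e c ≡ false → P c y))
  most-markov {w} t zero    h = most-weaken z≤n (most-all (λ y → (λ ()) , ≤-reflexive (*-zeroʳ t) , λ ()))
  most-markov {w} t (suc L) {P} h = most bad size λ y e → ex y , ≮⇒≥ (does-false (suc L <? t * count (ex y)) e) , λ c → Most.holds (h c) y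
    where
    ex : Fin q → Fin (suc L) → Bool
    ex y c = Most.bad (h c) y
    bad : Fin q → Bool
    bad y = does (suc L <? t * count (ex y))
    open ≤-Reasoning
    rearr : ∀ L K b → L * (K * b) ≡ K * (L * b)
    rearr = solve-∀
    rearr′ : ∀ t L w q → t * (L * (w * q)) ≡ L * (t * w * q)
    rearr′ = solve-∀
    size : K * count bad ≤ t * w * q
    size = *-cancelˡ-≤ (suc L) (begin
      suc L * (K * count bad)  ≡⟨ rearr (suc L) K (count bad) ⟩
      K * (suc L * count bad)  ≡⟨ cong (K *_) (sum-*ˡ (suc L) (ind ∘ bad)) ⟨
      K * sum (λ y → suc L * ind (bad y))  ≤⟨ *-monoʳ-≤ K (sum-mono (λ y → *-ind-≤ (suc L <? t * count (ex y)) <⇒≤)) ⟩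
      K * sum (λ y → t * count (ex y))  ≡⟨ cong (K *_) (sum-*ˡ t (λ y → count (ex y))) ⟩
      K * (t * sum (λ y → count (ex y)))  ≡⟨ cong (λ z → K * (t * z)) (∑-comm (λ y c → ind (ex y c))) ⟩
      K * (t * sum (λ c → count (Most.bad (h c))))  ≡⟨ rearr K t _ ⟩
      t * (K * sum (λ c → count (Most.bad (h c))))  ≡⟨ cong (t *_) (sum-*ˡ K (λ c → count (Most.bad (h c)))) ⟨
      t * sum (λ c → K * count (Most.bad (h c)))  ≤⟨ *-monoʳ-≤ t (sum-≤-const (w * q) (λ c → Most.small (h c))) ⟩
      t * (suc L * (w * q))  ≡⟨ rearr′ t (suc L) w q ⟩
      suc L * (t * w * q)  ∎)

  most-or-bad : ∀ {w} {P : Fin q → Set} (m : Most K w P) y {A B} → (P y → A ≤ B) → A ≤ B + A * ind (Most.bad m y)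
  most-or-bad (most bad _ holds) y {A} {B} h with bad y | holds y
  ... | true  | _ = ≤-trans (≤-reflexive (sym (*-identityʳ A))) (m≤n+m _ B)
  ... | false | e = ≤-trans (h (e refl)) (m≤m+n B _)

-- Fibres of a colouring, matchings and collisions

infix 4 _==_
_==_ : ∀ {n} → Fin n → Fin n → Bool
a == b = does (a ≟ b)

==-refl : ∀ {n} (a : Fin n) → (a == a) ≡ true
==-refl a with a ≟ a
... | yes _ = refl
... | no ¬p = contradiction refl ¬p

==-false : ∀ {n} {a b : Fin n} → a ≢ b → (a == b) ≡ false
==-false {a = a} {b} h with a ≟ b
... | yes e = contradiction e h
... | no _  = refl

sum-zero : ∀ {n} {f : Fin n → ℕ} → (∀ i → f i ≡ 0) → sum f ≡ 0
sum-zero {n} h = trans (sum-cong-≗ h) (trans (sum-const n 0) (*-zeroʳ n))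

count-zero : ∀ {n} {χ : Fin n → Bool} → (∀ i → χ i ≡ false) → count χ ≡ 0
count-zero h = sum-zero (λ i → cong ind (h i))

count-cong : ∀ {n} {χ ψ : Fin n → Bool} → (∀ i → χ i ≡ ψ i) → count χ ≡ count ψ
count-cong h = sum-cong-≗ (λ i → cong ind (h i))

sum-point : ∀ {n} (u : Fin n) → sum (λ v → ind (u == v)) ≡ 1
sum-point {suc n} u = trans (sum-remove {i = u} (λ v → ind (u == v)))
  (cong₂ _+_ (cong ind (==-refl u)) (sum-zero (λ i → cong ind (==-false (λ e → punchInᵢ≢i u i (sym e))))))

sum-fibres : ∀ {q W} (V : Fin q → Fin W) → sum (λ v → count (λ y → V y == v)) ≡ q
sum-fibres {q} V = trans (∑-comm (λ v y → ind (V y == v)))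
  (trans (sum-cong-≗ (λ y → sum-point (V y))) (trans (sum-const q 1) (*-identityʳ q)))

insert-at : ∀ {m n} i j (π : Permutation m n) → Perm.insert i j π ⟨$⟩ʳ i ≡ j
insert-at i j π with i ≟ i
... | yes _ = refl
... | no ¬p = contradiction refl ¬p

-- Greedy choice: a pair y, y′ of equal colour is matched and removed, which lowers both classes of
-- that colour by one and preserves the hypothesis. When no such pair is left, a colour attained by
-- `V` is missed by `V′`, so the hypothesis bounds K times its class by B, and the W classes cover
-- all remaining points.
matching : ∀ {W} K B q (V V′ : Fin q → Fin W) →
  (∀ v → K * count (λ y → V y == v) ≤ K * count (λ y → V′ y == v) + B) →
  Σ (Permutation′ q) λ τ → K * count (λ y → not (V y == V′ (τ ⟨$⟩ʳ y))) ≤ W * B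
matching {W} K B zero    V V′ h = Perm.id , ≤-trans (≤-reflexive (*-zeroʳ K)) z≤n
matching {W} K B (suc q) V V′ h with any? (λ y → any? (λ y′ → V y ≟ V′ y′))
... | no none = Perm.id , (begin
  K * count (λ y → not (V y == V′ y))  ≤⟨ *-monoʳ-≤ K (count-≤ (λ y → not (V y == V′ y))) ⟩
  K * suc q  ≡⟨ cong (K *_) (sum-fibres V) ⟨
  K * sum (λ v → count (λ y → V y == v))  ≡⟨ sum-*ˡ K (λ v → count (λ y → V y == v)) ⟨
  sum (λ v → K * count (λ y → V y == v))  ≤⟨ sum-≤-const B class ⟩
  W * B  ∎)
  where
  open ≤-Reasoning
  class : ∀ v → K * count (λ y → V y == v) ≤ B
  class v with any? (λ y → V y ≟ v)
  ... | yes (y , refl) = ≤-trans (h (V y)) (≤-reflexive (cong (_+ B)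
          (trans (cong (K *_) (count-zero (λ y′ → ==-false (λ e → none (y , y′ , sym e))))) (*-zeroʳ K))))
  ... | no nv = ≤-trans (≤-reflexive (trans (cong (K *_) (count-zero (λ y → ==-false (λ e → nv (y , e))))) (*-zeroʳ K))) z≤n
... | yes (y , y′ , e) with matching K B q (V ∘ punchIn y) (V′ ∘ punchIn y′) h′
  where
  split : (U : Fin (suc q) → Fin W) (z : Fin (suc q)) (v : Fin W) →
    K * count (λ x → U x == v) ≡ K * ind (U z == v) + K * count (λ x → U (punchIn z x) == v)
  split U z v = trans (cong (K *_) (sum-remove {i = z} (λ x → ind (U x == v)))) (*-distribˡ-+ K _ _)
  h′ : ∀ v → K * count (λ x → V (punchIn y x) == v) ≤ K * count (λ x → V′ (punchIn y′ x) == v) + B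
  h′ v = +-cancelˡ-≤ (K * ind (V y == v)) _ _ (≤-trans (≤-reflexive (sym (split V y v))) (≤-trans (h v)
    (≤-reflexive (trans (cong (_+ B) (trans (split V′ y′ v) (cong (λ u → K * ind (u == v) + K * count (λ x → V′ (punchIn y′ x) == v)) (sym e))))
      (+-assoc (K * ind (V y == v)) _ B)))))
... | τ , s = Perm.insert y y′ τ , ≤-trans (≤-reflexive (cong (K *_) (trans
    (sum-remove {i = y} (λ x → ind (not (V x == V′ (Perm.insert y y′ τ ⟨$⟩ʳ x)))))
    (cong₂ _+_
      (cong (ind ∘ not) (trans (cong (λ z → V y == V′ z) (insert-at y y′ τ)) (trans (cong (V y ==_) (sym e)) (==-refl (V y)))))
      (count-cong (λ x → cong (λ z → not (V (punchIn y x) == V′ z)) (Perm.insert-punchIn y y′ τ x))))))) s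

-- Without a collision every colour is reached, in one of the two samples, from exceptional indices
-- only. By closeness, K times its class in the first sample is then at most K times the exceptional
-- indices of that colour plus 2L. Summing over the colours gives K·L ≤ K·L/2 + 2·W·L, against 4·W <
-- K.
collision : ∀ {W L} K (u₁ u₂ : Fin L → Fin W) (e₁ e₂ : Fin L → Bool) →
  4 * W < K → 0 < L → 4 * count e₁ ≤ L → 4 * count e₂ ≤ L →
  (∀ v → K * count (λ i → u₁ i == v) ≤ K * count (λ i → u₂ i == v) + 2 * L) →
  ∃ λ i₁ → ∃ λ i₂ → e₁ i₁ ≡ false × e₂ i₂ ≡ false × u₁ i₁ ≡ u₂ i₂
collision {W} {L} K u₁ u₂ e₁ e₂ W<K 0<L s₁ s₂ close
  with any? (λ i₁ → any? (λ i₂ → (e₁ i₁ ≟ᵇ false) ×-dec ((e₂ i₂ ≟ᵇ false) ×-dec (u₁ i₁ ≟ u₂ i₂))))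
... | yes r = r
... | no none = contradiction big (<⇒≱ W<K)
  where
  open ≤-Reasoning
  x₁ x₂ : Fin W → ℕ
  x₁ v = count (λ i → e₁ i ∧ (u₁ i == v))
  x₂ v = count (λ i → e₂ i ∧ (u₂ i == v))
  all-exc : (e : Fin L → Bool) (u : Fin L → Fin W) (v : Fin W) → (∀ i → e i ≡ false → u i ≢ v) →
    count (λ i → u i == v) ≤ count (λ i → e i ∧ (u i == v))
  all-exc e u v h = sum-mono pw
    where
    pw : ∀ i → ind (u i == v) ≤ ind (e i ∧ (u i == v))
    pw i with e i | h i
    ... | true  | _ = ≤-refl
    ... | false | n = ≤-reflexive (cong ind (==-false (n refl)))
  class : ∀ v → K * count (λ i → u₁ i == v) ≤ K * x₁ v + K * x₂ v + 2 * L
  class v with any? (λ i → (e₁ i ≟ᵇ false) ×-dec (u₁ i ≟ v))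
  ... | yes (i , ei , refl) = ≤-trans (close v) (+-monoˡ-≤ (2 * L) (≤-trans
          (*-monoʳ-≤ K (all-exc e₂ u₂ v (λ i₂ e2 uv → none (i , i₂ , ei , e2 , sym uv)))) (m≤n+m (K * x₂ v) (K * x₁ v))))
  ... | no nv = ≤-trans (*-monoʳ-≤ K (all-exc e₁ u₁ v (λ i ei uv → nv (i , ei , uv)))) (≤-trans (m≤m+n _ _) (m≤m+n _ _))
  exc : (e : Fin L → Bool) (u : Fin L → Fin W) → sum (λ v → count (λ i → e i ∧ (u i == v))) ≤ count e
  exc e u = ≤-trans (≤-reflexive (∑-comm (λ v i → ind (e i ∧ (u i == v))))) (sum-mono pw)
    where
    pw : ∀ i → sum (λ v → ind (e i ∧ (u i == v))) ≤ ind (e i)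
    pw i with e i
    ... | true  = ≤-reflexive (sum-point (u i))
    ... | false = ≤-reflexive (sum-zero {W} (λ _ → refl))
  total : K * L ≤ K * count e₁ + K * count e₂ + W * (2 * L)
  total = begin
    K * L  ≡⟨ cong (K *_) (sum-fibres u₁) ⟨
    K * sum (λ v → count (λ i → u₁ i == v))  ≡⟨ sum-*ˡ K (λ v → count (λ i → u₁ i == v)) ⟨
    sum (λ v → K * count (λ i → u₁ i == v))  ≤⟨ sum-mono class ⟩
    sum (λ v → K * x₁ v + K * x₂ v + 2 * L)  ≡⟨ ∑-distrib-+ (λ v → K * x₁ v + K * x₂ v) (λ _ → 2 * L) ⟩
    sum (λ v → K * x₁ v + K * x₂ v) + sum {W} (λ _ → 2 * L)  ≡⟨ cong₂ _+_ (trans (∑-distrib-+ (λ v → K * x₁ v) (λ v → K * x₂ v)) (cong₂ _+_ (sum-*ˡ K x₁) (sum-*ˡ K x₂))) (sum-const W (2 * L)) ⟩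
    K * sum x₁ + K * sum x₂ + W * (2 * L)  ≤⟨ +-monoˡ-≤ _ (+-mono-≤ (*-monoʳ-≤ K (exc e₁ u₁)) (*-monoʳ-≤ K (exc e₂ u₂))) ⟩
    K * count e₁ + K * count e₂ + W * (2 * L)  ∎
  r₁ : ∀ K L → 2 * L * K + 2 * L * K ≡ 4 * (K * L)
  r₁ = solve-∀
  r₂ : ∀ K a b W L → 4 * (K * a + K * b + W * (2 * L)) ≡ K * (4 * a) + K * (4 * b) + 2 * L * (4 * W)
  r₂ = solve-∀
  r₃ : ∀ K L x → K * L + K * L + x ≡ 2 * L * K + x
  r₃ = solve-∀
  big : K ≤ 4 * W
  big = *-cancelˡ-≤ (2 * L) {{m*n≢0 2 L {{_}} {{>-nonZero 0<L}}}} (+-cancelˡ-≤ (2 * L * K) _ _ (begin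
    2 * L * K + 2 * L * K  ≡⟨ r₁ K L ⟩
    4 * (K * L)  ≤⟨ *-monoʳ-≤ 4 total ⟩
    4 * (K * count e₁ + K * count e₂ + W * (2 * L))  ≡⟨ r₂ K (count e₁) (count e₂) W L ⟩
    K * (4 * count e₁) + K * (4 * count e₂) + 2 * L * (4 * W)  ≤⟨ +-monoˡ-≤ _ (+-mono-≤ (*-monoʳ-≤ K s₁) (*-monoʳ-≤ K s₂)) ⟩
    K * L + K * L + 2 * L * (4 * W)  ≡⟨ r₃ K L _ ⟩
    2 * L * K + 2 * L * (4 * W)  ∎))

most-constant : ∀ {K q w} {B : Set} {P : Fin q → Set} (φ : Fin q → B) → B → (∀ {y y′} → P y → P y′ → φ y ≡ φ y′) →
  Most K w P → ∃ λ C → Most K w (λ y → φ y ≡ C)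
most-constant φ default h (most bad small holds) with any? (λ y → bad y ≟ᵇ false)
... | yes (y₀ , e₀) = φ y₀ , most bad small (λ y e → h (holds y e) (holds y₀ e₀))
-- Every point is exceptional here, so any value serves.
... | no none       = default , most bad small (λ y e → contradiction (y , e) none)

-- Sums over tuples and the second moment of a random sample

sumT : ∀ {q} L → (Vec (Fin q) L → ℕ) → ℕ
sumT zero    φ = φ []
sumT (suc L) φ = sum (λ x → sumT L (λ c → φ (x ∷ c)))

sumT-mono : ∀ {q} L {φ ψ : Vec (Fin q) L → ℕ} → (∀ c → φ c ≤ ψ c) → sumT L φ ≤ sumT L ψ
sumT-mono zero    h = h []
sumT-mono (suc L) h = sum-mono (λ x → sumT-mono L (λ c → h (x ∷ c)))

sumT-cong : ∀ {q} L {φ ψ : Vec (Fin q) L → ℕ} → (∀ c → φ c ≡ ψ c) → sumT L φ ≡ sumT L ψ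
sumT-cong zero    h = h []
sumT-cong (suc L) h = sum-cong-≗ (λ x → sumT-cong L (λ c → h (x ∷ c)))

sumT-*ˡ : ∀ {q} L k (φ : Vec (Fin q) L → ℕ) → sumT L (λ c → k * φ c) ≡ k * sumT L φ
sumT-*ˡ zero    k φ = refl
sumT-*ˡ (suc L) k φ = trans (sum-cong-≗ (λ x → sumT-*ˡ L k (λ c → φ (x ∷ c)))) (sum-*ˡ k (λ x → sumT L (λ c → φ (x ∷ c))))

sumT-+ : ∀ {q} L (φ ψ : Vec (Fin q) L → ℕ) → sumT L (λ c → φ c + ψ c) ≡ sumT L φ + sumT L ψ
sumT-+ zero    φ ψ = refl
sumT-+ (suc L) φ ψ = trans (sum-cong-≗ (λ x → sumT-+ L (λ c → φ (x ∷ c)) (λ c → ψ (x ∷ c)))) (∑-distrib-+ (λ x → sumT L (λ c → φ (x ∷ c))) (λ x → sumT L (λ c → ψ (x ∷ c))))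

sumT-const : ∀ {q} L k → sumT {q} L (λ _ → k) ≡ q ^ L * k
sumT-const {q} zero    k = sym (*-identityˡ k)
sumT-const {q} (suc L) k = trans (sum-cong-≗ {q} (λ x → sumT-const L k)) (trans (sum-const q (q ^ L * k)) (sym (*-assoc q (q ^ L) k)))

sumT-sum : ∀ {q n} L (φ : Vec (Fin q) L → Fin n → ℕ) → sumT L (λ c → sum (φ c)) ≡ sum (λ y → sumT L (λ c → φ c y))
sumT-sum zero    φ = refl
sumT-sum (suc L) φ = trans (sum-cong-≗ (λ x → sumT-sum L (λ c → φ (x ∷ c)))) (∑-comm (λ x y → sumT L (λ c → φ (x ∷ c) y)))

sumT-++ : ∀ {q} L M (φ : Vec (Fin q) (L + M) → ℕ) → sumT (L + M) φ ≡ sumT L (λ c → sumT M (λ a → φ (c ++ a)))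
sumT-++ zero    M φ = refl
sumT-++ (suc L) M φ = sum-cong-≗ (λ x → sumT-++ L M (λ c → φ (x ∷ c)))

sumT-comm : ∀ {q} L M (φ : Vec (Fin q) L → Vec (Fin q) M → ℕ) → sumT L (λ c → sumT M (φ c)) ≡ sumT M (λ a → sumT L (λ c → φ c a))
sumT-comm zero    M φ = refl
sumT-comm (suc L) M φ = trans (sum-cong-≗ (λ x → sumT-comm L M (λ c → φ (x ∷ c)))) (sym (sumT-sum M (λ a x → sumT L (λ c → φ (x ∷ c) a))))

module _ where
  open import Data.Integer using (+_)

  sq : ℤ → ℕ
  sq z = ∣ z ∣ * ∣ z ∣

  sq-* : ∀ z → + sq z ≡ z ℤ.* z
  sq-* (+ n)     = ℤ.pos-* n n
  sq-* -[1+ n ]  = refl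

  sumℤ : ∀ {n} → (Fin n → ℤ) → ℤ
  sumℤ {zero}  ξ = + 0
  sumℤ {suc n} ξ = ξ zero ℤ.+ sumℤ (ξ ∘ suc)

  sum-sq-shift : ∀ {n} u (ξ : Fin n → ℤ) →
    + sum (λ y → sq (u ℤ.+ ξ y)) ≡ + n ℤ.* (u ℤ.* u) ℤ.+ + 2 ℤ.* u ℤ.* sumℤ ξ ℤ.+ + sum (λ y → sq (ξ y))
  sum-sq-shift {zero}  u ξ = r u
    where
    r : ∀ u → + 0 ≡ + 0 ℤ.* (u ℤ.* u) ℤ.+ + 2 ℤ.* u ℤ.* + 0 ℤ.+ + 0
    r = ℤ.solve-∀
  sum-sq-shift {suc n} u ξ = begin
    + (sq (u ℤ.+ ξ zero) + rest)  ≡⟨ ℤ.pos-+ (sq (u ℤ.+ ξ zero)) rest ⟩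
    + sq (u ℤ.+ ξ zero) ℤ.+ + rest  ≡⟨ cong₂ ℤ._+_ (sq-* (u ℤ.+ ξ zero)) (sum-sq-shift u (ξ ∘ suc)) ⟩
    (u ℤ.+ ξ zero) ℤ.* (u ℤ.+ ξ zero) ℤ.+ (+ n ℤ.* (u ℤ.* u) ℤ.+ + 2 ℤ.* u ℤ.* sumℤ (ξ ∘ suc) ℤ.+ + s)
                                                 ≡⟨ r u (ξ zero) (+ n) (sumℤ (ξ ∘ suc)) (+ s) ⟩
    (ℤ.suc (+ n)) ℤ.* (u ℤ.* u) ℤ.+ + 2 ℤ.* u ℤ.* (ξ zero ℤ.+ sumℤ (ξ ∘ suc)) ℤ.+ (ξ zero ℤ.* ξ zero ℤ.+ + s)
                                                 ≡⟨ cong (λ z → + suc n ℤ.* (u ℤ.* u) ℤ.+ + 2 ℤ.* u ℤ.* sumℤ ξ ℤ.+ z) (trans (cong (ℤ._+ + s) (sym (sq-* (ξ zero)))) (sym (ℤ.pos-+ (sq (ξ zero)) s))) ⟩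
    + suc n ℤ.* (u ℤ.* u) ℤ.+ + 2 ℤ.* u ℤ.* sumℤ ξ ℤ.+ + (sq (ξ zero) + s)  ∎
    where
    open ≡-Reasoning
    rest s : ℕ
    rest = sum (λ y → sq (u ℤ.+ ξ (suc y)))
    s = sum (λ y → sq (ξ (suc y)))
    r : ∀ u x n t s → (u ℤ.+ x) ℤ.* (u ℤ.+ x) ℤ.+ (n ℤ.* (u ℤ.* u) ℤ.+ + 2 ℤ.* u ℤ.* t ℤ.+ s)
        ≡ (+ 1 ℤ.+ n) ℤ.* (u ℤ.* u) ℤ.+ + 2 ℤ.* u ℤ.* (x ℤ.+ t) ℤ.+ (x ℤ.* x ℤ.+ s)
    r = ℤ.solve-∀

  sum-sq-centred : ∀ {n} u (ξ : Fin n → ℤ) → sumℤ ξ ≡ + 0 → sum (λ y → sq (u ℤ.+ ξ y)) ≡ n * sq u + sum (λ y → sq (ξ y))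
  sum-sq-centred {n} u ξ h = ℤ.+-injective (begin
    + sum (λ y → sq (u ℤ.+ ξ y))  ≡⟨ sum-sq-shift u ξ ⟩
    + n ℤ.* (u ℤ.* u) ℤ.+ + 2 ℤ.* u ℤ.* sumℤ ξ ℤ.+ s  ≡⟨ cong (λ z → + n ℤ.* (u ℤ.* u) ℤ.+ + 2 ℤ.* u ℤ.* z ℤ.+ s) h ⟩
    + n ℤ.* (u ℤ.* u) ℤ.+ + 2 ℤ.* u ℤ.* + 0 ℤ.+ s  ≡⟨ r (+ n ℤ.* (u ℤ.* u)) u s ⟩
    + n ℤ.* (u ℤ.* u) ℤ.+ s  ≡⟨ cong (λ z → + n ℤ.* z ℤ.+ s) (sym (sq-* u)) ⟩
    + n ℤ.* + sq u ℤ.+ s  ≡⟨ cong (ℤ._+ s) (sym (ℤ.pos-* n (sq u))) ⟩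
    + (n * sq u) ℤ.+ s  ≡⟨ sym (ℤ.pos-+ (n * sq u) (sum (λ y → sq (ξ y)))) ⟩
    + (n * sq u + sum (λ y → sq (ξ y)))  ∎)
    where
    open ≡-Reasoning
    s : ℤ
    s = + sum (λ y → sq (ξ y))
    r : ∀ a u s → a ℤ.+ + 2 ℤ.* u ℤ.* + 0 ℤ.+ s ≡ a ℤ.+ s
    r = ℤ.solve-∀

  ≤-abs : ∀ a b → a ≤ b + ∣ + a ℤ.- + b ∣ × b ≤ a + ∣ + a ℤ.- + b ∣
  ≤-abs a b rewrite ℤ.m-n≡m⊖n a b with ≤-total a b
  ... | inj₁ a≤b rewrite ℤ.∣⊖∣-≤ a≤b = ≤-trans a≤b (m≤m+n b _) , ≤-reflexive (sym (m+[n∸m]≡n a≤b))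
  ... | inj₂ b≤a rewrite ℤ.∣m⊖n∣≡∣n⊖m∣ a b | ℤ.∣⊖∣-≤ b≤a = ≤-reflexive (sym (m+[n∸m]≡n b≤a)) , ≤-trans b≤a (m≤m+n a _)

  hits : ∀ {q L} → (Fin q → Bool) → Vec (Fin q) L → ℕ
  hits χ []      = 0
  hits χ (x ∷ c) = ind (χ x) + hits χ c

  module _ {q : ℕ} (χ : Fin q → Bool) where

    -- The indicator minus its mean, multiplied by q to stay in the integers.
    centred : Fin q → ℤ
    centred y = + (q * ind (χ y)) ℤ.- + count χ

    sumℤ-centred : sumℤ centred ≡ + 0
    sumℤ-centred = trans (go (ind ∘ χ)) (trans (refl) (ℤ.+-inverseʳ (+ (q * count χ))))
      where
      r : ∀ a b c d → (a ℤ.- b) ℤ.+ (c ℤ.- d) ≡ (a ℤ.+ c) ℤ.- (b ℤ.+ d)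
      r = ℤ.solve-∀
      go : ∀ {n} (f : Fin n → ℕ) → sumℤ (λ y → + (q * f y) ℤ.- + count χ) ≡ + (q * sum f) ℤ.- + (n * count χ)
      go {zero}  f = sym (cong (λ z → + z ℤ.- + 0) (*-zeroʳ q))
      go {suc n} f = trans (cong (λ z → (+ (q * f zero) ℤ.- + count χ) ℤ.+ z) (go (f ∘ suc)))
        (trans (r (+ (q * f zero)) (+ count χ) (+ (q * sum (f ∘ suc))) (+ (n * count χ)))
          (cong₂ ℤ._-_ (trans (sym (ℤ.pos-+ (q * f zero) (q * sum (f ∘ suc)))) (cong +_ (sym (*-distribˡ-+ q (f zero) _)))) (sym (ℤ.pos-+ (count χ) (n * count χ)))))

    abs-diff-≤ : ∀ {a b n} → a ≤ n → b ≤ n → ∣ + a ℤ.- + b ∣ ≤ n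
    abs-diff-≤ {a} {b} {n} ha hb = ≤-trans (≤-reflexive (trans (cong ∣_∣ (ℤ.m-n≡m⊖n a b)) (ℤ.∣m⊖n∣≡∣n⊖m∣ a b))) (≤-trans (ℤ.∣m⊝n∣≤m⊔n b a) (⊔-lub hb ha))

    deviation : ∀ {L} → Vec (Fin q) L → ℤ
    deviation {L} c = + (q * hits χ c) ℤ.- + (L * count χ)

    deviation-∷ : ∀ {L} u x (c : Vec (Fin q) L) → u ℤ.+ deviation (x ∷ c) ≡ (u ℤ.+ centred x) ℤ.+ deviation c
    deviation-∷ {L} u x c = trans (cong₂ (λ a b → u ℤ.+ (a ℤ.- b)) (trans (cong +_ (*-distribˡ-+ q (ind (χ x)) (hits χ c))) (ℤ.pos-+ (q * ind (χ x)) (q * hits χ c))) (ℤ.pos-+ (count χ) (L * count χ)))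
      (r u (+ (q * ind (χ x))) (+ (q * hits χ c)) (+ count χ) (+ (L * count χ)))
      where
      r : ∀ u a b c d → u ℤ.+ ((a ℤ.+ b) ℤ.- (c ℤ.+ d)) ≡ (u ℤ.+ (a ℤ.- c)) ℤ.+ (b ℤ.- d)
      r = ℤ.solve-∀

    -- The offset u collects the entries already drawn, which is what the induction on the length
    -- needs. The centred values sum to zero, so the cross term disappears and each draw adds at
    -- most q² to the mean square.
    variance : ∀ L u → sumT L (λ c → sq (u ℤ.+ deviation c)) ≤ q ^ L * (sq u + L * (q * q))
    variance zero u = ≤-reflexive (trans (cong sq (trans (cong (λ z → u ℤ.+ (+ z ℤ.- + 0)) (*-zeroʳ q)) (ℤ.+-identityʳ u))) (sym (trans (*-identityˡ _) (+-identityʳ (sq u)))))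
    variance (suc L) u = begin
      sum (λ x → sumT L (λ c → sq (u ℤ.+ deviation (x ∷ c))))  ≡⟨ sum-cong-≗ (λ x → sumT-cong L (λ c → cong sq (deviation-∷ u x c))) ⟩
      sum (λ x → sumT L (λ c → sq ((u ℤ.+ centred x) ℤ.+ deviation c)))  ≤⟨ sum-mono (λ x → variance L (u ℤ.+ centred x)) ⟩
      sum (λ x → q ^ L * (sq (u ℤ.+ centred x) + L * (q * q)))  ≡⟨ sum-*ˡ (q ^ L) (λ x → sq (u ℤ.+ centred x) + L * (q * q)) ⟩
      q ^ L * sum (λ x → sq (u ℤ.+ centred x) + L * (q * q))  ≡⟨ cong (q ^ L *_) (∑-distrib-+ (λ x → sq (u ℤ.+ centred x)) (λ _ → L * (q * q))) ⟩
      q ^ L * (sum (λ x → sq (u ℤ.+ centred x)) + sum {q} (λ _ → L * (q * q)))  ≡⟨ cong₂ (λ a b → q ^ L * (a + b)) (sum-sq-centred u centred sumℤ-centred) (sum-const q (L * (q * q))) ⟩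
      q ^ L * (q * sq u + sum (λ x → sq (centred x)) + q * (L * (q * q)))  ≤⟨ *-monoʳ-≤ (q ^ L) (+-monoˡ-≤ (q * (L * (q * q))) (+-monoʳ-≤ (q * sq u) (sum-≤-const (q * q) (λ x → *-mono-≤ (small x) (small x))))) ⟩
      q ^ L * (q * sq u + q * (q * q) + q * (L * (q * q)))  ≡⟨ r (q ^ L) q (sq u) L ⟩
      q * q ^ L * (sq u + suc L * (q * q))  ∎
      where
      open ≤-Reasoning
      r : ∀ Q q s L → Q * (q * s + q * (q * q) + q * (L * (q * q))) ≡ q * Q * (s + (1 + L) * (q * q))
      r = solve-∀
      small : ∀ x → ∣ centred x ∣ ≤ q
      small x = abs-diff-≤ (≤-trans (*-monoʳ-≤ q (ind-≤1 (χ x))) (≤-reflexive (*-identityʳ q))) (count-≤ χ)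

    -- After division by L·q: the frequency of χ in the sample differs from its density by more than
    -- 1/K.
    far : ∀ {L} → ℕ → Vec (Fin q) L → Bool
    far {L} K c = does (L * q <? K * ∣ deviation c ∣)

    -- The mean square of the deviation is at most L·q², and a far sample has a square above
    -- (L·q/K)²; so far samples make up a fraction at most K²/L.
    chebyshev : ∀ K L → 0 < q → 0 < L → L * sumT L (λ c → ind (far K c)) ≤ K * K * q ^ L
    chebyshev K L 0<q 0<L = *-cancelˡ-≤ (L * (q * q)) {{m*n≢0 L (q * q) {{>-nonZero 0<L}} {{m*n≢0 q q {{>-nonZero 0<q}} {{>-nonZero 0<q}}}}}} (begin
      L * (q * q) * (L * sumT L (λ c → ind (far K c)))  ≡⟨ r₁ L q _ ⟩
      L * q * (L * q) * sumT L (λ c → ind (far K c))  ≡⟨ sumT-*ˡ L (L * q * (L * q)) (λ c → ind (far K c)) ⟨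
      sumT L (λ c → L * q * (L * q) * ind (far K c))  ≤⟨ sumT-mono L (λ c → *-ind-≤ (L * q <? K * ∣ deviation c ∣) (λ lt → ≤-trans (*-mono-≤ (<⇒≤ lt) (<⇒≤ lt)) (≤-reflexive (r₂ K ∣ deviation c ∣)))) ⟩
      sumT L (λ c → K * K * sq (deviation c))  ≡⟨ sumT-*ˡ L (K * K) (λ c → sq (deviation c)) ⟩
      K * K * sumT L (λ c → sq (deviation c))  ≡⟨ cong (K * K *_) (sumT-cong L (λ c → cong sq (sym (ℤ.+-identityˡ (deviation c))))) ⟩
      K * K * sumT L (λ c → sq (+ 0 ℤ.+ deviation c))  ≤⟨ *-monoʳ-≤ (K * K) (variance L (+ 0)) ⟩
      K * K * (q ^ L * (L * (q * q)))  ≡⟨ r₃ (K * K) (q ^ L) (L * (q * q)) ⟩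
      L * (q * q) * (K * K * q ^ L)  ∎)
      where
      open ≤-Reasoning
      r₁ : ∀ L q s → L * (q * q) * (L * s) ≡ L * q * (L * q) * s
      r₁ = solve-∀
      r₂ : ∀ K d → K * d * (K * d) ≡ K * K * (d * d)
      r₂ = solve-∀
      r₃ : ∀ a b c → a * (b * c) ≡ c * (a * b)
      r₃ = solve-∀

    near-bounds : ∀ {L} K (c : Vec (Fin q) L) → far K c ≡ false →
      K * (q * hits χ c) ≤ K * (L * count χ) + L * q × K * (L * count χ) ≤ K * (q * hits χ c) + L * q
    near-bounds {L} K c h = bound (proj₁ (≤-abs A B)) , bound (proj₂ (≤-abs A B))
      where
      A B : ℕ
      A = q * hits χ c
      B = L * count χ
      bound : ∀ {x z} → x ≤ z + ∣ + A ℤ.- + B ∣ → K * x ≤ K * z + L * q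
      bound {x} {z} le = ≤-trans (*-monoʳ-≤ K le) (≤-trans (≤-reflexive (*-distribˡ-+ K z _)) (+-monoʳ-≤ (K * z) (≮⇒≥ (does-false (L * q <? K * ∣ deviation c ∣) h))))

-- Arithmetic modulo p and difference operators

module Modular (p-1 : ℕ) where

  p : ℕ
  p = suc p-1

  F : Set
  F = Fin p

  infixl 6 _⊕_ _⊝_
  infixl 7 _⊗_
  infix 8 ⊖_

  abstract
    [_] : ℕ → F
    [ n ] = fromℕ< (m%n<n n p)

    toℕ-[] : ∀ n → toℕ [ n ] ≡ n % p
    toℕ-[] n = toℕ-fromℕ< (m%n<n n p)

    []-cong : ∀ m n → m % p ≡ n % p → [ m ] ≡ [ n ]
    []-cong m n e = toℕ-injective (trans (toℕ-[] m) (trans e (sym (toℕ-[] n))))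

    []-toℕ : ∀ a → [ toℕ a ] ≡ a
    []-toℕ a = toℕ-injective (trans (toℕ-[] (toℕ a)) (m<n⇒m%n≡m (toℕ<n a)))

    _⊕_ _⊗_ : F → F → F
    a ⊕ b = [ toℕ a + toℕ b ]
    a ⊗ b = [ toℕ a * toℕ b ]

    ⊖_ : F → F
    ⊖ a = [ p ∸ toℕ a ]

  0F 1F : F
  0F = [ 0 ]
  1F = [ 1 ]

  abstract
    []-+ : ∀ m n → [ m + n ] ≡ [ m ] ⊕ [ n ]
    []-+ m n = []-cong (m + n) (toℕ [ m ] + toℕ [ n ]) (trans (%-distribˡ-+ m n p) (cong₂ (λ a b → (a + b) % p) (sym (toℕ-[] m)) (sym (toℕ-[] n))))

    []-* : ∀ m n → [ m * n ] ≡ [ m ] ⊗ [ n ]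
    []-* m n = []-cong (m * n) (toℕ [ m ] * toℕ [ n ]) (trans (%-distribˡ-* m n p) (cong₂ (λ a b → (a * b) % p) (sym (toℕ-[] m)) (sym (toℕ-[] n))))

    toℕ-⊕ : ∀ a b → toℕ (a ⊕ b) ≡ (toℕ a + toℕ b) % p
    toℕ-⊕ a b = toℕ-[] (toℕ a + toℕ b)

    toℕ-⊗ : ∀ a b → toℕ (a ⊗ b) ≡ (toℕ a * toℕ b) % p
    toℕ-⊗ a b = toℕ-[] (toℕ a * toℕ b)

    ⊕-comm : ∀ a b → a ⊕ b ≡ b ⊕ a
    ⊕-comm a b = cong [_] (+-comm (toℕ a) (toℕ b))

    ⊗-comm : ∀ a b → a ⊗ b ≡ b ⊗ a
    ⊗-comm a b = cong [_] (*-comm (toℕ a) (toℕ b))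

    ⊕-assoc : ∀ a b c → (a ⊕ b) ⊕ c ≡ a ⊕ (b ⊕ c)
    ⊕-assoc a b c = begin
      (a ⊕ b) ⊕ c  ≡⟨ cong ((a ⊕ b) ⊕_) ([]-toℕ c) ⟨
      (a ⊕ b) ⊕ [ toℕ c ]  ≡⟨ []-+ (toℕ a + toℕ b) (toℕ c) ⟨
      [ toℕ a + toℕ b + toℕ c ]  ≡⟨ cong [_] (+-assoc (toℕ a) (toℕ b) (toℕ c)) ⟩
      [ toℕ a + (toℕ b + toℕ c) ]  ≡⟨ []-+ (toℕ a) (toℕ b + toℕ c) ⟩
      [ toℕ a ] ⊕ (b ⊕ c)  ≡⟨ cong (_⊕ (b ⊕ c)) ([]-toℕ a) ⟩
      a ⊕ (b ⊕ c)  ∎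
      where open ≡-Reasoning

    ⊗-assoc : ∀ a b c → (a ⊗ b) ⊗ c ≡ a ⊗ (b ⊗ c)
    ⊗-assoc a b c = begin
      (a ⊗ b) ⊗ c  ≡⟨ cong ((a ⊗ b) ⊗_) ([]-toℕ c) ⟨
      (a ⊗ b) ⊗ [ toℕ c ]  ≡⟨ []-* (toℕ a * toℕ b) (toℕ c) ⟨
      [ toℕ a * toℕ b * toℕ c ]  ≡⟨ cong [_] (*-assoc (toℕ a) (toℕ b) (toℕ c)) ⟩
      [ toℕ a * (toℕ b * toℕ c) ]  ≡⟨ []-* (toℕ a) (toℕ b * toℕ c) ⟩
      [ toℕ a ] ⊗ (b ⊗ c)  ≡⟨ cong (_⊗ (b ⊗ c)) ([]-toℕ a) ⟩
      a ⊗ (b ⊗ c)  ∎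
      where open ≡-Reasoning

    ⊗-distribˡ : ∀ a b c → a ⊗ (b ⊕ c) ≡ (a ⊗ b) ⊕ (a ⊗ c)
    ⊗-distribˡ a b c = begin
      a ⊗ (b ⊕ c)  ≡⟨ cong (_⊗ (b ⊕ c)) ([]-toℕ a) ⟨
      [ toℕ a ] ⊗ (b ⊕ c)  ≡⟨ []-* (toℕ a) (toℕ b + toℕ c) ⟨
      [ toℕ a * (toℕ b + toℕ c) ]  ≡⟨ cong [_] (*-distribˡ-+ (toℕ a) (toℕ b) (toℕ c)) ⟩
      [ toℕ a * toℕ b + toℕ a * toℕ c ]  ≡⟨ []-+ (toℕ a * toℕ b) (toℕ a * toℕ c) ⟩
      (a ⊗ b) ⊕ (a ⊗ c)  ∎
      where open ≡-Reasoning

    ⊕-identityˡ : ∀ a → 0F ⊕ a ≡ a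
    ⊕-identityˡ a = []-toℕ a

    ⊗-identityˡ : ∀ a → 1F ⊗ a ≡ a
    ⊗-identityˡ a = begin
      1F ⊗ a  ≡⟨ cong (1F ⊗_) ([]-toℕ a) ⟨
      [ 1 ] ⊗ [ toℕ a ]  ≡⟨ []-* 1 (toℕ a) ⟨
      [ 1 * toℕ a ]  ≡⟨ cong [_] (*-identityˡ (toℕ a)) ⟩
      [ toℕ a ]  ≡⟨ []-toℕ a ⟩
      a  ∎
      where open ≡-Reasoning

    ⊕-inverseʳ : ∀ a → a ⊕ ⊖ a ≡ 0F
    ⊕-inverseʳ a = begin
      a ⊕ ⊖ a  ≡⟨ cong (_⊕ ⊖ a) ([]-toℕ a) ⟨
      [ toℕ a ] ⊕ [ p ∸ toℕ a ]  ≡⟨ []-+ (toℕ a) (p ∸ toℕ a) ⟨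
      [ toℕ a + (p ∸ toℕ a) ]  ≡⟨ cong [_] (m+[n∸m]≡n (<⇒≤ (toℕ<n a))) ⟩
      [ p ]  ≡⟨ []-cong p 0 (n%n≡0 p) ⟩
      0F  ∎
      where open ≡-Reasoning

  _⊝_ : F → F → F
  a ⊝ b = a ⊕ ⊖ b

  F-ring : CommutativeRing 0ℓ 0ℓ
  F-ring = record
    { Carrier = F ; _≈_ = _≡_ ; _+_ = _⊕_ ; _*_ = _⊗_ ; -_ = ⊖_ ; 0# = 0F ; 1# = 1F
    ; isCommutativeRing = record
      { isRing = record
        { +-isAbelianGroup = record
          { isGroup = record
            { isMonoid = record
              { isSemigroup = record
                { isMagma = record { isEquivalence = isEquivalence ; ∙-cong = cong₂ _⊕_ }
                ; assoc = ⊕-assoc }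
              ; identity = ⊕-identityˡ , λ a → trans (⊕-comm a 0F) (⊕-identityˡ a) }
            ; inverse = (λ a → trans (⊕-comm (⊖ a) a) (⊕-inverseʳ a)) , ⊕-inverseʳ
            ; ⁻¹-cong = cong ⊖_ }
          ; comm = ⊕-comm }
        ; *-cong = cong₂ _⊗_
        ; *-assoc = ⊗-assoc
        ; *-identity = ⊗-identityˡ , λ a → trans (⊗-comm a 1F) (⊗-identityˡ a)
        ; distrib = ⊗-distribˡ , λ a b c → trans (⊗-comm (b ⊕ c) a) (trans (⊗-distribˡ a b c) (cong₂ _⊕_ (⊗-comm a b) (⊗-comm a c)))
        }
      ; *-comm = ⊗-comm } }

  F-acr : AlmostCommutativeRing 0ℓ 0ℓ
  F-acr = fromCommutativeRing F-ring (λ _ → nothing)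

  import Algebra.Properties.Ring (CommutativeRing.ring F-ring) as RingProperties

  ⊝-interchange : ∀ a b c d → (a ⊝ b) ⊝ (c ⊝ d) ≡ (a ⊝ c) ⊝ (b ⊝ d)
  ⊝-interchange = Tactic.RingSolver.solve-∀ F-acr

  ⊕-⊝-interchange : ∀ a b c d → (a ⊕ b) ⊝ (c ⊕ d) ≡ (a ⊝ c) ⊕ (b ⊝ d)
  ⊕-⊝-interchange = Tactic.RingSolver.solve-∀ F-acr

  ⊕-0ʳ : ∀ a → a ⊕ 0F ≡ a
  ⊕-0ʳ a = trans (⊕-comm a 0F) (⊕-identityˡ a)

  ⊕-cancel-⊝ : ∀ a b → (a ⊕ b) ⊝ b ≡ a
  ⊕-cancel-⊝ a b = trans (⊕-assoc a b (⊖ b)) (trans (cong (a ⊕_) (⊕-inverseʳ b)) (⊕-0ʳ a))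

  ⊝-cancel-⊕ : ∀ a b → (a ⊝ b) ⊕ b ≡ a
  ⊝-cancel-⊕ a b = trans (⊕-assoc a (⊖ b) b) (trans (cong (a ⊕_) (trans (⊕-comm (⊖ b) b) (⊕-inverseʳ b))) (⊕-0ʳ a))

  ⊝-self : ∀ a → a ⊝ a ≡ 0F
  ⊝-self = ⊕-inverseʳ

  ⊝-0ʳ : ∀ a → a ⊝ 0F ≡ a
  ⊝-0ʳ a = trans (sym (cong (_⊝ 0F) (⊕-0ʳ a))) (⊕-cancel-⊝ a 0F)

  ⊕-cancelʳ : ∀ {a b c} → a ⊕ c ≡ b ⊕ c → a ≡ b
  ⊕-cancelʳ {a} {b} {c} e = trans (sym (⊕-cancel-⊝ a c)) (trans (cong (_⊝ c) e) (⊕-cancel-⊝ b c))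

  ⊝-≡0 : ∀ {a b} → a ⊝ b ≡ 0F → a ≡ b
  ⊝-≡0 {a} {b} e = trans (sym (⊝-cancel-⊕ a b)) (trans (cong (_⊕ b) e) (⊕-identityˡ b))

  ⊝-⊕-assoc : ∀ a b c → (a ⊝ b) ⊕ c ≡ a ⊕ (c ⊝ b)
  ⊝-⊕-assoc = Tactic.RingSolver.solve-∀ F-acr

  ⊝-transpose : ∀ {a b c e} → a ⊝ b ≡ c ⊝ e → c ≡ a ⊕ (e ⊝ b)
  ⊝-transpose {a} {b} {c} {e} h = trans (sym (⊝-cancel-⊕ c e)) (trans (cong (_⊕ e) (sym h)) (⊝-⊕-assoc a b e))

  ⊗-zeroˡ : ∀ a → 0F ⊗ a ≡ 0F
  ⊗-zeroˡ = CommutativeRing.zeroˡ F-ring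

  ⊗-zeroʳ : ∀ a → a ⊗ 0F ≡ 0F
  ⊗-zeroʳ = CommutativeRing.zeroʳ F-ring

  ⊗-identityʳ : ∀ a → a ⊗ 1F ≡ a
  ⊗-identityʳ = CommutativeRing.*-identityʳ F-ring

  ⊗-distrib-⊝ : ∀ a b c → a ⊗ (b ⊝ c) ≡ a ⊗ b ⊝ a ⊗ c
  ⊗-distrib-⊝ a b c = trans (⊗-distribˡ a b (⊖ c)) (cong (a ⊗ b ⊕_) (sym (RingProperties.-‿distribʳ-* a c)))

  ⊝-split : ∀ x s r → x ⊝ r ≡ (x ⊝ s) ⊕ (s ⊝ r)
  ⊝-split x s r = sym (trans (sym (⊕-assoc (x ⊝ s) s (⊖ r))) (cong (_⊕ ⊖ r) (⊝-cancel-⊕ x s)))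

  ⊗-leibniz : ∀ a b c e → a ⊗ b ⊝ c ⊗ e ≡ a ⊗ (b ⊝ e) ⊕ (a ⊝ c) ⊗ e
  ⊗-leibniz a b c e = begin
    a ⊗ b ⊝ c ⊗ e  ≡⟨ ⊝-split (a ⊗ b) (a ⊗ e) (c ⊗ e) ⟩
    (a ⊗ b ⊝ a ⊗ e) ⊕ (a ⊗ e ⊝ c ⊗ e)  ≡⟨ cong₂ _⊕_ (sym (⊗-distrib-⊝ a b e)) (cong₂ _⊝_ (⊗-comm a e) (⊗-comm c e)) ⟩
    a ⊗ (b ⊝ e) ⊕ (e ⊗ a ⊝ e ⊗ c)  ≡⟨ cong (a ⊗ (b ⊝ e) ⊕_) (trans (sym (⊗-distrib-⊝ e a c)) (⊗-comm e (a ⊝ c))) ⟩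
    a ⊗ (b ⊝ e) ⊕ (a ⊝ c) ⊗ e  ∎
    where open ≡-Reasoning

  affine-recentre : ∀ a u v b → a ⊕ (u ⊕ v) ⊗ b ≡ (a ⊕ v ⊗ b) ⊕ u ⊗ b
  affine-recentre = Tactic.RingSolver.solve-∀ F-acr

  quadratic-recentre : ∀ a u v b c → a ⊕ (u ⊕ v) ⊗ (b ⊕ u ⊗ c) ≡ (a ⊕ v ⊗ b) ⊕ u ⊗ (b ⊕ (u ⊕ v) ⊗ c)
  quadratic-recentre = Tactic.RingSolver.solve-∀ F-acr

  ⊗-affine : ∀ a b u c → a ⊗ (b ⊕ u ⊗ c) ≡ a ⊗ b ⊕ u ⊗ (a ⊗ c)
  ⊗-affine = Tactic.RingSolver.solve-∀ F-acr

  ⊕-affine : ∀ a a′ u c c′ → (a ⊕ u ⊗ c) ⊕ (a′ ⊕ u ⊗ c′) ≡ (a ⊕ a′) ⊕ u ⊗ (c ⊕ c′)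
  ⊕-affine = Tactic.RingSolver.solve-∀ F-acr

  -- With u = 1 and f the falling factorial of length m at l, this is the discrete form of the rule
  -- that differentiates a power of exponent m + 1.
  falling-identity : ∀ l u m f → (l ⊕ u) ⊗ f ⊝ f ⊗ (l ⊝ m) ≡ (m ⊕ u) ⊗ f
  falling-identity l u m f = begin
    (l ⊕ u) ⊗ f ⊝ f ⊗ (l ⊝ m)  ≡⟨ cong (_⊝ f ⊗ (l ⊝ m)) (⊗-comm (l ⊕ u) f) ⟩
    f ⊗ (l ⊕ u) ⊝ f ⊗ (l ⊝ m)  ≡⟨ ⊗-distrib-⊝ f (l ⊕ u) (l ⊝ m) ⟨
    f ⊗ ((l ⊕ u) ⊝ (l ⊝ m))  ≡⟨ cong (f ⊗_) (⊕-⊝-interchange l u l (⊖ m)) ⟩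
    f ⊗ ((l ⊝ l) ⊕ (u ⊝ ⊖ m))  ≡⟨ cong₂ (λ a b → f ⊗ (a ⊕ (u ⊕ b))) (⊝-self l) (RingProperties.-‿involutive m) ⟩
    f ⊗ (0F ⊕ (u ⊕ m))  ≡⟨ cong (f ⊗_) (trans (⊕-identityˡ (u ⊕ m)) (⊕-comm u m)) ⟩
    f ⊗ (m ⊕ u)  ≡⟨ ⊗-comm f (m ⊕ u) ⟩
    (m ⊕ u) ⊗ f  ∎
    where open ≡-Reasoning

  diff : ℕ → (ℕ → F) → ℕ → F
  diff zero    h k = h k
  diff (suc i) h k = diff i h (suc k) ⊝ diff i h k

  mul : ∀ {A : Set} → (A → A → A) → A → ℕ → A → A
  mul _∙_ ε zero    x = ε
  mul _∙_ ε (suc n) x = x ∙ mul _∙_ ε n x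

  -- A vector space over F given by its addition alone, scalars acting by repeated addition. Both
  -- `Vec F t`, where polynomials live, and `Fin q`, where points are counted, carry this structure.
  record VectorGroup (A : Set) : Set where
    infixl 6 _∙_
    field
      _∙_       : A → A → A
      ε         : A
      inv       : A → A
      ∙-assoc   : ∀ x y z → (x ∙ y) ∙ z ≡ x ∙ (y ∙ z)
      ∙-comm    : ∀ x y → x ∙ y ≡ y ∙ x
      ∙-idʳ     : ∀ x → x ∙ ε ≡ x
      ∙-invʳ    : ∀ x → x ∙ inv x ≡ ε
      torsion   : ∀ x → mul _∙_ ε p x ≡ ε

  module Linear {A : Set} (G : VectorGroup A) where
    open VectorGroup G public

    infixr 7 _·_
    _·_ : ℕ → A → A
    n · x = mul _∙_ ε n x

    ∙-idˡ : ∀ x → ε ∙ x ≡ x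
    ∙-idˡ x = trans (∙-comm ε x) (∙-idʳ x)

    ∙-swapʳ : ∀ x y z → (x ∙ y) ∙ z ≡ (x ∙ z) ∙ y
    ∙-swapʳ x y z = trans (∙-assoc x y z) (trans (cong (x ∙_) (∙-comm y z)) (sym (∙-assoc x z y)))

    ∙-middle : ∀ a b c d → (a ∙ b) ∙ (c ∙ d) ≡ (a ∙ c) ∙ (b ∙ d)
    ∙-middle a b c d = trans (∙-assoc a b (c ∙ d)) (trans (cong (a ∙_) (trans (sym (∙-assoc b c d)) (trans (cong (_∙ d) (∙-comm b c)) (∙-assoc c b d)))) (sym (∙-assoc a c (b ∙ d))))

    ·-+ : ∀ m n x → (m + n) · x ≡ m · x ∙ n · x
    ·-+ zero    n x = sym (∙-idˡ (n · x))
    ·-+ (suc m) n x = trans (cong (x ∙_) (·-+ m n x)) (sym (∙-assoc x (m · x) (n · x)))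

    ·-*p : ∀ k x → (k * p) · x ≡ ε
    ·-*p zero    x = refl
    ·-*p (suc k) x = trans (·-+ p (k * p) x) (trans (cong₂ _∙_ (torsion x) (·-*p k x)) (∙-idʳ ε))

    ·-% : ∀ n x → (n % p) · x ≡ n · x
    ·-% n x = sym (trans (cong (_· x) (m≡m%n+[m/n]*n n p)) (trans (·-+ (n % p) (n / p * p) x) (trans (cong ((n % p) · x ∙_) (·-*p (n / p) x)) (∙-idʳ _))))

    lincomb : ∀ {M} → Vec A M → Vec F M → A
    lincomb []      []      = ε
    lincomb (a ∷ v) (s ∷ t) = toℕ s · a ∙ lincomb v t

    lincomb-⊕ : ∀ {M} (a : Vec A M) s t → lincomb a (zipWith _⊕_ s t) ≡ lincomb a s ∙ lincomb a t
    lincomb-⊕ []      []      []      = sym (∙-idʳ ε)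
    lincomb-⊕ (a ∷ v) (s ∷ ss) (t ∷ ts) = trans
      (cong₂ _∙_ (trans (cong (_· a) (toℕ-⊕ s t)) (trans (·-% (toℕ s + toℕ t) a) (·-+ (toℕ s) (toℕ t) a))) (lincomb-⊕ v ss ts))
      (∙-middle (toℕ s · a) (toℕ t · a) (lincomb v ss) (lincomb v ts))

    lincomb-0 : ∀ {M} (a : Vec A M) → lincomb a (replicate M 0F) ≡ ε
    lincomb-0 []      = refl
    lincomb-0 (a ∷ v) = trans (cong₂ _∙_ (trans (cong (_· a) (toℕ-[] 0)) (·-% 0 a)) (lincomb-0 v)) (∙-idʳ ε)

    record Span {M} (a : Vec A M) (v : A) : Set where
      constructor coeffs
      field
        coord   : Vec F M
        coord-≡ : lincomb a coord ≡ v

    span-ε : ∀ {M} {a : Vec A M} → Span a ε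
    span-ε {M} {a} = coeffs (replicate M 0F) (lincomb-0 a)

    span-∙ : ∀ {M} {a : Vec A M} {u v} → Span a u → Span a v → Span a (u ∙ v)
    span-∙ {a = a} (coeffs s e) (coeffs t e′) = coeffs (zipWith _⊕_ s t) $ trans (lincomb-⊕ a s t) (cong₂ _∙_ e e′)

    span-∷ : ∀ {M} {a : Vec A M} x {v} → Span a v → Span (x ∷ a) v
    span-∷ {a = a} x (coeffs s e) = coeffs (0F ∷ s) $ trans (cong₂ _∙_ (trans (cong (_· x) (toℕ-[] 0)) (·-% 0 x)) e) (∙-idˡ _)

    span-head : ∀ {M} (a : Vec A M) x → Span (x ∷ a) x
    span-head {M} a x = coeffs (1F ∷ replicate M 0F) $ trans (cong₂ _∙_ (trans (cong (_· x) (toℕ-[] 1)) (trans (·-% 1 x) (∙-idʳ x))) (lincomb-0 a)) (∙-idʳ x)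

    span-++ : ∀ {L M} (c : Vec A L) {a : Vec A M} {v} → Span a v → Span (c ++ a) v
    span-++ []      h = h
    span-++ (x ∷ c) h = span-∷ x (span-++ c h)

    span-lookup : ∀ {L M} (c : Vec A L) (a : Vec A M) i → Span (c ++ a) (lookup c i)
    span-lookup (x ∷ c) a zero    = span-head (c ++ a) x
    span-lookup (x ∷ c) a (suc i) = span-∷ x (span-lookup c a i)

    span-· : ∀ {M} {a : Vec A M} {v} n → Span a v → Span a (n · v)
    span-· zero    h = span-ε
    span-· (suc n) h = span-∙ h (span-· n h)

    span-lincomb : ∀ {M t} {a : Vec A M} {b : Vec A t} → Allᵛ (Span a) b → ∀ s → Span a (lincomb b s)
    span-lincomb []       []      = span-ε
    span-lincomb (h ∷ hs) (s ∷ t) = span-∙ (span-· (toℕ s) h) (span-lincomb hs t)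

    All-span : ∀ {M k} {a : Vec A M} {b : Vec A k} → Allᵛ (Span a) b → ∃ λ σ → map (lincomb a) σ ≡ b
    All-span []             = [] , refl
    All-span (coeffs s e ∷ hs) = let (σ , e′) = All-span hs in s ∷ σ , cong₂ _∷_ e e′

    D : ∀ {k} → Vec A k → (A → F) → A → F
    D []      f y = f y
    D (v ∷ b) f y = D b f (y ∙ v) ⊝ D b f y

    D-cong : ∀ {k} (b : Vec A k) {f g : A → F} → (∀ y → f y ≡ g y) → ∀ y → D b f y ≡ D b g y
    D-cong []      h y = h y
    D-cong (v ∷ b) h y = cong₂ _⊝_ (D-cong b h (y ∙ v)) (D-cong b h y)

    D-⊝ : ∀ {k} (b : Vec A k) (f g : A → F) y → D b (λ z → f z ⊝ g z) y ≡ D b f y ⊝ D b g y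
    D-⊝ []      f g y = refl
    D-⊝ (v ∷ b) f g y = trans (cong₂ _⊝_ (D-⊝ b f g (y ∙ v)) (D-⊝ b f g y)) (⊝-interchange (D b f (y ∙ v)) _ _ _)

    D-⊕ : ∀ {k} (b : Vec A k) (f g : A → F) y → D b (λ z → f z ⊕ g z) y ≡ D b f y ⊕ D b g y
    D-⊕ []      f g y = refl
    D-⊕ (v ∷ b) f g y = trans (cong₂ _⊝_ (D-⊕ b f g (y ∙ v)) (D-⊕ b f g y)) (⊕-⊝-interchange (D b f (y ∙ v)) _ _ _)

    D-shift : ∀ {k} (b : Vec A k) (f : A → F) s y → D b (λ z → f (z ∙ s)) y ≡ D b f (y ∙ s)
    D-shift []      f s y = refl
    D-shift (v ∷ b) f s y = cong₂ _⊝_ (trans (D-shift b f s (y ∙ v)) (cong (D b f) (∙-swapʳ y v s))) (D-shift b f s y)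

    -- `D` peels off its head direction as the outermost difference; inductions on the degree need
    -- that direction as the innermost one, applied to f itself.
    D-inner : ∀ {k} (b : Vec A k) (f : A → F) v y → D b (λ z → f (z ∙ v) ⊝ f z) y ≡ D (v ∷ b) f y
    D-inner b f v y = trans (D-⊝ b (λ z → f (z ∙ v)) f y) (cong (_⊝ D b f y) (D-shift b f v y))

    -- Polynomial degree below k, expressed by differences; for k = 0 only the zero function is
    -- left.
    DegLt : ℕ → (A → F) → Set
    DegLt k f = ∀ (b : Vec A k) y → D b f y ≡ 0F

  -- Finite codes for tables of values

  record Codable (I : Set) : Set where
    field
      size     : ℕ → ℕ
      code     : ∀ {W} → (I → Fin W) → Fin (size W)
      code-inj : ∀ {W} {φ ψ : I → Fin W} → code φ ≡ code ψ → ∀ i → φ i ≡ ψ i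
      code-cong : ∀ {W} {φ ψ : I → Fin W} → (∀ i → φ i ≡ ψ i) → code φ ≡ code ψ
  open Codable

  codable-Fin : ∀ n → Codable (Fin n)
  codable-Fin n = record { size = _^ n ; code = funToFin ; code-inj = inj n ; code-cong = cng n }
    where
    inj : ∀ n {W} {φ ψ : Fin n → Fin W} → funToFin φ ≡ funToFin ψ → ∀ i → φ i ≡ ψ i
    inj (suc n) {φ = φ} {ψ} e zero    = proj₁ (combine-injective (φ zero) (funToFin (φ ∘ suc)) (ψ zero) (funToFin (ψ ∘ suc)) e)
    inj (suc n) {φ = φ} {ψ} e (suc i) = inj n (proj₂ (combine-injective (φ zero) (funToFin (φ ∘ suc)) (ψ zero) (funToFin (ψ ∘ suc)) e)) i
    cng : ∀ n {W} {φ ψ : Fin n → Fin W} → (∀ i → φ i ≡ ψ i) → funToFin φ ≡ funToFin ψ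
    cng zero    h = refl
    cng (suc n) h = cong₂ combine (h zero) (cng n (h ∘ suc))

  codable-× : ∀ {I J} → Codable I → Codable J → Codable (I × J)
  codable-× A B = record
    { size = size A ∘ size B
    ; code = λ φ → code A (λ i → code B (λ j → φ (i , j)))
    ; code-inj = λ { e (i , j) → code-inj B (code-inj A e i) j }
    ; code-cong = λ h → code-cong A (λ i → code-cong B (λ j → h (i , j))) }

  codable-⊎ : ∀ {I J} → Codable I → Codable J → Codable (I ⊎ J)
  codable-⊎ A B = record
    { size = λ W → size A W * size B W
    ; code = λ φ → combine (code A (φ ∘ inj₁)) (code B (φ ∘ inj₂))
    ; code-inj = λ { {φ = φ} {ψ} e (inj₁ i) → code-inj A (proj₁ (combine-injective (code A (φ ∘ inj₁)) (code B (φ ∘ inj₂)) (code A (ψ ∘ inj₁)) (code B (ψ ∘ inj₂)) e)) i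
                   ; {φ = φ} {ψ} e (inj₂ j) → code-inj B (proj₂ (combine-injective (code A (φ ∘ inj₁)) (code B (φ ∘ inj₂)) (code A (ψ ∘ inj₁)) (code B (ψ ∘ inj₂)) e)) j }
    ; code-cong = λ h → cong₂ combine (code-cong A (h ∘ inj₁)) (code-cong B (h ∘ inj₂)) }

  codable-Vec : ∀ {I} → Codable I → ∀ n → Codable (Vec I n)
  codable-Vec A zero    = record { size = id ; code = λ φ → φ [] ; code-inj = λ { e [] → e } ; code-cong = λ h → h [] }
  codable-Vec A (suc n) = record
    { size = size A ∘ size B
    ; code = λ φ → code A (λ i → code B (λ v → φ (i ∷ v)))
    ; code-inj = λ { e (i ∷ v) → code-inj B (code-inj A e i) v }
    ; code-cong = λ h → code-cong A (λ i → code-cong B (λ v → h (i ∷ v))) }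
    where B = codable-Vec A n

  vecGroup : ∀ t → VectorGroup (Vec F t)
  vecGroup t = record
    { _∙_ = zipWith _⊕_ ; ε = replicate t 0F ; inv = map ⊖_
    ; ∙-assoc = zipWith-assoc ⊕-assoc ; ∙-comm = zipWith-comm ⊕-comm
    ; ∙-idʳ = zipWith-identityʳ ⊕-0ʳ ; ∙-invʳ = zipWith-inverseʳ ⊝-self
    ; torsion = torsion }
    where
    []-mul : ∀ n x → mul _⊕_ 0F n x ≡ [ n ] ⊗ x
    []-mul zero    x = sym (⊗-zeroˡ x)
    []-mul (suc n) x = trans (cong₂ _⊕_ (sym (⊗-identityˡ x)) ([]-mul n x))
      (sym (trans (cong (_⊗ x) ([]-+ 1 n)) (trans (⊗-comm (1F ⊕ [ n ]) x) (trans (⊗-distribˡ x 1F [ n ]) (cong₂ _⊕_ (⊗-comm x 1F) (⊗-comm x [ n ]))))))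
    mul-∷ : ∀ {t} n x (v : Vec F t) → mul (zipWith _⊕_) (replicate (suc t) 0F) n (x ∷ v) ≡ mul _⊕_ 0F n x ∷ mul (zipWith _⊕_) (replicate t 0F) n v
    mul-∷ zero    x v = refl
    mul-∷ (suc n) x v = cong (zipWith _⊕_ (x ∷ v)) (mul-∷ n x v)
    torsion : ∀ {t} (v : Vec F t) → mul (zipWith _⊕_) (replicate t 0F) p v ≡ replicate t 0F
    torsion []      = []≡ p
      where
      []≡ : ∀ n → mul (zipWith _⊕_) [] n [] ≡ []
      []≡ zero    = refl
      []≡ (suc n) = cong (zipWith _⊕_ []) ([]≡ n)
    torsion (x ∷ v) = trans (mul-∷ p x v) (cong₂ _∷_ (trans ([]-mul p x) (trans (cong (_⊗ x) ([]-cong p 0 (n%n≡0 p))) (⊗-zeroˡ x))) (torsion v))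

  -- The entries of a view: on the left a translate at which g is read, on the right ℓ directions
  -- and a translate for a difference of f. Everything is given by coefficients relative to the
  -- tuple, so that views around different points, and their number, can be compared.
  ViewIndex : ℕ → ℕ → Set
  ViewIndex M ℓ = Vec F M ⊎ (Vec (Vec F M) ℓ × Vec F M)

  abstract
    codable-View : ∀ M ℓ → Codable (ViewIndex M ℓ)
    codable-View M ℓ = codable-⊎ (codable-Vec (codable-Fin p) M) (codable-× (codable-Vec (codable-Vec (codable-Fin p) M) ℓ) (codable-Vec (codable-Fin p) M))

  views : ℕ → ℕ → ℕ
  views M ℓ = size (codable-View M ℓ) p

  hits-count : ∀ {q L} (χ : Fin q → Bool) (c : Vec (Fin q) L) → hits χ c ≡ count (λ r → χ (lookup c r))
  hits-count χ []      = refl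
  hits-count χ (x ∷ c) = cong (ind (χ x) +_) (hits-count χ c)

  -- Views, typical points and approximate automorphisms

  module Relative {q : ℕ} (G : VectorGroup (Fin q)) (f g : Fin q → F) (ℓ : ℕ) where
    open Linear G

    X : Set
    X = Fin q

    Shift : Set
    Shift = Vec X ℓ → F

    -- For κ = `0ˢ` the two points have equal views in the directions a; a general κ describes how τ
    -- moves a point.
    record Rel {M} (a : Vec X M) (κ : Shift) (y y′ : X) : Set where
      constructor rel
      field
        same : ∀ {v} → Span a v → g (y ∙ v) ≡ g (y′ ∙ v)
        shifted : ∀ {b v} → Allᵛ (Span a) b → Span a v → D b f (y′ ∙ v) ≡ D b f (y ∙ v) ⊕ κ b
    open Rel public

    0ˢ : Shift
    0ˢ _ = 0F

    times : ℕ → Shift → Shift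
    times zero    κ b = 0F
    times (suc k) κ b = times k κ b ⊕ κ b

    module _ {M} {a : Vec X M} where

      rel-refl : ∀ {y} → Rel a 0ˢ y y
      rel-refl = rel (λ _ → refl) (λ _ _ → sym (⊕-0ʳ _))

      rel-step : ∀ {k κ y y′ y″} → Rel a (times k κ) y y′ → Rel a κ y′ y″ → Rel a (times (suc k) κ) y y″
      rel-step r r′ = rel (λ h → trans (same r h) (same r′ h))
        (λ hb hv → trans (shifted r′ hb hv) (trans (cong (_⊕ _) (shifted r hb hv)) (⊕-assoc _ _ _)))

      -- The two shifts by κ cancel. Hence a motion by one κ respects equality of views, although it
      -- changes the views themselves.
      rel-square : ∀ {κ y₁ y₂ z₁ z₂} → Rel a 0ˢ y₁ y₂ → Rel a κ y₁ z₁ → Rel a κ y₂ z₂ → Rel a 0ˢ z₁ z₂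
      rel-square r r₁ r₂ = rel (λ h → trans (sym (same r₁ h)) (trans (same r h) (same r₂ h)))
        (λ hb hv → trans (shifted r₂ hb hv) (trans (cong (_⊕ _) (trans (shifted r hb hv) (⊕-0ʳ _))) (trans (sym (shifted r₁ hb hv)) (sym (⊕-0ʳ _)))))

      rel-shift : ∀ {κ y y′ s} → Span a s → Rel a κ y y′ → Rel a κ (y ∙ s) (y′ ∙ s)
      rel-shift {y = y} {y′} {s} hs r = rel
        (λ {v} hv → trans (cong g (∙-assoc y s v)) (trans (same r (span-∙ hs hv)) (cong g (sym (∙-assoc y′ s v)))))
        (λ {b} {v} hb hv → trans (cong (D b f) (∙-assoc y′ s v)) (trans (shifted r hb (span-∙ hs hv)) (cong (λ z → D b f z ⊕ _) (sym (∙-assoc y s v)))))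

    rel-restrict : ∀ {M M′} {a : Vec X M} {a′ : Vec X M′} {κ y y′} → (∀ {v} → Span a v → Span a′ v) → Rel a′ κ y y′ → Rel a κ y y′
    rel-restrict h r = rel (same r ∘ h) (λ hb hv → shifted r (VecAll.map h hb) (h hv))

    module _ {M} (a : Vec X M) where

      -- Subtracting κ here turns `Rel a κ y y′` into equality of two colours, `view 0ˢ y` and
      -- `view κ y′`, which is the form that `matching` handles.
      table : Shift → X → ViewIndex M ℓ → F
      table κ y (inj₁ s)       = g (y ∙ lincomb a s)
      table κ y (inj₂ (σ , s)) = D (map (lincomb a) σ) f (y ∙ lincomb a s) ⊝ κ (map (lincomb a) σ)

      view : Shift → X → Fin (views M ℓ)
      view κ y = code (codable-View M ℓ) (table κ y)

      view⇒rel : ∀ {κ y y′} → view 0ˢ y ≡ view κ y′ → Rel a κ y y′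
      view⇒rel {κ} {y} {y′} e = rel sm df
        where
        pw : ∀ i → table 0ˢ y i ≡ table κ y′ i
        pw = code-inj (codable-View M ℓ) e
        sm : ∀ {v} → Span a v → g (y ∙ v) ≡ g (y′ ∙ v)
        sm (coeffs s refl) = pw (inj₁ s)
        df : ∀ {b v} → Allᵛ (Span a) b → Span a v → D b f (y′ ∙ v) ≡ D b f (y ∙ v) ⊕ κ b
        df hb (coeffs s refl) with All-span hb
        ... | σ , refl = trans (sym (⊝-cancel-⊕ _ _)) (cong (_⊕ κ _) (trans (sym (pw (inj₂ (σ , s)))) (⊝-0ʳ _)))

      private
        in-map : ∀ {k} (σ : Vec (Vec F M) k) → Allᵛ (Span a) (map (lincomb a) σ)
        in-map []      = []
        in-map (s ∷ σ) = coeffs s refl ∷ in-map σ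

      rel⇒view : ∀ {κ y y′} → Rel a κ y y′ → view 0ˢ y ≡ view κ y′
      rel⇒view {κ} {y} {y′} r = code-cong (codable-View M ℓ) pw
        where
        pw : ∀ i → table 0ˢ y i ≡ table κ y′ i
        pw (inj₁ s)       = same r (coeffs s refl)
        pw (inj₂ (σ , s)) = trans (⊝-0ʳ _) (sym (trans (cong (_⊝ κ _) (shifted r (in-map σ) (coeffs s refl))) (⊕-cancel-⊝ _ _)))

    translate : X → Permutation′ q
    translate s = Perm.permutation (_∙ s) (_∙ inv s)
      (λ y → trans (∙-assoc y (inv s) s) (trans (cong (y ∙_) (trans (∙-comm (inv s) s) (∙-invʳ s))) (∙-idʳ y)))
      (λ y → trans (∙-assoc y s (inv s)) (trans (cong (y ∙_) (∙-invʳ s)) (∙-idʳ y)))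

    translateˡ : X → Permutation′ q
    translateˡ s = Perm.permutation (s ∙_) (inv s ∙_)
      (λ y → trans (sym (∙-assoc s (inv s) y)) (trans (cong (_∙ y) (∙-invʳ s)) (∙-idˡ y)))
      (λ y → trans (sym (∙-assoc (inv s) s y)) (trans (cong (_∙ y) (trans (∙-comm (inv s) s) (∙-invʳ s))) (∙-idˡ y)))

    -- Every class of V is hit by the sample y ∙ c₁, …, y ∙ c_L about as often as it should be.
    Typical : ∀ {W L} → ℕ → (X → Fin W) → Vec X L → X → Set
    Typical K V c y = ∀ v → far (λ z → V (y ∙ z) == v) K c ≡ false

    module _ {W L} (K : ℕ) (V : X → Fin W) (c : Vec X L) where

      sample : X → Fin W → ℕ
      sample y v = count (λ r → V (y ∙ lookup c r) == v)

      typical-bounds : ∀ {y} → Typical K V c y → ∀ v →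
        K * (q * sample y v) ≤ K * (L * count (λ z → V z == v)) + L * q ×
        K * (L * count (λ z → V z == v)) ≤ K * (q * sample y v) + L * q
      typical-bounds {y} t v = subst₂ (λ A B → K * (q * A) ≤ K * (L * B) + L * q × K * (L * B) ≤ K * (q * A) + L * q)
        (hits-count χ c) (sym (sum-permute (λ z → ind (V z == v)) (translateˡ y))) (near-bounds χ K c (t v))
        where
        χ : X → Bool
        χ z = V (y ∙ z) == v

      typical-close : 0 < q → ∀ {y₁ y₂} → Typical K V c y₁ → Typical K V c y₂ → ∀ v → K * sample y₁ v ≤ K * sample y₂ v + 2 * L
      typical-close 0<q {y₁} {y₂} t₁ t₂ v = *-cancelˡ-≤ q {{>-nonZero 0<q}} (begin
        q * (K * sample y₁ v)  ≡⟨ r₁ q K (sample y₁ v) ⟩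
        K * (q * sample y₁ v)  ≤⟨ proj₁ (typical-bounds t₁ v) ⟩
        K * (L * count (λ z → V z == v)) + L * q  ≤⟨ +-monoˡ-≤ (L * q) (proj₂ (typical-bounds t₂ v)) ⟩
        K * (q * sample y₂ v) + L * q + L * q  ≡⟨ r₂ q K (sample y₂ v) L ⟩
        q * (K * sample y₂ v + 2 * L)  ∎)
        where
        open ≤-Reasoning
        r₁ : ∀ q K s → q * (K * s) ≡ K * (q * s)
        r₁ = solve-∀
        r₂ : ∀ q K s L → K * (q * s) + L * q + L * q ≡ q * (K * s + 2 * L)
        r₂ = solve-∀

    -- The samples around x and x′ realise y ↦ y′ with Rel a κ y y′ on the level of views, hence so do the views of all of X up to a small error.
    automorphism : ∀ {M L} K (a : Vec X M) (c : Vec X L) κ {x x′} → 0 < L →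
      Typical K (view a 0ˢ) c x → Typical K (view a 0ˢ) c x′ → Rel (c ++ a) κ x x′ →
      Σ (Permutation′ q) λ τ → K * count (λ y → not (view a 0ˢ y == view a κ (τ ⟨$⟩ʳ y))) ≤ views M ℓ * (2 * q)
    automorphism {M} {L} K a c κ {x} {x′} 0<L t t′ r = matching K (2 * q) q (view a 0ˢ) (view a κ) close
      where
      V V′ : X → Fin (views M ℓ)
      V = view a 0ˢ
      V′ = view a κ
      open ≤-Reasoning
      r₁ : ∀ L K s → L * (K * s) ≡ K * (L * s)
      r₁ = solve-∀
      r₂ : ∀ q K s L → K * (L * s) + L * q + L * q ≡ L * (K * s + 2 * q)
      r₂ = solve-∀
      step : ∀ s → Span (c ++ a) s → V (x ∙ s) ≡ V′ (x′ ∙ s)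
      step s hs = rel⇒view a (rel-restrict (span-++ c) (rel-shift hs r))
      samples : ∀ v → sample K V c x v ≡ count (λ i → V′ (x′ ∙ lookup c i) == v)
      samples v = count-cong (λ i → cong (_== v) (step (lookup c i) (span-lookup c a i)))
      -- κ changes each entry of the table by an amount that depends on the index only, so V and V′
      -- have the same fibres; typicality of x′, stated for V, thus passes to V′.
      same-class : ∀ {z z′} → V′ z ≡ V′ z′ → V z ≡ V z′
      same-class {z} {z′} e = code-cong (codable-View M ℓ) pw
        where
        pw : ∀ i → table a 0ˢ z i ≡ table a 0ˢ z′ i
        pw (inj₁ s)       = code-inj (codable-View M ℓ) e (inj₁ s)
        pw (inj₂ (σ , s)) = cong (_⊝ 0F) (⊕-cancelʳ (code-inj (codable-View M ℓ) e (inj₂ (σ , s))))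
      same-class′ : ∀ {z z′} → V z ≡ V z′ → V′ z ≡ V′ z′
      same-class′ {z} {z′} e = code-cong (codable-View M ℓ) pw
        where
        pw : ∀ i → table a κ z i ≡ table a κ z′ i
        pw (inj₁ s)       = code-inj (codable-View M ℓ) e (inj₁ s)
        pw (inj₂ (σ , s)) = cong (_⊝ κ (map (lincomb a) σ)) (⊕-cancelʳ (code-inj (codable-View M ℓ) e (inj₂ (σ , s))))
      upper′ : ∀ v → K * (q * count (λ i → V′ (x′ ∙ lookup c i) == v)) ≤ K * (L * count (λ z → V′ z == v)) + L * q
      upper′ v with any? (λ z → V′ z ≟ v)
      ... | no nv = ≤-trans (≤-reflexive (trans (cong (λ n → K * (q * n)) (count-zero (λ i → ==-false (λ e → nv (x′ ∙ lookup c i , e))))) (trans (cong (K *_) (*-zeroʳ q)) (*-zeroʳ K)))) z≤n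
      ... | yes (z , refl) = ≤-trans (≤-reflexive (cong (λ n → K * (q * n)) (count-cong (λ i → tr (x′ ∙ lookup c i)))))
              (≤-trans (proj₁ (typical-bounds K V c t′ (V z))) (≤-reflexive (cong (λ n → K * (L * n) + L * q) (sym (count-cong tr)))))
        where
        tr : ∀ y → (V′ y == V′ z) ≡ (V y == V z)
        tr y with V y ≟ V z
        ... | yes e = trans (cong (_== V′ z) (same-class′ e)) (==-refl (V′ z))
        ... | no ne = ==-false (λ e → ne (same-class e))
      close : ∀ v → K * count (λ y → V y == v) ≤ K * count (λ y → V′ y == v) + 2 * q
      close v = *-cancelˡ-≤ L {{>-nonZero 0<L}} (begin
        L * (K * count (λ y → V y == v))  ≡⟨ r₁ L K _ ⟩
        K * (L * count (λ y → V y == v))  ≤⟨ proj₂ (typical-bounds K V c t v) ⟩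
        K * (q * sample K V c x v) + L * q  ≡⟨ cong (λ n → K * (q * n) + L * q) (samples v) ⟩
        K * (q * count (λ i → V′ (x′ ∙ lookup c i) == v)) + L * q  ≤⟨ +-monoˡ-≤ (L * q) (upper′ v) ⟩
        K * (L * count (λ y → V′ y == v)) + L * q + L * q  ≡⟨ r₂ q K _ L ⟩
        L * (K * count (λ y → V′ y == v) + 2 * q)  ∎)

  -- The weights w… count how many of the basic exceptional sets, each of density ≤ 1/K, a statement about almost all y may lose.
  wAgree : ℕ → ℕ
  wAgree k = (k + 1) + (k + 1)

  wDet : ℕ → ℕ → ℕ
  wDet zero    k = k + 1
  wDet (suc i) k = wDet i (suc k) + wDet i k

  wTransport : ℕ → ℕ → ℕ → ℕ → ℕ
  wTransport n zero    k l = 2 ^ n * wAgree (l + k) + 2 ^ n * wAgree l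
  wTransport n (suc i) k l = wTransport n i k (suc l) + wTransport n i k l

  wFirst : ℕ → ℕ → ℕ
  wFirst n k = (2 ^ n * wAgree (suc k) + 2 ^ n * wAgree k) + 1

  wNext : ℕ → ℕ → (ℕ → ℕ) → ℕ → ℕ
  wNext n i w k = wTransport n (suc i) k 0 + (4 * ((w 1 + w 0) + 2 ^ n * wDet (suc i) 0) + 1)

  2^suc : ∀ n w → 2 ^ n * w + 2 ^ n * w ≡ 2 ^ suc n * w
  2^suc n w = r (2 ^ n) w
    where
    r : ∀ a w → a * w + a * w ≡ 2 * a * w
    r = solve-∀

  -- Iterates of an approximate automorphism

  module Orbit {q : ℕ} (G : VectorGroup (Fin q)) (f g : Fin q → F) (ℓ : ℕ) (K : ℕ)
    {m M} (a₀ : Vec (Fin q) m) (top : Vec (Fin q) M) (a₀⊆top : ∀ {v} → Linear.Span G a₀ v → Linear.Span G top v)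
    (Good : Fin q → Set) (determined : ∀ {y y′} → Good y → Good y′ → Relative.Rel G f g ℓ a₀ (Relative.0ˢ G f g ℓ) y y′ → f y ≡ f y′)
    (κ : Relative.Shift G f g ℓ) (τ : Permutation′ q)
    (most-good : Most K 1 Good) (most-τ : Most K 1 (λ y → Relative.Rel G f g ℓ top κ y (τ ⟨$⟩ʳ y))) where
    open Linear G
    open Relative G f g ℓ

    τ^ : ℕ → Permutation′ q
    τ^ zero    = Perm.id
    τ^ (suc k) = τ^ k Perm.∘ₚ τ

    pow : ℕ → X → X
    pow k y = τ^ k ⟨$⟩ʳ y

    pow-+ : ∀ l k y → pow (l + k) y ≡ pow l (pow k y)
    pow-+ zero    k y = refl
    pow-+ (suc l) k y = cong (τ ⟨$⟩ʳ_) (pow-+ l k y)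

    Fₖ : ℕ → X → F
    Fₖ k y = f (pow k y)

    most-rel : ∀ k → Most K k (λ y → Rel top (times k κ) y (pow k y))
    most-rel zero    = most-all (λ y → rel-refl)
    most-rel (suc k) = most-weaken (≤-reflexive (+-comm k 1)) (most-map (λ y (r , r′) → rel-step {k = k} r r′) (most-∧ (most-rel k) (most-perm (τ^ k) most-τ)))

    Regular : ℕ → X → Set
    Regular k y = Rel top (times k κ) y (pow k y) × Good (pow k y)

    most-regular : ∀ k → Most K (k + 1) (Regular k)
    most-regular k = most-∧ (most-rel k) (most-perm (τ^ k) most-good)

    regular-det : ∀ {k y₁ y₂} → Rel a₀ 0ˢ y₁ y₂ → Regular k y₁ → Regular k y₂ → Fₖ k y₁ ≡ Fₖ k y₂
    regular-det r (r₁ , g₁) (r₂ , g₂) = determined g₁ g₂ (rel-square r (rel-restrict a₀⊆top r₁) (rel-restrict a₀⊆top r₂))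

    -- Both τᵏ(y + s) and τᵏ y + s arise from y + s by the same shift `times k κ`; by `rel-square`
    -- they have equal views in the directions a₀, and `determined` gives them equal values of f.
    -- This replaces commutation of τ with translations.
    agree : ∀ k {s} → Span top s → Most K (wAgree k) (λ y → Fₖ k (y ∙ s) ≡ f (pow k y ∙ s))
    agree k {s} hs = most-map
      (λ y ((r , gd) , (r′ , gd′)) → determined gd gd′ (rel-restrict a₀⊆top (rel-square rel-refl r (rel-shift hs r′))))
      (most-∧ (most-perm (translate s) (most-regular k)) (most-∧ (most-rel k) (most-perm (τ^ k Perm.∘ₚ translate s) most-good)))

    agree-D : ∀ {n} (b : Vec X n) → Allᵛ (Span top) b → ∀ k {s} → Span top s →
      Most K (2 ^ n * wAgree k) (λ y → D b (Fₖ k) (y ∙ s) ≡ D b f (pow k y ∙ s))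
    agree-D []      hb       k hs = most-weaken (≤-reflexive (sym (*-identityˡ _))) (agree k hs)
    agree-D {suc n} (v ∷ b) (hv ∷ hb) k {s} hs = most-weaken (≤-reflexive (2^suc n (wAgree k)))
      (most-map (λ y (e₁ , e₂) → cong₂ _⊝_ (trans (cong (D b (Fₖ k)) (∙-assoc y s v)) (trans e₁ (cong (D b f) (sym (∙-assoc (pow k y) s v))))) e₂)
        (most-∧ (agree-D b hb k (span-∙ hs hv)) (agree-D b hb k hs)))

    agree-Dε : ∀ {n} (b : Vec X n) → Allᵛ (Span top) b → ∀ k → Most K (2 ^ n * wAgree k) (λ y → D b (Fₖ k) y ≡ D b f (pow k y))
    agree-Dε b hb k = most-map (λ y e → trans (cong (D b (Fₖ k)) (sym (∙-idʳ y))) (trans e (cong (D b f) (∙-idʳ (pow k y))))) (agree-D b hb k span-ε)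

    Δ : ℕ → ℕ → X → F
    Δ i k y = diff i (λ l → Fₖ l y) k

    -- What `constant-next` requires of φ: once two samples contain points with equal views, φ must
    -- take the same value there.
    record Det {M′} (a : Vec X M′) (w : ℕ) (φ : X → F) : Set₁ where
      field
        on      : X → Set
        most-on : Most K w on
        det     : ∀ {y₁ y₂} → on y₁ → on y₂ → Rel a 0ˢ y₁ y₂ → φ y₁ ≡ φ y₂
    open Det

    module _ {M′} {a : Vec X M′} (low : ∀ {v} → Span a₀ v → Span a v) where

      det-⊝ : ∀ {w w′ φ ψ} → Det a w φ → Det a w′ ψ → Det a (w + w′) (λ y → φ y ⊝ ψ y)
      det-⊝ d d′ = record { on = λ y → on d y × on d′ y ; most-on = most-∧ (most-on d) (most-on d′)
        ; det = λ { (h₁ , h₁′) (h₂ , h₂′) r → cong₂ _⊝_ (det d h₁ h₂ r) (det d′ h₁′ h₂′ r) } }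

      det-shift : ∀ {w φ s} → Span a s → Det a w φ → Det a w (λ y → φ (y ∙ s))
      det-shift {s = s} hs d = record { on = λ y → on d (y ∙ s) ; most-on = most-perm (translate s) (most-on d)
        ; det = λ h₁ h₂ r → det d h₁ h₂ (rel-shift hs r) }

      det-Δ : ∀ i k → Det a (wDet i k) (Δ i k)
      det-Δ zero    k = record { on = Regular k ; most-on = most-regular k ; det = λ h₁ h₂ r → regular-det {k} (rel-restrict low r) h₁ h₂ }
      det-Δ (suc i) k = det-⊝ (det-Δ i (suc k)) (det-Δ i k)

      det-D : ∀ {n w φ} (b : Vec X n) → Allᵛ (Span a) b → Det a w φ → Det a (2 ^ n * w) (D b φ)
      det-D {w = w} {φ} []      hb        d = subst (λ w → Det a w φ) (sym (*-identityˡ w)) d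
      det-D {suc n} {w} {φ} (v ∷ b) (hv ∷ hb) d = subst (λ w → Det a w (D (v ∷ b) φ)) (2^suc n w) (det-⊝ (det-shift hv (det-D b hb d)) (det-D b hb d))

    -- Advancing k amounts to moving the point by τᵏ. The differences in the directions b are
    -- carried along by `agree-D`, applied at y and at τᵏ y.
    transport : ∀ {n} (b : Vec X n) → Allᵛ (Span top) b → ∀ i k l →
      Most K (wTransport n i k l) (λ y → D b (Δ i (l + k)) y ≡ D b (Δ i l) (pow k y))
    transport b hb zero    k l = most-map
      (λ y (e₁ , e₂) → trans e₁ (trans (cong (D b f) (pow-+ l k y)) (sym e₂)))
      (most-∧ (agree-Dε b hb (l + k)) (most-perm (τ^ k) (agree-Dε b hb l)))
    transport b hb (suc i) k l = most-map
      (λ y (e₁ , e₂) → trans (D-⊝ b (Δ i (suc l + k)) (Δ i (l + k)) y) (trans (cong₂ _⊝_ e₁ e₂) (sym (D-⊝ b (Δ i (suc l)) (Δ i l) (pow k y)))))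
      (most-∧ (transport b hb i k (suc l)) (transport b hb i k l))

    -- An approximate form of "the i-th difference in k has degree at most n in y"; the value C
    -- depends neither on y nor on k.
    Constant : ∀ {M′} → ℕ → ℕ → Vec X M′ → (ℕ → ℕ) → Set
    Constant n i a w = ∀ (b : Vec X n) → Allᵛ (Span a) b → ∃ λ C → ∀ k → Most K (w k) (λ y → D b (Δ i k) y ≡ C)

    -- One more step of τ raises each ℓ-fold difference of f by κ b, and this is the constant.
    constant-first : Constant ℓ 1 top (wFirst ℓ)
    constant-first b hb = κ b , λ k → most-map
      (λ y ((e₁ , e₂) , r) → trans (D-⊝ b (Fₖ (suc k)) (Fₖ k) y) (trans (cong₂ _⊝_ e₁ e₂)
        (trans (cong₂ (λ y₁ y₂ → D b f y₁ ⊝ D b f y₂) (sym (∙-idʳ (pow (suc k) y))) (sym (∙-idʳ (pow k y))))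
        (trans (cong (_⊝ D b f (pow k y ∙ ε)) (trans (shifted r hb span-ε) (⊕-comm _ _))) (⊕-cancel-⊝ (κ b) _)))))
      (most-∧ (most-∧ (agree-Dε b hb (suc k)) (agree-Dε b hb k)) (most-perm (τ^ k) most-τ))

    constant⇒zero : ∀ {M′ n i w} {a : Vec X M′} → Constant n i a w → ∀ b → Allᵛ (Span a) b → ∀ k →
      Most K (w (suc k) + w k) (λ y → D b (Δ (suc i) k) y ≡ 0F)
    constant⇒zero {i = i} h b hb k = let (C , mc) = h b hb in
      most-map (λ y (e₁ , e₂) → trans (D-⊝ b (Δ i (suc k)) (Δ i k) y) (trans (cong₂ _⊝_ e₁ e₂) (⊝-self C))) (most-∧ (mc (suc k)) (mc k))

    -- A function that is invariant under the fresh directions c and determined by the view in the old directions is constant: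
    -- the samples y₁ ∙ c and y₂ ∙ c contain points with equal views.
    constant-next : ∀ {M′ L n i w} Kt (c : Vec X L) (a : Vec X M′) → (∀ {v} → Span a₀ v → Span a v) → (∀ {v} → Span (c ++ a) v → Span top v) →
      0 < q → 0 < L → 4 * views M′ ℓ < Kt → Most K 1 (Typical Kt (view a 0ˢ) c) →
      Constant (suc n) i (c ++ a) w → Constant n (suc i) a (wNext n i w)
    constant-next {M′} {L} {n} {i} {w} Kt c a low up 0<q 0<L big typ h b hb = proj₁ const₀ , λ k →
        -- Constancy is proved for k = 0; `transport` carries it to every k with the same value.
        most-map (λ y (e₁ , e₂) → trans e₁ e₂) (most-∧ (transport b (VecAll.map (up ∘ span-++ c) hb) (suc i) k 0) (most-perm (τ^ k) (proj₂ const₀)))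
      where
      φ : X → F
      φ = D b (Δ (suc i) 0)
      dφ : Det a (2 ^ n * wDet (suc i) 0) φ
      dφ = det-D low b hb (det-Δ low (suc i) 0)
      -- By hypothesis one further difference of φ, in a fresh direction, is a difference in k of a
      -- constant, hence zero.
      invariant : ∀ r → Most K ((w 1 + w 0) + 2 ^ n * wDet (suc i) 0) (λ y → φ (y ∙ lookup c r) ≡ φ y × on dφ (y ∙ lookup c r))
      invariant r = most-map (λ y (e , o) → ⊝-≡0 e , o)
        (most-∧ (constant⇒zero {i = i} {w = w} h (lookup c r ∷ b) (span-lookup c a r ∷ VecAll.map (span-++ c) hb) 0) (most-perm (translate (lookup c r)) (most-on dφ)))
      -- The factor 4 leaves at most a quarter of the indices exceptional, as much as `collision`
      -- tolerates in each sample.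
      we : ℕ
      we = 4 * ((w 1 + w 0) + 2 ^ n * wDet (suc i) 0) + 1
      Nice : X → Set
      Nice y = (Σ (Fin L → Bool) λ e → 4 * count e ≤ L × (∀ r → e r ≡ false → φ (y ∙ lookup c r) ≡ φ y × on dφ (y ∙ lookup c r))) × Typical Kt (view a 0ˢ) c y
      nice : Most K we Nice
      nice = most-∧ (most-markov 4 L invariant) typ
      equal : ∀ {y₁ y₂} → Nice y₁ → Nice y₂ → φ y₁ ≡ φ y₂
      equal {y₁} {y₂} ((e₁ , s₁ , h₁) , t₁) ((e₂ , s₂ , h₂) , t₂) =
        let (r₁ , r₂ , f₁ , f₂ , e) = collision Kt (λ r → view a 0ˢ (y₁ ∙ lookup c r)) (λ r → view a 0ˢ (y₂ ∙ lookup c r)) e₁ e₂ big 0<L s₁ s₂ (typical-close Kt (view a 0ˢ) c 0<q t₁ t₂)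
        in trans (sym (proj₁ (h₁ r₁ f₁))) (trans (det dφ (proj₂ (h₁ r₁ f₁)) (proj₂ (h₂ r₂ f₂)) (view⇒rel a e)) (proj₁ (h₂ r₂ f₂)))
      const₀ : ∃ λ C → Most K we (λ y → φ y ≡ C)
      const₀ = most-constant φ 0F equal nice

-- Polynomials in one variable and Newton interpolation modulo p

module ListDecoding (k : ℕ) (prime : Prime (suc (suc k))) where

  open Modular (suc k)
  open Codable

  ⊗-zero : ∀ {a b} → a ⊗ b ≡ 0F → a ≡ 0F ⊎ b ≡ 0F
  ⊗-zero {a} {b} e with euclidsLemma (toℕ a) (toℕ b) prime (m%n≡0⇒n∣m (toℕ a * toℕ b) p (trans (sym (toℕ-⊗ a b)) (trans (cong toℕ e) (toℕ-[] 0))))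
  ... | inj₁ d = inj₁ (trans (sym ([]-toℕ a)) ([]-cong (toℕ a) 0 (n∣m⇒m%n≡0 (toℕ a) p d)))
  ... | inj₂ d = inj₂ (trans (sym ([]-toℕ b)) ([]-cong (toℕ b) 0 (n∣m⇒m%n≡0 (toℕ b) p d)))

  -- IsPoly i L φ: φ is a polynomial function of degree ≤ i with coefficient L at x^i.
  IsPoly : ℕ → F → (F → F) → Set
  IsPoly zero    L φ = ∀ x → φ x ≡ L
  IsPoly (suc i) L φ = ∃ λ r → ∃ λ ψ → IsPoly i L ψ × (∀ x → φ x ≡ φ r ⊕ (x ⊝ r) ⊗ ψ x)

  -- `IsPoly` provides a factorisation at some base point r. Moving it to a prescribed s makes sums
  -- possible and, at a root s, splits off a linear factor.
  recentre : ∀ i {L φ} → IsPoly (suc i) L φ → ∀ s → ∃ λ ψ → IsPoly i L ψ × (∀ x → φ x ≡ φ s ⊕ (x ⊝ s) ⊗ ψ x)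
  recentre zero {L} {φ} (r , ψ , c , e) s = (λ _ → L) , (λ _ → refl) , λ x →
    trans (trans (e x) (cong₂ (λ w z → φ r ⊕ w ⊗ z) (⊝-split x s r) (c x)))
      (trans (affine-recentre (φ r) (x ⊝ s) (s ⊝ r) L) (cong (_⊕ (x ⊝ s) ⊗ L) (sym (trans (e s) (cong (λ z → φ r ⊕ (s ⊝ r) ⊗ z) (c s))))))
  recentre (suc i) {L} {φ} (r , ψ , c , e) s with recentre i c s
  ... | χ , c′ , e′ = ψ′ , (r , χ , c′ , λ x → cong (_⊕ (x ⊝ r) ⊗ χ x) (sym ψ′-r)) , λ x → trans (trans (e x) (cong₂ (λ w z → φ r ⊕ w ⊗ z) (⊝-split x s r) (e′ x)))
        (trans (quadratic-recentre (φ r) (x ⊝ s) (s ⊝ r) (ψ s) (χ x))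
          (cong₂ (λ z w → z ⊕ (x ⊝ s) ⊗ (ψ s ⊕ w ⊗ χ x)) (sym (e s)) (sym (⊝-split x s r))))
    where
    ψ′ : F → F
    ψ′ x = ψ s ⊕ (x ⊝ r) ⊗ χ x
    ψ′-r : ψ′ r ≡ ψ s
    ψ′-r = trans (cong (λ z → ψ s ⊕ z ⊗ χ r) (⊝-self r)) (trans (cong (ψ s ⊕_) (⊗-zeroˡ (χ r))) (⊕-0ʳ (ψ s)))

  isPoly-raise : ∀ i {L φ} → IsPoly i L φ → IsPoly (suc i) 0F φ
  isPoly-raise zero {L} {φ} c = 0F , (λ _ → 0F) , (λ _ → refl) , λ x → sym (trans (cong (φ 0F ⊕_) (trans (⊗-comm _ 0F) (⊗-zeroˡ _))) (trans (⊕-0ʳ _) (trans (c 0F) (sym (c x)))))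
  isPoly-raise (suc i) (r , ψ , c , e) = r , ψ , isPoly-raise i c , e

  isPoly-⊗ : ∀ i {L φ} a → IsPoly i L φ → IsPoly i (a ⊗ L) (λ x → a ⊗ φ x)
  isPoly-⊗ zero    a c x = cong (a ⊗_) (c x)
  isPoly-⊗ (suc i) {φ = φ} a (r , ψ , c , e) = r , (λ x → a ⊗ ψ x) , isPoly-⊗ i a c , λ x → trans (cong (a ⊗_) (e x)) (⊗-affine a (φ r) (x ⊝ r) (ψ x))

  isPoly-⊕ : ∀ i {L L′ φ φ′} → IsPoly i L φ → IsPoly i L′ φ′ → IsPoly i (L ⊕ L′) (λ x → φ x ⊕ φ′ x)
  isPoly-⊕ zero    c c′ x = cong₂ _⊕_ (c x) (c′ x)
  isPoly-⊕ (suc i) {φ = φ} {φ′} (r , ψ , c , e) P′ with recentre i P′ r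
  ... | ψ′ , c′ , e′ = r , (λ x → ψ x ⊕ ψ′ x) , isPoly-⊕ i c c′ , λ x → trans (cong₂ _⊕_ (e x) (e′ x)) (⊕-affine (φ r) (φ′ r) (x ⊝ r) (ψ x) (ψ′ x))

  roots : (F → F) → ℕ
  roots φ = count (λ x → φ x == 0F)

  ==-true : ∀ {n} {a b : Fin n} → (a == b) ≡ true → a ≡ b
  ==-true {a = a} {b} = does-true (a ≟ b)

  roots-≤ : ∀ i {L φ} → IsPoly i L φ → L ≢ 0F → roots φ ≤ i
  roots-≤ zero    c nz = ≤-reflexive (count-zero (λ x → ==-false (λ e → nz (trans (sym (c x)) e))))
  roots-≤ (suc i) {L} {φ} P nz with any? (λ x → φ x ≟ 0F)
  ... | no none = ≤-trans (≤-reflexive (count-zero (λ x → ==-false (λ e → none (x , e))))) z≤n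
  ... | yes (r , er) with recentre i P r
  ... | ψ , c , e = begin
    roots φ  ≤⟨ sum-mono pw ⟩
    sum (λ x → ind (r == x) + ind (ψ x == 0F))  ≡⟨ ∑-distrib-+ (λ x → ind (r == x)) (λ x → ind (ψ x == 0F)) ⟩
    sum (λ x → ind (r == x)) + roots ψ  ≤⟨ +-mono-≤ (≤-reflexive (sum-point r)) (roots-≤ i c nz) ⟩
    suc i  ∎
    where
    open ≤-Reasoning
    pw : ∀ x → ind (φ x == 0F) ≤ ind (r == x) + ind (ψ x == 0F)
    pw x with φ x ≟ 0F
    ... | no _ = z≤n
    ... | yes ex with ⊗-zero (trans (sym (⊕-identityˡ _)) (trans (cong (_⊕ (x ⊝ r) ⊗ ψ x) (sym er)) (trans (sym (e x)) ex)))
    ... | inj₁ xr = ≤-trans (≤-reflexive (cong ind (sym (trans (cong (r ==_) (⊝-≡0 xr)) (==-refl r))))) (m≤m+n _ _)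
    ... | inj₂ z  = ≤-trans (≤-reflexive (cong ind (sym (trans (cong (_== 0F) z) (==-refl 0F))))) (m≤n+m _ (ind (r == x)))

  []-suc : ∀ l → [ suc l ] ≡ [ l ] ⊕ 1F
  []-suc l = trans ([]-+ 1 l) (⊕-comm 1F [ l ])

  falling : ℕ → F → F
  falling zero    x = 1F
  falling (suc m) x = falling m x ⊗ (x ⊝ [ m ])

  isPoly-falling : ∀ m → IsPoly m 1F (falling m)
  isPoly-falling zero    x = refl
  isPoly-falling (suc m) = [ m ] , falling m , isPoly-falling m , λ x →
    trans (⊗-comm (falling m x) (x ⊝ [ m ])) (sym (trans (cong (_⊕ (x ⊝ [ m ]) ⊗ falling m x) (trans (cong (falling m [ m ] ⊗_) (⊝-self [ m ])) (trans (⊗-comm _ 0F) (⊗-zeroˡ _)))) (⊕-identityˡ _)))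

  falling-suc : ∀ m x → falling (suc m) (x ⊕ 1F) ≡ (x ⊕ 1F) ⊗ falling m x
  falling-suc zero    x = trans (cong (1F ⊗_) (⊝-0ʳ (x ⊕ 1F))) (⊗-comm 1F (x ⊕ 1F))
  falling-suc (suc m) x = trans (cong₂ _⊗_ (falling-suc m x) shift) (⊗-assoc (x ⊕ 1F) (falling m x) (x ⊝ [ m ]))
    where
    shift : (x ⊕ 1F) ⊝ [ suc m ] ≡ x ⊝ [ m ]
    shift = trans (cong ((x ⊕ 1F) ⊝_) ([]-suc m)) (trans (⊕-⊝-interchange x 1F [ m ] 1F) (trans (cong ((x ⊝ [ m ]) ⊕_) (⊝-self 1F)) (⊕-0ʳ _)))

  diff-cong : ∀ i {h h′ : ℕ → F} → (∀ k → h k ≡ h′ k) → ∀ k → diff i h k ≡ diff i h′ k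
  diff-cong zero    e k = e k
  diff-cong (suc i) e k = cong₂ _⊝_ (diff-cong i e (suc k)) (diff-cong i e k)

  diff-⊕ : ∀ i (h h′ : ℕ → F) k → diff i (λ l → h l ⊕ h′ l) k ≡ diff i h k ⊕ diff i h′ k
  diff-⊕ zero    h h′ k = refl
  diff-⊕ (suc i) h h′ k = trans (cong₂ _⊝_ (diff-⊕ i h h′ (suc k)) (diff-⊕ i h h′ k)) (⊕-⊝-interchange (diff i h (suc k)) _ _ _)

  diff-⊗ : ∀ i a (h : ℕ → F) k → diff i (λ l → a ⊗ h l) k ≡ a ⊗ diff i h k
  diff-⊗ zero    a h k = refl
  diff-⊗ (suc i) a h k = trans (cong₂ _⊝_ (diff-⊗ i a h (suc k)) (diff-⊗ i a h k)) (sym (⊗-distrib-⊝ a (diff i h (suc k)) (diff i h k)))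

  diff-⊝ : ∀ i (h h′ : ℕ → F) k → diff i (λ l → h l ⊝ h′ l) k ≡ diff i h k ⊝ diff i h′ k
  diff-⊝ zero    h h′ k = refl
  diff-⊝ (suc i) h h′ k = trans (cong₂ _⊝_ (diff-⊝ i h h′ (suc k)) (diff-⊝ i h h′ k)) (⊝-interchange (diff i h (suc k)) _ _ _)

  diff-const : ∀ i c k → diff (suc i) (λ _ → c) k ≡ 0F
  diff-const zero    c k = ⊝-self c
  diff-const (suc i) c k = trans (cong₂ _⊝_ (diff-const i c (suc k)) (diff-const i c k)) (⊝-self 0F)

  diff-inner : ∀ i (h : ℕ → F) k → diff (suc i) h k ≡ diff i (λ l → h (suc l) ⊝ h l) k
  diff-inner zero    h k = refl
  diff-inner (suc i) h k = cong₂ _⊝_ (diff-inner i h (suc k)) (diff-inner i h k)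

  -- A difference at k + 1 is the sum of the differences of the same and the next order at k; so
  -- vanishing at 0 spreads to the right, one order being used up per step.
  diff-zero : ∀ n (h : ℕ → F) → (∀ l → l < n → diff l h 0 ≡ 0F) → ∀ k l → k + l < n → diff l h k ≡ 0F
  diff-zero n h e zero    l lt = e l lt
  diff-zero n h e (suc k) l lt = trans (sym (⊝-cancel-⊕ (diff l h (suc k)) (diff l h k)))
    (trans (cong₂ _⊕_ (diff-zero n h e k (suc l) (subst (_< n) (sym (+-suc k l)) lt)) (diff-zero n h e k l (<-trans (n<1+n (k + l)) lt))) (⊕-0ʳ 0F))

  falling-at-0 : ∀ m → falling (suc m) 0F ≡ 0F
  falling-at-0 zero    = trans (cong (1F ⊗_) (⊝-self 0F)) (trans (⊗-comm 1F 0F) (⊗-zeroˡ 1F))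
  falling-at-0 (suc m) = trans (cong (_⊗ (0F ⊝ [ suc m ])) (falling-at-0 m)) (⊗-zeroˡ _)

  falling-diff : ∀ m l → falling (suc m) [ suc l ] ⊝ falling (suc m) [ l ] ≡ [ suc m ] ⊗ falling m [ l ]
  falling-diff m l = trans (cong (_⊝ falling (suc m) [ l ]) (trans (cong (falling (suc m)) ([]-suc l)) (falling-suc m [ l ])))
    (trans (falling-identity [ l ] 1F [ m ] (falling m [ l ])) (cong (_⊗ falling m [ l ]) (sym ([]-suc m))))

  fact : ℕ → F
  fact zero    = 1F
  fact (suc i) = [ suc i ] ⊗ fact i

  falling-step : ∀ l m k → diff (suc l) (λ n → falling (suc m) [ n ]) k ≡ [ suc m ] ⊗ diff l (λ n → falling m [ n ]) k
  falling-step l m k = trans (diff-inner l (λ n → falling (suc m) [ n ]) k) (trans (diff-cong l (falling-diff m) k) (diff-⊗ l [ suc m ] (λ n → falling m [ n ]) k))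

  diff-falling-≡ : ∀ m k → diff m (λ n → falling m [ n ]) k ≡ fact m
  diff-falling-≡ zero    k = refl
  diff-falling-≡ (suc m) k = trans (falling-step m m k) (cong ([ suc m ] ⊗_) (diff-falling-≡ m k))

  diff-falling-> : ∀ {m l} → m < l → ∀ k → diff l (λ n → falling m [ n ]) k ≡ 0F
  diff-falling-> {zero}  {suc l} lt       k = diff-const l 1F k
  diff-falling-> {suc m} {suc l} (s≤s lt) k = trans (falling-step l m k) (trans (cong ([ suc m ] ⊗_) (diff-falling-> lt k)) (⊗-zeroʳ [ suc m ]))

  diff-falling-< : ∀ {m l} → l < m → diff l (λ n → falling m [ n ]) 0 ≡ 0F
  diff-falling-< {suc m} {zero}  lt       = falling-at-0 m
  diff-falling-< {suc m} {suc l} (s≤s lt) = trans (falling-step l m 0) (trans (cong ([ suc m ] ⊗_) (diff-falling-< lt)) (⊗-zeroʳ [ suc m ]))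

  -- i! times the Newton interpolation polynomial with leading differences d 0, …, d i.
  newton : (ℕ → F) → ℕ → F → F
  newton d zero    x = d zero
  newton d (suc i) x = [ suc i ] ⊗ newton d i x ⊕ d (suc i) ⊗ falling (suc i) x

  isPoly-newton : ∀ d i → IsPoly i (d i) (newton d i)
  isPoly-newton d zero    = λ x → refl
  isPoly-newton d (suc i) = subst (λ L → IsPoly (suc i) L (newton d (suc i))) (trans (⊕-identityˡ _) (⊗-identityʳ (d (suc i))))
    (isPoly-⊕ (suc i) (isPoly-raise i (isPoly-⊗ i [ suc i ] (isPoly-newton d i))) (isPoly-⊗ (suc i) (d (suc i)) (isPoly-falling (suc i))))

  newton-step : ∀ d i l → diff l (λ n → newton d (suc i) [ n ]) 0 ≡
    [ suc i ] ⊗ diff l (λ n → newton d i [ n ]) 0 ⊕ d (suc i) ⊗ diff l (λ n → falling (suc i) [ n ]) 0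
  newton-step d i l = trans (diff-⊕ l (λ n → [ suc i ] ⊗ newton d i [ n ]) (λ n → d (suc i) ⊗ falling (suc i) [ n ]) 0)
    (cong₂ _⊕_ (diff-⊗ l [ suc i ] (λ n → newton d i [ n ]) 0) (diff-⊗ l (d (suc i)) (λ n → falling (suc i) [ n ]) 0))

  diff-newton-> : ∀ d i {l} → i < l → diff l (λ n → newton d i [ n ]) 0 ≡ 0F
  diff-newton-> d zero    {suc l} lt = diff-const l (d 0) 0
  diff-newton-> d (suc i) {l}     lt = trans (newton-step d i l) (trans
    (cong₂ _⊕_ (trans (cong ([ suc i ] ⊗_) (diff-newton-> d i (<-trans (n<1+n i) lt))) (⊗-zeroʳ _)) (trans (cong (d (suc i) ⊗_) (diff-falling-> lt 0)) (⊗-zeroʳ _))) (⊕-0ʳ 0F))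

  diff-newton-≤ : ∀ d i {l} → l ≤ i → diff l (λ n → newton d i [ n ]) 0 ≡ fact i ⊗ d l
  diff-newton-≤ d zero    {zero} le = sym (⊗-identityˡ (d 0))
  diff-newton-≤ d (suc i) {l}    le with m≤n⇒m<n∨m≡n le
  ... | inj₁ (s≤s l≤i) = trans (newton-step d i l) (trans (cong₂ _⊕_ (trans (cong ([ suc i ] ⊗_) (diff-newton-≤ d i l≤i)) (sym (⊗-assoc _ _ _)))
      (trans (cong (d (suc i) ⊗_) (diff-falling-< (s≤s l≤i))) (⊗-zeroʳ _))) (⊕-0ʳ _))
  ... | inj₂ refl = trans (newton-step d i (suc i)) (trans (cong₂ _⊕_ (trans (cong ([ suc i ] ⊗_) (diff-newton-> d i (n<1+n i))) (⊗-zeroʳ _))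
      (trans (cong (d (suc i) ⊗_) (diff-falling-≡ (suc i) 0)) (⊗-comm _ _))) (⊕-identityˡ _))

  -- `newton d i` and i!·h have the same differences at 0 in all orders below p, so they agree on 0,
  -- ..., p - 1. Hence zeros of h are roots of `newton d i`, whose leading coefficient is the
  -- nonzero i-th difference. Putting i! on the side of h avoids dividing by it.
  zeros-≤ : ∀ (h : ℕ → F) i → (∀ l → i < l → l < p → diff l h 0 ≡ 0F) → diff i h 0 ≢ 0F →
    count (λ (x : F) → h (toℕ x) == 0F) ≤ i
  zeros-≤ h i top nz = ≤-trans (count-mono (λ x → h (toℕ x) == 0F) (λ x → newton d i x == 0F) pw) (roots-≤ i (isPoly-newton d i) nz)
    where
    d : ℕ → F
    d l = diff l h 0
    same : ∀ l → l < p → diff l (λ n → newton d i [ n ] ⊝ fact i ⊗ h n) 0 ≡ 0F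
    same l lt = trans (diff-⊝ l (λ n → newton d i [ n ]) (λ n → fact i ⊗ h n) 0) (trans (cong₂ _⊝_ left (diff-⊗ l (fact i) h 0)) (⊝-self _))
      where
      left : diff l (λ n → newton d i [ n ]) 0 ≡ fact i ⊗ d l
      left with ≤-<-connex l i
      ... | inj₁ le = diff-newton-≤ d i le
      ... | inj₂ gt = trans (diff-newton-> d i gt) (sym (trans (cong (fact i ⊗_) (top l gt lt)) (⊗-zeroʳ (fact i))))
    value : ∀ x → newton d i x ≡ fact i ⊗ h (toℕ x)
    value x = trans (cong (newton d i) (sym ([]-toℕ x))) (⊝-≡0 (diff-zero p _ same (toℕ x) 0 (subst (_< p) (sym (+-identityʳ (toℕ x))) (toℕ<n x))))
    pw : ∀ x → (h (toℕ x) == 0F) ≡ true → (newton d i x == 0F) ≡ true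
    pw x e = trans (cong (_== 0F) (trans (value x) (trans (cong (fact i ⊗_) (==-true e)) (⊗-zeroʳ (fact i))))) (==-refl 0F)

  -- The constants δ(j) and the Schwartz-Zippel bound

  p-1 : ℕ
  p-1 = suc k

  -- δ(j) = deltaNum j / deltaDen j.
  deltaNum deltaDen : ℕ → ℕ
  deltaNum j = p ∸ j % p-1
  deltaDen j = p ^ suc (j / p-1)

  divMod-unique : ∀ r a → r < p-1 → (r + a * p-1) / p-1 ≡ a × (r + a * p-1) % p-1 ≡ r
  divMod-unique r a r< =
    trans (+-distrib-/-∣ʳ r (n∣m*n a)) (cong₂ _+_ (m<n⇒m/n≡0 r<) (m*n/n≡m a p-1)) ,
    trans ([m+kn]%n≡m%n r a p-1) (m<n⇒m%n≡m r<)

  product-bound : ∀ {u v} → 1 ≤ u → 1 ≤ v → u + v ≤ u * v + 1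
  product-bound {suc u} {suc v} _ _ = ≤-trans (m≤m+n (suc u + suc v) (u * v)) (≤-reflexive (r u v))
    where
    r : ∀ u v → (1 + u) + (1 + v) + u * v ≡ (1 + u) * (1 + v) + 1
    r = solve-∀

  -- Cleared of denominators, this is δ(n + i) ≤ δ(n)(1 - i/p), the inequality that closes the
  -- Schwartz-Zippel induction. Let b be the remainder of n modulo p - 1. Without a carry it reads
  -- (p - b - i)·p ≤ (p - b)(p - i); with a carry, for u = p - b and v = p - i, it reads u + v - 1 ≤
  -- u·v.
  delta-step : ∀ n i → i ≤ p-1 → deltaNum (n + i) * (p * deltaDen n) ≤ deltaNum n * (p ∸ i) * deltaDen (n + i)
  delta-step n i i≤ with <-≤-connex (n % p-1 + i) p-1
  ... | inj₁ lt = begin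
    deltaNum (n + i) * (p * deltaDen n)  ≡⟨ cong (λ z → (p ∸ z) * (p * deltaDen n)) %≡ ⟩
    (p ∸ (b + i)) * (p * deltaDen n)  ≡⟨ *-assoc (p ∸ (b + i)) p (deltaDen n) ⟨
    (p ∸ (b + i)) * p * deltaDen n  ≤⟨ *-monoˡ-≤ (deltaDen n) core ⟩
    (p ∸ b) * (p ∸ i) * deltaDen n  ≡⟨ cong (λ z → (p ∸ b) * (p ∸ i) * p ^ suc z) /≡ ⟨
    deltaNum n * (p ∸ i) * deltaDen (n + i)  ∎
    where
    open ≤-Reasoning
    a b : ℕ
    a = n / p-1
    b = n % p-1
    n+i : n + i ≡ (b + i) + a * p-1
    n+i = trans (cong (_+ i) (m≡m%n+[m/n]*n n p-1)) (r b (a * p-1) i)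
      where
      r : ∀ b c i → b + c + i ≡ b + i + c
      r = solve-∀
    /≡ : (n + i) / p-1 ≡ a
    /≡ = trans (cong (_/ p-1) n+i) (proj₁ (divMod-unique (b + i) a lt))
    %≡ : (n + i) % p-1 ≡ b + i
    %≡ = trans (cong (_% p-1) n+i) (proj₂ (divMod-unique (b + i) a lt))
    core : (p ∸ (b + i)) * p ≤ (p ∸ b) * (p ∸ i)
    core = begin
      (p ∸ (b + i)) * p  ≡⟨ cong (_* p) (∸-+-assoc p b i) ⟨
      (p ∸ b ∸ i) * p  ≡⟨ *-distribʳ-∸ p (p ∸ b) i ⟩
      (p ∸ b) * p ∸ i * p  ≤⟨ ∸-monoʳ-≤ ((p ∸ b) * p) (≤-trans (≤-reflexive (*-comm (p ∸ b) i)) (*-monoʳ-≤ i (m∸n≤m p b))) ⟩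
      (p ∸ b) * p ∸ (p ∸ b) * i  ≡⟨ *-distribˡ-∸ (p ∸ b) p i ⟨
      (p ∸ b) * (p ∸ i)  ∎
  ... | inj₂ ge = begin
    deltaNum (n + i) * (p * deltaDen n)  ≡⟨ cong₂ (λ z w → (p ∸ z) * w) %≡ (sym den) ⟩
    (p ∸ r) * deltaDen (n + i)  ≤⟨ *-monoˡ-≤ (deltaDen (n + i)) (m≤n+o⇒m∸o≤n′ {p} {(p ∸ b) * (p ∸ i)} {r} core) ⟩
    (p ∸ b) * (p ∸ i) * deltaDen (n + i)  ∎
    where
    open ≤-Reasoning
    a b r : ℕ
    a = n / p-1
    b = n % p-1
    r = b + i ∸ p-1
    m≤n+o⇒m∸o≤n′ : ∀ {m n o} → m ≤ n + o → m ∸ o ≤ n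
    m≤n+o⇒m∸o≤n′ {m} {n} {o} h = ≤-trans (∸-monoˡ-≤ o h) (≤-reflexive (m+n∸n≡m n o))
    b< : b < p-1
    b< = m%n<n n p-1
    r< : r < p-1
    r< = +-cancelˡ-< p-1 r p-1 (≤-<-trans (≤-reflexive (m+[n∸m]≡n ge)) (+-mono-<-≤ b< i≤))
    n+i : n + i ≡ r + suc a * p-1
    n+i = trans (cong (_+ i) (m≡m%n+[m/n]*n n p-1)) (trans (s b (a * p-1) i) (trans (cong (_+ a * p-1) (sym (m∸n+n≡m ge))) (+-assoc r p-1 (a * p-1))))
      where
      s : ∀ b c i → b + c + i ≡ b + i + c
      s = solve-∀
    %≡ : (n + i) % p-1 ≡ r
    %≡ = trans (cong (_% p-1) n+i) (proj₂ (divMod-unique r (suc a) r<))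
    den : deltaDen (n + i) ≡ p * deltaDen n
    den = cong (λ z → p ^ suc z) (trans (cong (_/ p-1) n+i) (proj₁ (divMod-unique r (suc a) r<)))
    b≤p : b ≤ p
    b≤p = ≤-trans (<⇒≤ b<) (n≤1+n p-1)
    i≤p : i ≤ p
    i≤p = ≤-trans i≤ (n≤1+n p-1)
    t : ∀ u b v i → (u + b) + (v + i) ≡ b + i + (u + v)
    t = solve-∀
    t′ : ∀ x y → x + (y + 1) ≡ 1 + (y + x)
    t′ = solve-∀
    core : p ≤ (p ∸ b) * (p ∸ i) + r
    core = +-cancelʳ-≤ p p _ (begin
      p + p  ≡⟨ cong₂ _+_ (m∸n+n≡m b≤p) (m∸n+n≡m i≤p) ⟨
      ((p ∸ b) + b) + ((p ∸ i) + i)  ≡⟨ t (p ∸ b) b (p ∸ i) i ⟩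
      b + i + ((p ∸ b) + (p ∸ i))  ≤⟨ +-monoʳ-≤ (b + i) (product-bound (m<n⇒0<n∸m (≤-<-trans (<⇒≤ b<) (n<1+n p-1))) (m<n⇒0<n∸m (s≤s i≤))) ⟩
      b + i + ((p ∸ b) * (p ∸ i) + 1)  ≡⟨ t′ (b + i) ((p ∸ b) * (p ∸ i)) ⟩
      suc ((p ∸ b) * (p ∸ i) + (b + i))  ≡⟨ cong (λ z → suc ((p ∸ b) * (p ∸ i) + z)) (m∸n+n≡m ge) ⟨
      suc ((p ∸ b) * (p ∸ i) + (r + p-1))  ≡⟨ cong suc (+-assoc ((p ∸ b) * (p ∸ i)) r p-1) ⟨
      suc ((p ∸ b) * (p ∸ i) + r + p-1)  ≡⟨ +-suc _ p-1 ⟨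
      (p ∸ b) * (p ∸ i) + r + p  ∎)

  findT : ∀ {q} t (χ : Vec (Fin q) t → Bool) → (∃ λ s → χ s ≡ true) ⊎ (∀ s → χ s ≡ false)
  findT zero χ with χ [] in e
  ... | true  = inj₁ ([] , e)
  ... | false = inj₂ λ { [] → e }
  findT {q} (suc t) χ with any? (λ x → found? (findT t (λ s → χ (x ∷ s))))
    where
    found? : ∀ {χ′ : Vec (Fin q) t → Bool} → (∃ λ s → χ′ s ≡ true) ⊎ (∀ s → χ′ s ≡ false) → Dec (∃ λ s → χ′ s ≡ true)
    found? (inj₁ h) = yes h
    found? (inj₂ h) = no λ { (s , e) → contradiction (trans (sym e) (h s)) λ () }
  ... | yes (x , s , e) = inj₁ (x ∷ s , e)
  ... | no none = inj₂ λ { (x ∷ s) → ¬true (λ e → none (x , s , e)) }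
    where
    ¬true : ∀ {b} → b ≢ true → b ≡ false
    ¬true {true}  h = contradiction refl h
    ¬true {false} h = refl

  nz : F → Bool
  nz a = not (a == 0F)

  nz-true : ∀ {a} → nz a ≡ true → a ≢ 0F
  nz-true {a} e h with a ≟ 0F
  nz-true () h | yes _
  ... | no n = n h

  nz-false : ∀ {a} → nz a ≡ false → a ≡ 0F
  nz-false {a} e with a ≟ 0F
  ... | yes h = h
  nz-false () | no _

  weight : ∀ t → (Vec F t → F) → ℕ
  weight t φ = sumT t (λ s → ind (nz (φ s)))

  module _ (t : ℕ) where
    open Linear (vecGroup t)

    WeightBound : Set
    WeightBound = ∀ j (φ : Vec F t → F) → DegLt (suc j) φ → ∀ s → φ s ≢ 0F → deltaNum j * p ^ t ≤ deltaDen j * weight t φ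

    -- The i-th difference is nonzero for a fraction at least δ(j - i) of the s, and for each such s
    -- the sequence in n has at most i zeros among p terms; `delta-step` bounds δ(j - i)(1 - i/p)
    -- from below by δ(j).
    top-difference : WeightBound → ∀ j (P : ℕ → Vec F t → F) i → i ≤ p-1 → i ≤ j →
      (∀ l → i < l → l < p → ∀ s → diff l (λ n → P n s) 0 ≡ 0F) →
      DegLt (suc (j ∸ i)) (λ s → diff i (λ n → P n s) 0) → ∀ s → diff i (λ n → P n s) 0 ≢ 0F →
      deltaNum j * p ^ suc t ≤ deltaDen j * sumT t (λ s → count (λ (x : F) → nz (P (toℕ x) s)))
    top-difference wb j P i i≤ i≤j van deg s₀ s₀≠0 = *-cancelˡ-≤ (deltaDen n) {{m^n≢0 p (suc (n / p-1))}} (begin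
      deltaDen n * (deltaNum j * (p * p ^ t))  ≡⟨ r₁ (deltaDen n) (deltaNum j) p (p ^ t) ⟩
      deltaNum j * (p * deltaDen n) * p ^ t  ≤⟨ *-monoˡ-≤ (p ^ t) (subst (λ z → deltaNum z * (p * deltaDen n) ≤ deltaNum n * (p ∸ i) * deltaDen z) (m∸n+n≡m i≤j) (delta-step n i i≤)) ⟩
      deltaNum n * (p ∸ i) * deltaDen j * p ^ t  ≡⟨ r₂ (deltaNum n) (p ∸ i) (deltaDen j) (p ^ t) ⟩
      deltaDen j * ((p ∸ i) * (deltaNum n * p ^ t))  ≤⟨ *-monoʳ-≤ (deltaDen j) (*-monoʳ-≤ (p ∸ i) (wb n φ deg s₀ s₀≠0)) ⟩
      deltaDen j * ((p ∸ i) * (deltaDen n * weight t φ))  ≡⟨ r₃ (deltaDen j) (p ∸ i) (deltaDen n) (weight t φ) ⟩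
      deltaDen n * (deltaDen j * ((p ∸ i) * weight t φ))  ≡⟨ cong (λ z → deltaDen n * (deltaDen j * z)) (sumT-*ˡ t (p ∸ i) (λ s → ind (nz (φ s)))) ⟨
      deltaDen n * (deltaDen j * sumT t (λ s → (p ∸ i) * ind (nz (φ s))))  ≤⟨ *-monoʳ-≤ (deltaDen n) (*-monoʳ-≤ (deltaDen j) (sumT-mono t pw)) ⟩
      deltaDen n * (deltaDen j * sumT t (λ s → count (λ (x : F) → nz (P (toℕ x) s))))  ∎)
      where
      open ≤-Reasoning
      n : ℕ
      n = j ∸ i
      φ : Vec F t → F
      φ s = diff i (λ l → P l s) 0
      r₁ : ∀ d n p q → d * (n * (p * q)) ≡ n * (p * d) * q
      r₁ = solve-∀
      r₂ : ∀ a b c d → a * b * c * d ≡ c * (b * (a * d))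
      r₂ = solve-∀
      r₃ : ∀ a b c d → a * (b * (c * d)) ≡ c * (a * (b * d))
      r₃ = solve-∀
      pw : ∀ s → (p ∸ i) * ind (nz (φ s)) ≤ count (λ (x : F) → nz (P (toℕ x) s))
      pw s with φ s ≟ 0F
      ... | yes _ = ≤-trans (≤-reflexive (*-zeroʳ (p ∸ i))) z≤n
      ... | no ne = ≤-trans (≤-reflexive (*-identityʳ (p ∸ i))) (≤-trans (∸-monoʳ-≤ p (zeros-≤ (λ l → P l s) i (λ l lt lt′ → van l lt lt′ s) ne))
              (≤-reflexive (trans (cong (_∸ zc) (sym (count-not (λ (x : F) → P (toℕ x) s == 0F)))) (m+n∸m≡n zc _))))
        where
        zc : ℕ
        zc = count (λ (x : F) → P (toℕ x) s == 0F)

    -- The largest index i at which the difference is not identically zero satisfies i₀ ≤ i ≤ j and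
    -- feeds `top-difference`. The conditions start at order i₀ so that, with i₀ = 1, P may contain
    -- an arbitrary term that is constant in n, such as g.
    family-bound : WeightBound → ∀ j (P : ℕ → Vec F t → F) i₀ s₀ → i₀ < p → diff i₀ (λ n → P n s₀) 0 ≢ 0F →
      (∀ l → i₀ ≤ l → l ≤ j → DegLt (suc (j ∸ l)) (λ s → diff l (λ n → P n s) 0)) →
      (∀ l → i₀ ≤ l → j < l → l < p → ∀ s → diff l (λ n → P n s) 0 ≡ 0F) →
      deltaNum j * p ^ suc t ≤ deltaDen j * sumT t (λ s → count (λ (x : F) → nz (P (toℕ x) s)))
    family-bound wb j P i₀ s₀ i₀<p ne deg van = go p ≤-refl (λ l le lt → contradiction lt (≤⇒≯ le))
      where
      go : ∀ n → n ≤ p → (∀ l → n ≤ l → l < p → ∀ s → diff l (λ n → P n s) 0 ≡ 0F) →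
        deltaNum j * p ^ suc t ≤ deltaDen j * sumT t (λ s → count (λ (x : F) → nz (P (toℕ x) s)))
      go zero    n≤ z = contradiction (z i₀ z≤n i₀<p s₀) ne
      go (suc i) n≤ z with <-≤-connex i i₀
      ... | inj₁ i<i₀ = contradiction (z i₀ i<i₀ i₀<p s₀) ne
      ... | inj₂ i₀≤i with findT t (λ s → nz (diff i (λ n → P n s) 0))
      ... | inj₁ (s , e) with ≤-<-connex i j
      ...   | inj₁ i≤j = top-difference wb j P i (≤-pred n≤) i≤j (λ l lt lp → z l lt lp) (deg i i₀≤i i≤j) s (nz-true e)
      ...   | inj₂ j<i = contradiction (van i i₀≤i j<i n≤ s) (nz-true e)
      go (suc i) n≤ z | inj₂ i₀≤i | inj₂ zz = go i (<⇒≤ n≤) z′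
        where
        z′ : ∀ l → i ≤ l → l < p → ∀ s → diff l (λ n → P n s) 0 ≡ 0F
        z′ l le lt s with m≤n⇒m<n∨m≡n le
        ... | inj₁ i<l  = z l i<l lt s
        ... | inj₂ refl = nz-false (zz s)

  -- The first coordinate serves as the parameter of `family-bound`: its l-th difference at 0 is a
  -- function of the others with degree lowered by l. Some difference of order below p is nonzero at
  -- s₀, since otherwise φ would vanish on the whole line through the given point.
  weight-bound : ∀ t → WeightBound t
  weight-bound zero j φ deg [] ne = begin
    deltaNum j * 1  ≡⟨ *-identityʳ (deltaNum j) ⟩
    deltaNum j  ≤⟨ m∸n≤m p (j % p-1) ⟩
    p  ≡⟨ *-identityʳ p ⟨
    p * 1  ≤⟨ *-monoʳ-≤ p (m^n>0 p (j / p-1)) ⟩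
    deltaDen j  ≡⟨ *-identityʳ (deltaDen j) ⟨
    deltaDen j * 1  ≡⟨ cong (deltaDen j *_) (cong (ind ∘ not) (==-false ne)) ⟨
    deltaDen j * ind (nz (φ []))  ∎
    where open ≤-Reasoning
  weight-bound (suc t) j φ deg (x₀ ∷ s₀) ne = ≤-trans bound
      (≤-reflexive (cong (deltaDen j *_) (trans (sumT-sum t (λ s (x : F) → ind (nz (P (toℕ x) s)))) (sum-cong-≗ {p} (λ x → sumT-cong t (λ s → cong (λ z → ind (nz (φ (z ∷ s)))) ([]-toℕ x)))))))
    where
    module V = Linear (vecGroup t)
    module V⁺ = Linear (vecGroup (suc t))
    P : ℕ → Vec F t → F
    P n s = φ ([ n ] ∷ s)
    e₁ : Vec F (suc t)
    e₁ = 1F ∷ replicate t 0F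
    ψ : ℕ → Vec F (suc t) → F
    ψ zero    y = φ y
    ψ (suc l) y = ψ l (y V⁺.∙ e₁) ⊝ ψ l y
    ψ-diff : ∀ l n s → diff l (λ m → P m s) n ≡ ψ l ([ n ] ∷ s)
    ψ-diff zero    n s = refl
    ψ-diff (suc l) n s = cong₂ _⊝_ (trans (ψ-diff l (suc n) s) (cong (ψ l) (cong₂ _∷_ ([]-suc n) (sym (V.∙-idʳ s))))) (ψ-diff l n s)
    lower : ∀ n {χ} → V⁺.DegLt (suc n) χ → V⁺.DegLt n (λ y → χ (y V⁺.∙ e₁) ⊝ χ y)
    lower n {χ} d b y = trans (V⁺.D-inner b χ e₁ y) (d (e₁ ∷ b) y)
    deg-zero : ∀ {χ} → V⁺.DegLt 0 χ → V⁺.DegLt 0 (λ y → χ (y V⁺.∙ e₁) ⊝ χ y)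
    deg-zero d [] y = trans (cong₂ _⊝_ (d [] (y V⁺.∙ e₁)) (d [] y)) (⊝-self 0F)
    -- Subtraction is truncated: for l > j the bound is degree below 0, that is, vanishing, as
    -- `family-bound` demands beyond order j.
    ψ-deg : ∀ l → V⁺.DegLt (suc j ∸ l) (ψ l)
    ψ-deg zero    = deg
    ψ-deg (suc l) with suc j ∸ l | ψ-deg l | ∸-suc′ (suc j) l
      where
      ∸-suc′ : ∀ m n → m ∸ suc n ≡ Data.Nat.pred (m ∸ n)
      ∸-suc′ m n = sym (pred[m∸n]≡m∸[1+n] m n)
    ... | zero  | d | e = subst (λ z → V⁺.DegLt z (ψ (suc l))) (sym e) (deg-zero d)
    ... | suc n | d | e = subst (λ z → V⁺.DegLt z (ψ (suc l))) (sym e) (lower n d)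
    slice : ∀ {n} (χ : Vec F (suc t) → F) z (b : Vec (Vec F t) n) s → V.D b (λ s → χ (z ∷ s)) s ≡ V⁺.D (map (0F ∷_) b) χ (z ∷ s)
    slice χ z []      s = refl
    slice χ z (v ∷ b) s = cong₂ _⊝_ (trans (slice χ z b (s V.∙ v)) (cong (λ w → V⁺.D (map (0F ∷_) b) χ (w ∷ (s V.∙ v))) (sym (⊕-0ʳ z)))) (slice χ z b s)
    deg′ : ∀ l → V.DegLt (suc j ∸ l) (λ s → diff l (λ n → P n s) 0)
    deg′ l b s = trans (V.D-cong b (ψ-diff l 0) s) (trans (slice (ψ l) 0F b s) (ψ-deg l (map (0F ∷_) b) (0F ∷ s)))
    Bound : Set
    Bound = deltaNum j * p ^ suc t ≤ deltaDen j * sumT t (λ s → count (λ (x : F) → nz (P (toℕ x) s)))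
    Found Vanish : ℕ → Set
    Found l = ∃ λ s → nz (diff l (λ n → P n s) 0) ≡ true
    Vanish l = ∀ s → nz (diff l (λ n → P n s) 0) ≡ false
    some-diff : ∀ n → (∃ λ l → l < n × Found l) ⊎ (∀ l → l < n → Vanish l)
    some-diff zero    = inj₂ λ l ()
    some-diff (suc n) with some-diff n | findT t (λ s → nz (diff n (λ m → P m s) 0))
    ... | inj₁ (l , lt , r) | _ = inj₁ (l , <-trans lt (n<1+n n) , r)
    ... | inj₂ _ | inj₁ r = inj₁ (n , n<1+n n , r)
    ... | inj₂ a | inj₂ b = inj₂ c
      where
      c : ∀ l → l < suc n → Vanish l
      c l (s≤s le) with m≤n⇒m<n∨m≡n le
      ... | inj₁ lt   = a l lt
      ... | inj₂ refl = b
    bound : Bound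
    bound with some-diff p
    ... | inj₁ (l , lt , s , e) = family-bound t (weight-bound t) j P l s lt (nz-true e)
        (λ l′ _ le → subst (λ z → V.DegLt z (λ s → diff l′ (λ n → P n s) 0)) (+-∸-assoc 1 le) (deg′ l′))
        (λ l′ _ gt _ s′ → subst (λ z → V.DegLt z (λ s → diff l′ (λ n → P n s) 0)) (m≤n⇒m∸n≡0 gt) (deg′ l′) [] s′)
    ... | inj₂ all = contradiction
        (trans (cong (λ z → φ (z ∷ s₀)) (sym ([]-toℕ x₀))) (diff-zero p (λ n → P n s₀) (λ l lt → nz-false (all l lt s₀)) (toℕ x₀) 0 (subst (_< p) (sym (+-identityʳ (toℕ x₀))) (toℕ<n x₀)))) ne

  -- The contradiction from a nonzero shift κ

  sumTo : ℕ → (ℕ → ℕ) → ℕ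
  sumTo zero    w = 0
  sumTo (suc n) w = w n + sumTo n w

  module _ {K q : ℕ} where

    most-below : ∀ n (w : ℕ → ℕ) {P : ℕ → Fin q → Set} → (∀ i → i < n → Most K (w i) (P i)) → Most K (sumTo n w) (λ y → ∀ i → i < n → P i y)
    most-below zero    w h = most-all (λ y i ())
    most-below (suc n) w {P} h = most-map step (most-∧ (h n (n<1+n n)) (most-below n w (λ i lt → h i (<-trans lt (n<1+n n)))))
      where
      step : ∀ y → P n y × (∀ i → i < n → P i y) → ∀ i → i < suc n → P i y
      step y (a , b) i (s≤s le) with m≤n⇒m<n∨m≡n le
      ... | inj₁ lt   = b i lt
      ... | inj₂ refl = a

    most-Vec : ∀ {r w} t {P : Vec (Fin r) t → Fin q → Set} → (∀ s → Most K w (P s)) → Most K (r ^ t * w) (λ y → ∀ s → P s y)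
    most-Vec {w = w} zero    h = most-weaken (≤-reflexive (sym (*-identityˡ w))) (most-map (λ { y a [] → a }) (h []))
    most-Vec {r} {w} (suc t) h = most-weaken (≤-reflexive (sym (*-assoc r (r ^ t) w))) (most-map (λ { y a (x ∷ s) → a x s }) (most-Fin r (λ x → most-Vec t (λ s → h (x ∷ s)))))

    most-VecVec : ∀ {r w t} n {P : Vec (Vec (Fin r) t) n → Fin q → Set} → (∀ σ → Most K w (P σ)) → Most K ((r ^ t) ^ n * w) (λ y → ∀ σ → P σ y)
    most-VecVec {w = w} zero h = most-weaken (≤-reflexive (sym (*-identityˡ w))) (most-map (λ { y a [] → a }) (h []))
    most-VecVec {r} {w} {t} (suc n) h = most-weaken (≤-reflexive (sym (*-assoc (r ^ t) ((r ^ t) ^ n) w))) (most-map (λ { y a (s ∷ σ) → a s σ }) (most-Vec t (λ s → most-VecVec n (λ σ → h (s ∷ σ)))))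

  -- The weight of the constancy statement for the difference of order i + 1, reached after i
  -- applications of `constant-next`.
  wConst : ℕ → ℕ → ℕ → ℕ
  wConst ℓ zero    = wFirst ℓ
  wConst ℓ (suc i) = wNext (ℓ ∸ suc i) (suc i) (wConst ℓ i)

  wDegree : ℕ → ℕ → ℕ
  wDegree ℓ i = (p ^ ℓ) ^ suc (ℓ ∸ i) * (p ^ ℓ * (wConst ℓ i 0 + wConst ℓ i 0))

  wVanish : ℕ → ℕ → ℕ
  wVanish ℓ n = p ^ ℓ * (wConst ℓ ℓ (suc n) + wConst ℓ ℓ n)

  wFine : ℕ → ℕ
  wFine ℓ = sumTo (suc ℓ) (wDegree ℓ) + (sumTo p (wVanish ℓ) + wFirst ℓ 0)

  -- The first term pays for the points that are not `Fine`, the second for the at most p steps in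
  -- which τ preserves g only approximately.
  wTotal : ℕ → ℕ
  wTotal ℓ = deltaNum (suc ℓ) * wFine ℓ + deltaDen (suc ℓ) * p

  distance : ∀ {q} → (Fin q → F) → (Fin q → F) → ℕ
  distance f g = count (λ y → nz (f y ⊝ g y))

  diff-⊝-const : ∀ i (h : ℕ → F) c n → diff (suc i) (λ l → h l ⊝ c) n ≡ diff (suc i) h n
  diff-⊝-const i h c n = trans (diff-⊝ (suc i) h (λ _ → c) n) (trans (cong (diff (suc i) h n ⊝_) (diff-const i c n)) (⊝-0ʳ _))

  diff-vanish : ∀ m (h : ℕ → F) → (∀ n → n < p → diff m h n ≡ 0F) → ∀ l n → n + l < p → diff (l + m) h n ≡ 0F
  diff-vanish m h z zero    n lt = z n (subst (_< p) (+-identityʳ n) lt)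
  diff-vanish m h z (suc l) n lt = trans (cong₂ _⊝_ (diff-vanish m h z l (suc n) (subst (_< p) (+-suc n l) lt)) (diff-vanish m h z l n (<-trans (n<1+n _) (subst (_< p) (+-suc n l) lt)))) (⊝-self 0F)

  module Contradiction {q : ℕ} (G : VectorGroup (Fin q)) (f g : Fin q → F) (ℓ : ℕ) (K : ℕ)
    {m M} (a₀ : Vec (Fin q) m) (top : Vec (Fin q) M) (a₀⊆top : ∀ {v} → Linear.Span G a₀ v → Linear.Span G top v)
    (Good : Fin q → Set) (determined : ∀ {y y′} → Good y → Good y′ → Relative.Rel G f g ℓ a₀ (Relative.0ˢ G f g ℓ) y y′ → f y ≡ f y′)
    (κ : Relative.Shift G f g ℓ) (τ : Permutation′ q)
    (most-good : Most K 1 Good) (most-τ : Most K 1 (λ y → Relative.Rel G f g ℓ top κ y (τ ⟨$⟩ʳ y))) where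
    open Linear G
    open Relative G f g ℓ

    open Orbit G f g ℓ K a₀ top a₀⊆top Good determined κ τ most-good most-τ

    j : ℕ
    j = suc ℓ

    module V = Linear (vecGroup ℓ)

    module _ (b : Vec X ℓ) (b∈ : Allᵛ (Span a₀) b) (κb≠0 : κ b ≢ 0F)
      (constants : ∀ i → i ≤ ℓ → Constant (ℓ ∸ i) (suc i) a₀ (wConst ℓ i)) where

      β : Vec F ℓ → X
      β = lincomb b

      β∈ : ∀ s → Span a₀ (β s)
      β∈ = span-lincomb b∈

      D-pull : ∀ {n} (φ : X → F) y (σ : Vec (Vec F ℓ) n) s → V.D σ (λ s → φ (y ∙ β s)) s ≡ D (map β σ) φ (y ∙ β s)
      D-pull φ y []      s = refl
      D-pull φ y (u ∷ σ) s = cong₂ _⊝_ (trans (D-pull φ y σ (s V.∙ u)) (cong (D (map β σ) φ) (trans (cong (y ∙_) (lincomb-⊕ b s u)) (sym (∙-assoc y (β s) (β u)))))) (D-pull φ y σ s)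

      in-map : ∀ {n} (σ : Vec (Vec F ℓ) n) → Allᵛ (Span a₀) (map β σ)
      in-map []      = []
      in-map (u ∷ σ) = β∈ u ∷ in-map σ

      -- Only the translate y + span(b) is inspected, so the number of conditions is bounded in
      -- terms of p and ℓ and `fine` can take a union bound.
      record Fine (y : X) : Set where
        field
          degree : ∀ i → i < suc ℓ → ∀ (σ : Vec (Vec F ℓ) (suc (ℓ ∸ i))) s → D (map β σ) (Δ (suc i) 0) (y ∙ β s) ≡ 0F
          vanish : ∀ n → n < p → ∀ s → Δ (suc j) n (y ∙ β s) ≡ 0F
          jump   : D b (Δ 1 0) y ≡ κ b

      fine : Most K (wFine ℓ) Fine
      fine = most-map (λ y (d , v , e) → record { degree = λ i lt σ s → d i lt σ s ; vanish = v ; jump = e })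
        (most-∧ (most-below (suc ℓ) (wDegree ℓ) {λ i y → ∀ (σ : Vec (Vec F ℓ) (suc (ℓ ∸ i))) s → D (map β σ) (Δ (suc i) 0) (y ∙ β s) ≡ 0F} (λ i lt → most-VecVec (suc (ℓ ∸ i)) (λ σ → most-Vec ℓ (λ s → most-perm (translate (β s)) (deg i (≤-pred lt) σ)))))
          (most-∧ (most-below p (wVanish ℓ) (λ n lt → most-Vec ℓ (λ s → most-perm (translate (β s)) (van n))))
            (proj₂ (constant-first b (VecAll.map a₀⊆top b∈)) 0)))
        where
        deg : ∀ i → i ≤ ℓ → (σ : Vec (Vec F ℓ) (suc (ℓ ∸ i))) → Most K (wConst ℓ i 0 + wConst ℓ i 0) (λ y → D (map β σ) (Δ (suc i) 0) y ≡ 0F)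
        deg i le (u ∷ σ) = let (C , mc) = constants i le (map β σ) (in-map σ) in
          most-map (λ y (e₁ , e₂) → trans (cong₂ _⊝_ e₁ e₂) (⊝-self C)) (most-∧ (most-perm (translate (β u)) (mc 0)) (mc 0))
        last : Constant 0 (suc ℓ) a₀ (wConst ℓ ℓ)
        last = subst (λ n → Constant n (suc ℓ) a₀ (wConst ℓ ℓ)) (n∸n≡0 ℓ) (constants ℓ ≤-refl)
        van : ∀ n → Most K (wConst ℓ ℓ (suc n) + wConst ℓ ℓ n) (λ y → Δ (suc j) n y ≡ 0F)
        van n = constant⇒zero {i = suc ℓ} {w = wConst ℓ ℓ} last [] [] n

      D-zero : ∀ {n} (φ : X → F) y (c : Vec X n) → Allᵛ (Span b) c → (∀ s → φ (y ∙ β s) ≡ 0F) → ∀ {v} → Span b v → D c φ (y ∙ v) ≡ 0F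
      D-zero φ y []      h        z (coeffs s refl) = z s
      D-zero φ y (u ∷ c) (hu ∷ h) z {v} hv = trans (cong₂ _⊝_ (trans (cong (D c φ) (∙-assoc y v u)) (D-zero φ y c h z (span-∙ hv hu))) (D-zero φ y c h z hv)) (⊝-self 0F)

      all-self : ∀ {n} (c : Vec X n) → Allᵛ (Span c) c
      all-self []      = []
      all-self (x ∷ c) = span-head c x ∷ VecAll.map (span-∷ x) (all-self c)

      module _ {y : X} (fy : Fine y) where
        open Fine fy

        P : ℕ → Vec F ℓ → F
        P n s = Fₖ n (y ∙ β s) ⊝ g (y ∙ β s)

        P-diff : ∀ i s → diff (suc i) (λ n → P n s) 0 ≡ Δ (suc i) 0 (y ∙ β s)
        P-diff i s = diff-⊝-const i (λ n → Fₖ n (y ∙ β s)) (g (y ∙ β s)) 0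

        line-bound : deltaNum j * p ^ suc ℓ ≤ deltaDen j * sumT ℓ (λ s → count (λ (x : F) → nz (P (toℕ x) s)))
        line-bound with findT ℓ (λ s → nz (Δ 1 0 (y ∙ β s)))
        -- If the first difference in k vanished on y + span(b), so would its differences in the
        -- directions b, one of which is κ b.
        ... | inj₂ z = contradiction (trans (sym jump) (trans (cong (D b (Δ 1 0)) (sym (∙-idʳ y))) (D-zero (Δ 1 0) y b (all-self b) (λ s → nz-false (z s)) span-ε))) κb≠0
        ... | inj₁ (s₀ , e₀) = family-bound ℓ (weight-bound ℓ) j P 1 s₀ (s≤s (s≤s z≤n)) (λ e → nz-true e₀ (trans (sym (P-diff 0 s₀)) e)) deg van
          where
          deg : ∀ l → 1 ≤ l → l ≤ j → V.DegLt (suc (j ∸ l)) (λ s → diff l (λ n → P n s) 0)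
          deg (suc i) _ (s≤s le) σ s = trans (V.D-cong σ (P-diff i) s) (trans (D-pull (Δ (suc i) 0) y σ s) (degree i (s≤s le) σ s))
          van : ∀ l → 1 ≤ l → j < l → l < p → ∀ s → diff l (λ n → P n s) 0 ≡ 0F
          van (suc i) _ (s≤s j≤i) lt s = trans (P-diff i s) (subst (λ l → diff l (λ n → Fₖ n (y ∙ β s)) 0 ≡ 0F) (m∸n+n≡m (s≤s j≤i))
            (diff-vanish (suc j) (λ n → Fₖ n (y ∙ β s)) (λ n lt′ → vanish n lt′ s) (i ∸ j) 0 (≤-<-trans (m∸n≤m i j) (<-trans (n<1+n i) lt))))

      -- For most y, g takes the same value at y and τⁿ y, and τⁿ is a permutation; so comparing
      -- f(τⁿ y) with g(y) over all y is almost comparing f with g.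
      shifted-distance : ∀ n → K * count (λ y → nz (Fₖ n y ⊝ g y)) ≤ K * distance f g + n * q
      shifted-distance n = begin
        K * count (λ y → nz (Fₖ n y ⊝ g y))  ≤⟨ *-monoʳ-≤ K (sum-mono pw) ⟩
        K * sum (λ y → ind (nz (f (pow n y) ⊝ g (pow n y))) + ind (Most.bad (most-rel n) y))  ≡⟨ cong (K *_) (∑-distrib-+ (λ y → ind (nz (f (pow n y) ⊝ g (pow n y)))) (ind ∘ Most.bad (most-rel n))) ⟩
        K * (sum (λ y → ind (nz (f (pow n y) ⊝ g (pow n y)))) + count (Most.bad (most-rel n)))  ≡⟨ *-distribˡ-+ K _ (count (Most.bad (most-rel n))) ⟩
        K * sum (λ y → ind (nz (f (pow n y) ⊝ g (pow n y)))) + K * count (Most.bad (most-rel n))  ≤⟨ +-mono-≤ (≤-reflexive (cong (K *_) (sym (sum-permute (λ y → ind (nz (f y ⊝ g y))) (τ^ n))))) (Most.small (most-rel n)) ⟩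
        K * distance f g + n * q  ∎
        where
        open ≤-Reasoning
        pw : ∀ y → ind (nz (Fₖ n y ⊝ g y)) ≤ ind (nz (f (pow n y) ⊝ g (pow n y))) + ind (Most.bad (most-rel n) y)
        pw y with Most.bad (most-rel n) y | Most.holds (most-rel n) y
        ... | true  | _ = ≤-trans (ind-≤1 _) (m≤n+m 1 (ind (nz (f (pow n y) ⊝ g (pow n y)))))
        ... | false | h = ≤-trans (≤-reflexive (cong (λ z → ind (nz (Fₖ n y ⊝ z))) (trans (cong g (sym (∙-idʳ y))) (trans (same (h refl) span-ε) (cong g (∙-idʳ (pow n y))))))) (m≤m+n _ 0)

      lines : X → ℕ
      lines y = sumT ℓ (λ s → count (λ (x : F) → nz (Fₖ (toℕ x) (y ∙ β s) ⊝ g (y ∙ β s))))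

      lines-total : K * sum lines ≤ p * p ^ ℓ * (K * distance f g + p * q)
      lines-total = begin
        K * sum lines  ≡⟨ cong (K *_) (sumT-sum ℓ (λ s y → count (λ (x : F) → nz (Fₖ (toℕ x) (y ∙ β s) ⊝ g (y ∙ β s))))) ⟨
        K * sumT ℓ (λ s → sum (λ y → count (λ (x : F) → nz (Fₖ (toℕ x) (y ∙ β s) ⊝ g (y ∙ β s)))))
                                                                     ≡⟨ cong (K *_) (sumT-cong ℓ (λ s → sym (sum-permute (λ y → count (λ (x : F) → nz (Fₖ (toℕ x) y ⊝ g y))) (translate (β s))))) ⟩
        K * sumT ℓ (λ _ → S)  ≡⟨ cong (K *_) (sumT-const ℓ S) ⟩
        K * (p ^ ℓ * S)  ≡⟨ r₁ K (p ^ ℓ) S ⟩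
        p ^ ℓ * (K * S)  ≤⟨ *-monoʳ-≤ (p ^ ℓ) S-bound ⟩
        p ^ ℓ * (p * (K * distance f g + p * q))  ≡⟨ r₂ (p ^ ℓ) p _ ⟩
        p * p ^ ℓ * (K * distance f g + p * q)  ∎
        where
        open ≤-Reasoning
        S : ℕ
        S = sum (λ y → count (λ (x : F) → nz (Fₖ (toℕ x) y ⊝ g y)))
        r₁ : ∀ a b c → a * (b * c) ≡ b * (a * c)
        r₁ = solve-∀
        r₂ : ∀ a b c → a * (b * c) ≡ b * a * c
        r₂ = solve-∀
        S-bound : K * S ≤ p * (K * distance f g + p * q)
        S-bound = begin
          K * S  ≡⟨ cong (K *_) (∑-comm (λ y (x : F) → ind (nz (Fₖ (toℕ x) y ⊝ g y)))) ⟩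
          K * sum (λ (x : F) → count (λ y → nz (Fₖ (toℕ x) y ⊝ g y)))  ≡⟨ sum-*ˡ K (λ (x : F) → count (λ y → nz (Fₖ (toℕ x) y ⊝ g y))) ⟨
          sum (λ (x : F) → K * count (λ y → nz (Fₖ (toℕ x) y ⊝ g y)))  ≤⟨ sum-≤-const {p} (K * distance f g + p * q) (λ x → ≤-trans (shifted-distance (toℕ x)) (+-monoʳ-≤ (K * distance f g) (*-monoˡ-≤ q (<⇒≤ (toℕ<n x))))) ⟩
          p * (K * distance f g + p * q)  ∎

      lines-lower : ∀ y → deltaNum j * (p * p ^ ℓ) ≤ deltaDen j * lines y + deltaNum j * (p * p ^ ℓ) * ind (Most.bad fine y)
      lines-lower y = most-or-bad fine y line-bound

      -- Disagreements are counted twice over all y, all points of `Vec F ℓ` and all n < p: from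
      -- below for each fine y by `line-bound`, from above for each n by `shifted-distance`.
      total-bound : K * (deltaNum j * q) ≤ K * (deltaDen j * distance f g) + wTotal ℓ * q
      total-bound = *-cancelˡ-≤ pp {{m*n≢0 p (p ^ ℓ) {{_}} {{m^n≢0 p ℓ}}}} (begin
        pp * (K * (N * q))  ≡⟨ r₁ pp K N q ⟩
        K * (q * (N * pp))  ≤⟨ *-monoʳ-≤ K (≤-trans (sum-≥-const {q} (N * pp) lines-lower) (≤-reflexive (trans (∑-distrib-+ (λ y → Dn * lines y) (λ y → N * pp * ind (Most.bad fine y))) (cong₂ _+_ (sum-*ˡ Dn lines) (sum-*ˡ (N * pp) (ind ∘ Most.bad fine)))))) ⟩
        K * (Dn * sum lines + N * pp * count (Most.bad fine))  ≡⟨ r₂ K Dn (sum lines) (N * pp) (count (Most.bad fine)) ⟩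
        Dn * (K * sum lines) + N * pp * (K * count (Most.bad fine))  ≤⟨ +-mono-≤ (*-monoʳ-≤ Dn lines-total) (*-monoʳ-≤ (N * pp) (Most.small fine)) ⟩
        Dn * (pp * (K * distance f g + p * q)) + N * pp * (wFine ℓ * q)  ≡⟨ r₃ Dn pp K (distance f g) p q N (wFine ℓ) ⟩
        pp * (K * (Dn * distance f g) + (N * wFine ℓ + Dn * p) * q)  ∎)
        where
        open ≤-Reasoning
        pp N Dn : ℕ
        pp = p * p ^ ℓ
        N = deltaNum j
        Dn = deltaDen j
        r₁ : ∀ a K N q → a * (K * (N * q)) ≡ K * (q * (N * a))
        r₁ = solve-∀
        r₂ : ∀ K D s n c → K * (D * s + n * c) ≡ D * (K * s) + n * (K * c)
        r₂ = solve-∀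
        r₃ : ∀ D a K d p q N w → D * (a * (K * d + p * q)) + N * a * (w * q) ≡ a * (K * (D * d) + (N * w + D * p) * q)
        r₃ = solve-∀

      contradiction-bound : ∀ E → 0 < q → E * (deltaDen j * distance f g) + q ≤ E * (deltaNum j * q) → K ≤ E * wTotal ℓ
      contradiction-bound E 0<q close = *-cancelʳ-≤ K (E * wTotal ℓ) q {{>-nonZero 0<q}} (+-cancelˡ-≤ (K * (E * d)) _ _ (begin
        K * (E * d) + K * q  ≡⟨ *-distribˡ-+ K (E * d) q ⟨
        K * (E * d + q)  ≤⟨ *-monoʳ-≤ K close ⟩
        K * (E * (deltaNum j * q))  ≡⟨ r₁ K E (deltaNum j * q) ⟩
        E * (K * (deltaNum j * q))  ≤⟨ *-monoʳ-≤ E total-bound ⟩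
        E * (K * d + wTotal ℓ * q)  ≡⟨ r₂ E K d (wTotal ℓ) q ⟩
        K * (E * d) + E * wTotal ℓ * q  ∎))
        where
        open ≤-Reasoning
        d : ℕ
        d = deltaDen j * distance f g
        r₁ : ∀ K E x → K * (E * x) ≡ E * (K * x)
        r₁ = solve-∀
        r₂ : ∀ E K d w q → E * (K * d + w * q) ≡ K * (E * d) + E * w * q
        r₂ = solve-∀

  -- Random directions and rare exceptional sets

  take-++ : ∀ {A : Set} {L M} (c : Vec A L) (a : Vec A M) → take L (c ++ a) ≡ c
  take-++ []      a = refl
  take-++ (x ∷ c) a = cong (x ∷_) (take-++ c a)

  drop-++ : ∀ {A : Set} {L M} (c : Vec A L) (a : Vec A M) → drop L (c ++ a) ≡ a
  drop-++ []      a = refl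
  drop-++ (x ∷ c) a = drop-++ c a

  sumT-split : ∀ {q} L M (φ : Vec (Fin q) L → Vec (Fin q) M → ℕ) → sumT (L + M) (λ a → φ (take L a) (drop L a)) ≡ sumT M (λ a → sumT L (λ c → φ c a))
  sumT-split L M φ = trans (sumT-++ L M (λ a → φ (take L a) (drop L a)))
    (trans (sumT-cong L (λ c → sumT-cong M (λ a → cong₂ φ (take-++ c a) (drop-++ c a)))) (sumT-comm L M φ))

  sumT-drop : ∀ {q} L M (φ : Vec (Fin q) M → ℕ) → sumT (L + M) (λ a → φ (drop L a)) ≡ q ^ L * sumT M φ
  sumT-drop {q} L M φ = trans (sumT-split L M (λ _ → φ)) (trans (sumT-cong M (λ a → sumT-const L (φ a))) (sumT-*ˡ M (q ^ L) φ))

  sections : ∀ {q} K K₂ N (B : Vec (Fin q) N → Fin q → Bool) → 0 < q → K₂ * sumT N (λ a → count (B a)) ≤ q ^ N * q →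
    K₂ * sumT N (λ a → ind (does (q <? K * count (B a)))) ≤ K * q ^ N
  sections {q} K K₂ N B 0<q h = *-cancelˡ-≤ q {{>-nonZero 0<q}} (begin
    q * (K₂ * sumT N χ)  ≡⟨ r₁ q K₂ _ ⟩
    K₂ * (q * sumT N χ)  ≡⟨ cong (K₂ *_) (sumT-*ˡ N q χ) ⟨
    K₂ * sumT N (λ a → q * χ a)  ≤⟨ *-monoʳ-≤ K₂ (sumT-mono N (λ a → *-ind-≤ (q <? K * count (B a)) <⇒≤)) ⟩
    K₂ * sumT N (λ a → K * count (B a))  ≡⟨ cong (K₂ *_) (sumT-*ˡ N K (λ a → count (B a))) ⟩
    K₂ * (K * sumT N (λ a → count (B a)))  ≡⟨ r₁ K₂ K _ ⟩
    K * (K₂ * sumT N (λ a → count (B a)))  ≤⟨ *-monoʳ-≤ K h ⟩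
    K * (q ^ N * q)  ≡⟨ r₂ K (q ^ N) q ⟩
    q * (K * q ^ N)  ∎)
    where
    open ≤-Reasoning
    χ : Vec (Fin q) N → ℕ
    χ a = ind (does (q <? K * count (B a)))
    r₁ : ∀ a b c → a * (b * c) ≡ b * (a * c)
    r₁ = solve-∀
    r₂ : ∀ a b c → a * (b * c) ≡ c * (a * b)
    r₂ = solve-∀

  section-most : ∀ {q} K (B : Fin q → Bool) → does (q <? K * count B) ≡ false → Most K 1 (λ y → B y ≡ false)
  section-most {q} K B h = most B (≤-trans (≮⇒≥ (does-false (q <? K * count B) h)) (≤-reflexive (sym (*-identityˡ q)))) (λ y e → e)

  module Sampling {q : ℕ} (G : VectorGroup (Fin q)) (f g : Fin q → F) (ℓ : ℕ) where
    open Linear G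
    open Relative G f g ℓ

    atypical : ∀ {W L} → ℕ → (X → Fin W) → Vec X L → X → Bool
    atypical K V c y = does (any? (λ v → far (λ z → V (y ∙ z) == v) K c ≟ᵇ true))

    atypical-false : ∀ {W L} K (V : X → Fin W) (c : Vec X L) y → atypical K V c y ≡ false → Typical K V c y
    atypical-false K V c y h v with far (λ z → V (y ∙ z) == v) K c in e
    ... | false = refl
    ... | true  = contradiction (v , e) (does-false (any? (λ v → far (λ z → V (y ∙ z) == v) K c ≟ᵇ true)) h)

    atypical-≤ : ∀ {W L} K (V : X → Fin W) (c : Vec X L) y → ind (atypical K V c y) ≤ sum (λ v → ind (far (λ z → V (y ∙ z) == v) K c))
    atypical-≤ {W} K V c y with any? (λ v → far (λ z → V (y ∙ z) == v) K c ≟ᵇ true)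
    ... | no _ = z≤n
    atypical-≤ {suc W} K V c y | yes (v , e) = ≤-trans (≤-trans (≤-reflexive (cong ind (sym e))) (m≤m+n _ _)) (≤-reflexive (sym (sum-remove {i = v} (λ v → ind (far (λ z → V (y ∙ z) == v) K c)))))

    -- `chebyshev` gives failure probability K²/L for each of the W colours, and L is the length at
    -- which their sum drops below 1/K₂; the `suc` keeps L positive.
    atypical-rare : ∀ {W} K K₂ (V : X → Fin W) → 0 < q → 0 < K₂ → let L = K₂ * suc (W * (K * K)) in
      K₂ * sumT L (λ c → count (atypical K V c)) ≤ q ^ L * q
    atypical-rare {W} K K₂ V 0<q 0<K₂ = *-cancelˡ-≤ (suc (W * (K * K))) (begin
      suc WK * (K₂ * S)  ≡⟨ r₁ (suc WK) K₂ S ⟩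
      L * S  ≡⟨ cong (L *_) (sumT-sum L (λ c y → ind (atypical K V c y))) ⟩
      L * sum (λ y → sumT L (λ c → ind (atypical K V c y)))  ≡⟨ sum-*ˡ L (λ y → sumT L (λ c → ind (atypical K V c y))) ⟨
      sum (λ y → L * sumT L (λ c → ind (atypical K V c y)))  ≤⟨ sum-≤-const (suc WK * q ^ L) pointwise ⟩
      q * (suc WK * q ^ L)  ≡⟨ r₂ q (suc WK) (q ^ L) ⟩
      suc WK * (q ^ L * q)  ∎)
      where
      open ≤-Reasoning
      WK L S : ℕ
      WK = W * (K * K)
      L = K₂ * suc WK
      S = sumT L (λ c → count (atypical K V c))
      0<L : 0 < L
      0<L = *-mono-≤ 0<K₂ (s≤s {0} {WK} z≤n)
      r₁ : ∀ a b c → a * (b * c) ≡ b * a * c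
      r₁ = solve-∀
      r₂ : ∀ a b c → a * (b * c) ≡ b * (c * a)
      r₂ = solve-∀
      r₃ : ∀ a b c → a * (b * c) ≡ a * b * c
      r₃ = solve-∀
      pointwise : ∀ y → L * sumT L (λ c → ind (atypical K V c y)) ≤ suc WK * q ^ L
      pointwise y = begin
        L * sumT L (λ c → ind (atypical K V c y))  ≤⟨ *-monoʳ-≤ L (sumT-mono L (λ c → atypical-≤ K V c y)) ⟩
        L * sumT L (λ c → sum (λ v → ind (far (λ z → V (y ∙ z) == v) K c)))  ≡⟨ cong (L *_) (sumT-sum L (λ c v → ind (far (λ z → V (y ∙ z) == v) K c))) ⟩
        L * sum (λ v → sumT L (λ c → ind (far (λ z → V (y ∙ z) == v) K c)))  ≡⟨ sum-*ˡ L (λ v → sumT L (λ c → ind (far (λ z → V (y ∙ z) == v) K c))) ⟨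
        sum (λ v → L * sumT L (λ c → ind (far (λ z → V (y ∙ z) == v) K c)))  ≤⟨ sum-≤-const (K * K * q ^ L) (λ v → chebyshev (λ z → V (y ∙ z) == v) K L 0<q 0<L) ⟩
        W * (K * K * q ^ L)  ≡⟨ r₃ W (K * K) (q ^ L) ⟩
        WK * q ^ L  ≤⟨ *-monoˡ-≤ (q ^ L) (n≤1+n WK) ⟩
        suc WK * q ^ L  ∎

  -- `rare` measures tuples and points jointly, so `bad` may discard a whole tuple. The differences
  -- are compared at x and x′ alone; j-fold ones already control how (j-1)-fold ones change under
  -- translations by the span.
  record Determined {q} (G : VectorGroup (Fin q)) (f g : Fin q → F) (j N K : ℕ) : Set where
    open Linear G
    field
      bad  : Vec (Fin q) N → Fin q → Bool
      rare : K * sumT N (λ a → count (bad a)) ≤ q ^ N * q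
      det  : ∀ a {x x′} → bad a x ≡ false → bad a x′ ≡ false →
             (∀ {v} → Span a v → g (x ∙ v) ≡ g (x′ ∙ v)) →
             (∀ (b : Vec (Fin q) j) → Allᵛ (Span a) b → D b f x ≡ D b f x′) → f x ≡ f x′

  -- In integers: dist(f, g) ≤ δ(j) - 1/(E · `deltaDen j`).
  Close : ∀ {q} → (Fin q → F) → (Fin q → F) → ℕ → ℕ → Set
  Close {q} f g j E = E * (deltaDen j * distance f g) + q ≤ E * (deltaNum j * q)

  Determination : ℕ → Set
  Determination j = ∀ K E → ∃ λ N → ∀ {q} (G : VectorGroup (Fin q)) (f g : Fin q → F) → 0 < q → Close f g j E → Determined G f g j N K

  delta-mono : ∀ j → deltaNum (suc j) * deltaDen j ≤ deltaNum j * deltaDen (suc j)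
  delta-mono j = *-cancelˡ-≤ p (begin
    p * (deltaNum (suc j) * deltaDen j)  ≡⟨ r₁ p (deltaNum (suc j)) (deltaDen j) ⟩
    deltaNum (suc j) * (p * deltaDen j)  ≤⟨ subst (λ z → deltaNum z * (p * deltaDen j) ≤ deltaNum j * (p ∸ 1) * deltaDen z) (+-comm j 1) (delta-step j 1 (s≤s z≤n)) ⟩
    deltaNum j * (p ∸ 1) * deltaDen (suc j)  ≤⟨ *-monoˡ-≤ (deltaDen (suc j)) (*-monoʳ-≤ (deltaNum j) (m∸n≤m p 1)) ⟩
    deltaNum j * p * deltaDen (suc j)  ≡⟨ r₂ (deltaNum j) p (deltaDen (suc j)) ⟩
    p * (deltaNum j * deltaDen (suc j))  ∎)
    where
    open ≤-Reasoning
    r₁ : ∀ a b c → a * (b * c) ≡ b * (a * c)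
    r₁ = solve-∀
    r₂ : ∀ a b c → a * b * c ≡ b * (a * c)
    r₂ = solve-∀

  -- δ does not increase with j, so the induction hypothesis applies to the same f and g; the factor
  -- `deltaDen (suc j)` absorbs the change of denominator in the slack.
  close-pred : ∀ {q} (f g : Fin q → F) j E → Close f g (suc j) E → Close f g j (E * deltaDen (suc j))
  close-pred {q} f g j E c = begin
    E * D′ * (deltaDen j * d) + q  ≤⟨ +-monoʳ-≤ _ (≤-trans (≤-reflexive (sym (*-identityˡ q))) (*-monoˡ-≤ q (m^n>0 p (suc (j / p-1))))) ⟩
    E * D′ * (deltaDen j * d) + deltaDen j * q  ≡⟨ r₁ E D′ (deltaDen j) d q ⟩
    deltaDen j * (E * (D′ * d) + q)  ≤⟨ *-monoʳ-≤ (deltaDen j) c ⟩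
    deltaDen j * (E * (deltaNum (suc j) * q))  ≡⟨ r₂ (deltaDen j) E (deltaNum (suc j)) q ⟩
    E * q * (deltaNum (suc j) * deltaDen j)  ≤⟨ *-monoʳ-≤ (E * q) (delta-mono j) ⟩
    E * q * (deltaNum j * D′)  ≡⟨ r₃ E q (deltaNum j) D′ ⟩
    E * D′ * (deltaNum j * q)  ∎
    where
    open ≤-Reasoning
    D′ d : ℕ
    D′ = deltaDen (suc j)
    d = distance f g
    r₁ : ∀ E D e d q → E * D * (e * d) + e * q ≡ e * (E * (D * d) + q)
    r₁ = solve-∀
    r₂ : ∀ e E n q → e * (E * (n * q)) ≡ E * q * (n * e)
    r₂ = solve-∀
    r₃ : ∀ E q n D → E * q * (n * D) ≡ E * D * (n * q)
    r₃ = solve-∀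

  -- The induction step for determination

  module Scales (ℓ K₀ K₂ m : ℕ) where

    -- Above 4 times the number of views, for `collision`, and above K₀ times (2 · views + 1), so
    -- that the points left unmatched by `automorphism` have density at most 1/K₀.
    Kₜ : ℕ → ℕ
    Kₜ M = suc (4 * views M ℓ + K₀ * suc (2 * views M ℓ))

    block : ℕ → ℕ
    block M = K₂ * suc (views M ℓ * (Kₜ M * Kₜ M))

    -- At `suc ℓ` there are ℓ + 1 blocks around the m innermost directions: the outermost produces
    -- τ, and each of the others serves one application of `constant-next`.
    scale : ℕ → ℕ
    scale zero    = m
    scale (suc r) = block (scale r) + scale r

  module Step {q : ℕ} (G : VectorGroup (Fin q)) (f g : Fin q → F) (0<q : 0 < q) (ℓ K₀ K₂ : ℕ) (0<K₂ : 0 < K₂) {m : ℕ}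
    (ih : Determined G f g ℓ m K₂) where
    open Linear G
    open Relative G f g ℓ
    open Sampling G f g ℓ
    open Scales ℓ K₀ K₂ m
    private module IH = Determined ih

    bottom : ∀ r → Vec X (scale r) → Vec X m
    bottom zero    a = a
    bottom (suc r) a = bottom r (drop (block (scale r)) a)

    atypicalAt : ∀ r → Vec X (scale (suc r)) → X → Bool
    atypicalAt r a = atypical (Kₜ (scale r)) (view (drop (block (scale r)) a) 0ˢ) (take (block (scale r)) a)

    -- An event of the tuple alone. When it is excluded, each exceptional set needed around τ has
    -- weight 1 relative to K₀.
    fails : ∀ r → Vec X (scale r) → Bool
    fails zero    a = does (q <? K₀ * count (IH.bad a))
    fails (suc r) a = does (q <? K₀ * count (atypicalAt r a)) ∨ fails r (drop (block (scale r)) a)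

    -- The outermost block has to be typical only at the points compared, since `automorphism`
    -- starts from two points; the inner blocks must be typical around most points, which is left to
    -- `fails`.
    bad : Vec X (scale (suc ℓ)) → X → Bool
    bad a x = fails ℓ (drop (block (scale ℓ)) a) ∨ (IH.bad (bottom (suc ℓ) a) x ∨ atypicalAt ℓ a x)

    atypicalAt-rare : ∀ r → K₂ * sumT (scale (suc r)) (λ a → count (atypicalAt r a)) ≤ q ^ scale (suc r) * q
    atypicalAt-rare r = begin
      K₂ * sumT (L + M) (λ a → count (atypicalAt r a))  ≡⟨ cong (K₂ *_) (sumT-split L M (λ c a → count (atypical (Kₜ M) (view a 0ˢ) c))) ⟩
      K₂ * sumT M (λ a → sumT L (λ c → count (atypical (Kₜ M) (view a 0ˢ) c)))  ≡⟨ sumT-*ˡ M K₂ (λ a → sumT L (λ c → count (atypical (Kₜ M) (view a 0ˢ) c))) ⟨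
      sumT M (λ a → K₂ * sumT L (λ c → count (atypical (Kₜ M) (view a 0ˢ) c)))  ≤⟨ sumT-mono M (λ a → atypical-rare (Kₜ M) K₂ (view a 0ˢ) 0<q 0<K₂) ⟩
      sumT M (λ _ → q ^ L * q)  ≡⟨ sumT-const M (q ^ L * q) ⟩
      q ^ M * (q ^ L * q)  ≡⟨ r₁ (q ^ M) (q ^ L) q ⟩
      q ^ L * q ^ M * q  ≡⟨ cong (_* q) (^-distribˡ-+-* q L M) ⟨
      q ^ (L + M) * q  ∎
      where
      open ≤-Reasoning
      L M : ℕ
      M = scale r
      L = block M
      r₁ : ∀ a b c → a * (b * c) ≡ b * a * c
      r₁ = solve-∀

    fails-rare : ∀ r → K₂ * sumT (scale r) (λ a → ind (fails r a)) ≤ suc r * (K₀ * q ^ scale r)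
    fails-rare zero    = ≤-trans (sections K₀ K₂ m IH.bad 0<q IH.rare) (≤-reflexive (sym (*-identityˡ _)))
    fails-rare (suc r) = begin
      K₂ * sumT (L + M) (λ a → ind (fails (suc r) a))  ≤⟨ *-monoʳ-≤ K₂ (sumT-mono (L + M) (λ a → ind-∨ _ (fails r (drop L a)))) ⟩
      K₂ * sumT (L + M) (λ a → ind (does (q <? K₀ * count (atypicalAt r a))) + ind (fails r (drop L a)))  ≡⟨ cong (K₂ *_) (sumT-+ (L + M) (λ a → ind (does (q <? K₀ * count (atypicalAt r a)))) (λ a → ind (fails r (drop L a)))) ⟩
      K₂ * (sumT (L + M) (λ a → ind (does (q <? K₀ * count (atypicalAt r a)))) + sumT (L + M) (λ a → ind (fails r (drop L a))))  ≡⟨ *-distribˡ-+ K₂ (sumT (L + M) (λ a → ind (does (q <? K₀ * count (atypicalAt r a))))) _ ⟩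
      K₂ * sumT (L + M) (λ a → ind (does (q <? K₀ * count (atypicalAt r a)))) + K₂ * sumT (L + M) (λ a → ind (fails r (drop L a)))  ≤⟨ +-mono-≤ (sections K₀ K₂ (L + M) (atypicalAt r) 0<q (atypicalAt-rare r)) rest ⟩
      K₀ * q ^ (L + M) + suc r * (K₀ * q ^ (L + M))  ∎
      where
      open ≤-Reasoning
      L M : ℕ
      M = scale r
      L = block M
      r₁ : ∀ a b c → a * (b * c) ≡ b * (a * c)
      r₁ = solve-∀
      r₂ : ∀ a r k b → a * (r * (k * b)) ≡ r * (k * (a * b))
      r₂ = solve-∀
      rest : K₂ * sumT (L + M) (λ a → ind (fails r (drop L a))) ≤ suc r * (K₀ * q ^ (L + M))
      rest = begin
        K₂ * sumT (L + M) (λ a → ind (fails r (drop L a)))  ≡⟨ cong (K₂ *_) (sumT-drop L M (λ a → ind (fails r a))) ⟩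
        K₂ * (q ^ L * sumT M (λ a → ind (fails r a)))  ≡⟨ r₁ K₂ (q ^ L) _ ⟩
        q ^ L * (K₂ * sumT M (λ a → ind (fails r a)))  ≤⟨ *-monoʳ-≤ (q ^ L) (fails-rare r) ⟩
        q ^ L * (suc r * (K₀ * q ^ M))  ≡⟨ r₂ (q ^ L) (suc r) K₀ (q ^ M) ⟩
        suc r * (K₀ * (q ^ L * q ^ M))  ≡⟨ cong (λ z → suc r * (K₀ * z)) (^-distribˡ-+-* q L M) ⟨
        suc r * (K₀ * q ^ (L + M))  ∎

    bottom-rare : ∀ r → K₂ * sumT (scale r) (λ a → count (IH.bad (bottom r a))) ≤ q ^ scale r * q
    bottom-rare zero    = IH.rare
    bottom-rare (suc r) = begin
      K₂ * sumT (L + M) (λ a → count (IH.bad (bottom r (drop L a))))  ≡⟨ cong (K₂ *_) (sumT-drop L M (λ a → count (IH.bad (bottom r a)))) ⟩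
      K₂ * (q ^ L * sumT M (λ a → count (IH.bad (bottom r a))))  ≡⟨ r₁ K₂ (q ^ L) _ ⟩
      q ^ L * (K₂ * sumT M (λ a → count (IH.bad (bottom r a))))  ≤⟨ *-monoʳ-≤ (q ^ L) (bottom-rare r) ⟩
      q ^ L * (q ^ M * q)  ≡⟨ *-assoc (q ^ L) (q ^ M) q ⟨
      q ^ L * q ^ M * q  ≡⟨ cong (_* q) (^-distribˡ-+-* q L M) ⟨
      q ^ (L + M) * q  ∎
      where
      open ≤-Reasoning
      L M : ℕ
      M = scale r
      L = block M
      r₁ : ∀ a b c → a * (b * c) ≡ b * (a * c)
      r₁ = solve-∀

    bad-rare : K₂ * sumT (scale (suc ℓ)) (λ a → count (bad a)) ≤ (suc ℓ * K₀ + 2) * (q ^ scale (suc ℓ) * q)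
    bad-rare = begin
      K₂ * sumT N (λ a → count (bad a))  ≤⟨ *-monoʳ-≤ K₂ (sumT-mono N (λ a → pw a)) ⟩
      K₂ * sumT N (λ a → A a + (B a + C a))  ≡⟨ cong (K₂ *_) (trans (sumT-+ N A (λ a → B a + C a)) (cong (sumT N A +_) (sumT-+ N B C))) ⟩
      K₂ * (sumT N A + (sumT N B + sumT N C))  ≡⟨ r₁ K₂ (sumT N A) (sumT N B) (sumT N C) ⟩
      K₂ * sumT N A + (K₂ * sumT N B + K₂ * sumT N C)  ≤⟨ +-mono-≤ boundA (+-mono-≤ (bottom-rare (suc ℓ)) (atypicalAt-rare ℓ)) ⟩
      suc ℓ * (K₀ * q ^ N) * q + (q ^ N * q + q ^ N * q)  ≡⟨ r₂ (suc ℓ) K₀ (q ^ N) q ⟩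
      (suc ℓ * K₀ + 2) * (q ^ N * q)  ∎
      where
      open ≤-Reasoning
      L M N : ℕ
      M = scale ℓ
      L = block M
      N = scale (suc ℓ)
      A B C : Vec X N → ℕ
      A a = q * ind (fails ℓ (drop L a))
      B a = count (IH.bad (bottom (suc ℓ) a))
      C a = count (atypicalAt ℓ a)
      r₁ : ∀ k a b c → k * (a + (b + c)) ≡ k * a + (k * b + k * c)
      r₁ = solve-∀
      r₂ : ∀ l k Q q → l * (k * Q) * q + (Q * q + Q * q) ≡ (l * k + 2) * (Q * q)
      r₂ = solve-∀
      r₃ : ∀ k q a b → k * (q * (a * b)) ≡ q * (a * (k * b))
      r₃ = solve-∀
      r₄ : ∀ q a r k b → q * (a * (r * (k * b))) ≡ r * (k * (a * b)) * q
      r₄ = solve-∀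
      pw : ∀ a → count (bad a) ≤ A a + (B a + C a)
      pw a = begin
        count (bad a)  ≤⟨ sum-mono (λ x → ≤-trans (ind-∨ (fails ℓ (drop L a)) _) (+-monoʳ-≤ (ind (fails ℓ (drop L a))) (ind-∨ (IH.bad (bottom (suc ℓ) a) x) (atypicalAt ℓ a x)))) ⟩
        sum (λ x → ind (fails ℓ (drop L a)) + (ind (IH.bad (bottom (suc ℓ) a) x) + ind (atypicalAt ℓ a x)))  ≡⟨ ∑-distrib-+ (λ _ → ind (fails ℓ (drop L a))) (λ x → ind (IH.bad (bottom (suc ℓ) a) x) + ind (atypicalAt ℓ a x)) ⟩
        sum {q} (λ _ → ind (fails ℓ (drop L a))) + sum (λ x → ind (IH.bad (bottom (suc ℓ) a) x) + ind (atypicalAt ℓ a x))  ≡⟨ cong₂ _+_ (sum-const q (ind (fails ℓ (drop L a)))) (∑-distrib-+ (ind ∘ IH.bad (bottom (suc ℓ) a)) (ind ∘ atypicalAt ℓ a)) ⟩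
        A a + (B a + C a)  ∎
      boundA : K₂ * sumT N A ≤ suc ℓ * (K₀ * q ^ N) * q
      boundA = begin
        K₂ * sumT N A  ≡⟨ cong (K₂ *_) (trans (sumT-*ˡ N q (λ a → ind (fails ℓ (drop L a)))) (cong (q *_) (sumT-drop L M (λ a → ind (fails ℓ a))))) ⟩
        K₂ * (q * (q ^ L * sumT M (λ a → ind (fails ℓ a))))  ≡⟨ r₃ K₂ q (q ^ L) _ ⟩
        q * (q ^ L * (K₂ * sumT M (λ a → ind (fails ℓ a))))  ≤⟨ *-monoʳ-≤ q (*-monoʳ-≤ (q ^ L) (fails-rare ℓ)) ⟩
        q * (q ^ L * (suc ℓ * (K₀ * q ^ M)))  ≡⟨ r₄ q (q ^ L) (suc ℓ) K₀ (q ^ M) ⟩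
        suc ℓ * (K₀ * (q ^ L * q ^ M)) * q  ≡⟨ cong (λ z → suc ℓ * (K₀ * z) * q) (^-distribˡ-+-* q L M) ⟨
        suc ℓ * (K₀ * q ^ N) * q  ∎

    block>0 : ∀ M → 0 < block M
    block>0 M = *-mono-≤ 0<K₂ (s≤s {0} {views M ℓ * (Kₜ M * Kₜ M)} z≤n)

    span-drop : ∀ {L M} (a : Vec X (L + M)) {v} → Span (drop L a) v → Span a v
    span-drop {L} a h = subst (λ z → Span z _) (take++drop≡id L a) (span-++ (take L a) h)

    span-bottom : ∀ r (a : Vec X (scale r)) {v} → Span (bottom r a) v → Span a v
    span-bottom zero    a h = h
    span-bottom (suc r) a h = span-drop a (span-bottom r (drop (block (scale r)) a) h)

    fails-good : ∀ r (a : Vec X (scale r)) → fails r a ≡ false → Most K₀ 1 (λ y → IH.bad (bottom r a) y ≡ false)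
    fails-good zero    a h = section-most K₀ (IH.bad a) h
    fails-good (suc r) a h = fails-good r (drop (block (scale r)) a) (proj₂ (∨-false {does (q <? K₀ * count (atypicalAt r a))} h))

    module _ (E : ℕ) (E-bound : E * wTotal ℓ < K₀) (close : Close f g (suc ℓ) E)
      (aR : Vec X (scale ℓ)) (ok : fails ℓ aR ≡ false)
      (κ : Shift) (τ : Permutation′ q) (most-τ : Most K₀ 1 (λ y → Rel aR κ y (τ ⟨$⟩ʳ y))) where

      a₀ : Vec X m
      a₀ = bottom ℓ aR

      determined : ∀ {y y′} → IH.bad a₀ y ≡ false → IH.bad a₀ y′ ≡ false → Rel a₀ 0ˢ y y′ → f y ≡ f y′
      determined {y} {y′} h h′ r = IH.det a₀ h h′ (same r)
        (λ b hb → sym (trans (cong (D b f) (sym (∙-idʳ y′))) (trans (shifted r hb span-ε) (trans (⊕-0ʳ _) (cong (D b f) (∙-idʳ y))))))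

      open Orbit G f g ℓ K₀ a₀ aR (span-bottom ℓ aR) (λ y → IH.bad a₀ y ≡ false) determined κ τ (fails-good ℓ aR ok) most-τ
      open Contradiction G f g ℓ K₀ a₀ aR (span-bottom ℓ aR) (λ y → IH.bad a₀ y ≡ false) determined κ τ (fails-good ℓ aR ok) most-τ

      -- Each block removed gives one `constant-next`, and i + r ≡ ℓ ties the blocks left to the
      -- order reached. At the wanted order the statement, proved for a larger span, is restricted
      -- to a₀.
      chain : ∀ r i (a : Vec X (scale r)) → i + r ≡ ℓ → bottom r a ≡ a₀ → fails r a ≡ false → (∀ {v} → Span a v → Span aR v) →
        Constant (ℓ ∸ i) (suc i) a (wConst ℓ i) → ∀ i′ → i ≤ i′ → i′ ≤ ℓ → Constant (ℓ ∸ i′) (suc i′) a₀ (wConst ℓ i′)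
      chain zero i a e refl h up C i′ le le′ = subst (λ z → Constant (ℓ ∸ z) (suc z) a (wConst ℓ z)) (≤-antisym le (≤-trans le′ (≤-reflexive (trans (sym e) (+-identityʳ i))))) C
      chain (suc r) i a e eb h up C i′ le le′ with m≤n⇒m<n∨m≡n le
      ... | inj₂ refl = λ b hb → C b (VecAll.map (λ s → span-bottom (suc r) a (subst (λ z → Span z _) (sym eb) s)) hb)
      ... | inj₁ lt = chain r (suc i) a′ (trans (sym (+-suc i r)) e) eb (proj₂ (∨-false {does (q <? K₀ * count (atypicalAt r a))} h)) (up ∘ span-drop a) next i′ lt le′
        where
        c : Vec X (block (scale r))
        c = take (block (scale r)) a
        a′ : Vec X (scale r)
        a′ = drop (block (scale r)) a
        i<ℓ : i < ℓ
        i<ℓ = ≤-trans lt le′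
        C′ : Constant (suc (ℓ ∸ suc i)) (suc i) (c ++ a′) (wConst ℓ i)
        C′ = subst₂ (λ n z → Constant n (suc i) z (wConst ℓ i)) (+-∸-assoc 1 i<ℓ) (sym (take++drop≡id (block (scale r)) a)) C
        low : ∀ {v} → Span a₀ v → Span a′ v
        low s = span-bottom r a′ (subst (λ z → Span z _) (sym eb) s)
        up′ : ∀ {v} → Span (c ++ a′) v → Span aR v
        up′ s = up (subst (λ z → Span z _) (take++drop≡id (block (scale r)) a) s)
        typ : Most K₀ 1 (Typical (Kₜ (scale r)) (view a′ 0ˢ) c)
        typ = most-map (λ y → atypical-false (Kₜ (scale r)) (view a′ 0ˢ) c y) (section-most K₀ (atypicalAt r a) (proj₁ (∨-false h)))
        next : Constant (ℓ ∸ suc i) (suc (suc i)) a′ (wConst ℓ (suc i))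
        next = constant-next {i = suc i} {w = wConst ℓ i} (Kₜ (scale r)) c a′ low up′ 0<q (block>0 (scale r)) (s≤s (m≤m+n _ _)) typ C′

      κ-vanishes : ∀ b → Allᵛ (Span a₀) b → κ b ≡ 0F
      κ-vanishes b hb with κ b ≟ 0F
      ... | yes e = e
      ... | no ne = contradiction (contradiction-bound b hb ne (λ i le → chain ℓ 0 aR refl refl ok id constant-first i z≤n le) E 0<q close) (<⇒≱ E-bound)

    step-det : ∀ E → E * wTotal ℓ < K₀ → Close f g (suc ℓ) E → ∀ a {x x′} → bad a x ≡ false → bad a x′ ≡ false →
      (∀ {v} → Span a v → g (x ∙ v) ≡ g (x′ ∙ v)) → (∀ (b : Vec X (suc ℓ)) → Allᵛ (Span a) b → D b f x ≡ D b f x′) → f x ≡ f x′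
    step-det E E-bound close a {x} {x′} h h′ sg sd = IH.det base (proj₁ (split h)) (proj₁ (split h′)) (sg ∘ span-bottom (suc ℓ) a)
        (λ b hb → sym (⊝-≡0 (κ-vanishes E E-bound close aR (proj₁ (∨-false h)) κ τ most-τ b hb)))
      where
      L : ℕ
      L = block (scale ℓ)
      aR : Vec X (scale ℓ)
      aR = drop L a
      base : Vec X m
      base = bottom ℓ aR
      c : Vec X L
      c = take L a
      Kt v : ℕ
      Kt = Kₜ (scale ℓ)
      v = views (scale ℓ) ℓ
      split : ∀ {y} → bad a y ≡ false → IH.bad base y ≡ false × atypicalAt ℓ a y ≡ false
      split {y} e = ∨-false (proj₂ (∨-false {fails ℓ aR} e))
      κ : Shift
      κ b = D b f x′ ⊝ D b f x
      r : Rel a κ x x′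
      -- Equal (ℓ+1)-fold differences in the directions s, b mean that the gap between the ℓ-fold
      -- differences around x and x′ is the same after translation by s; this gap is κ b.
      r = rel sg (λ {b} {s} hb hs → ⊝-transpose (sd (s ∷ b) (hs ∷ hb)))
      typical : ∀ {y} → bad a y ≡ false → Typical Kt (view aR 0ˢ) c y
      typical {y} e = atypical-false Kt (view aR 0ˢ) c y (proj₂ (split e))
      auto : Σ (Permutation′ q) λ τ → Kt * count (λ y → not (view aR 0ˢ y == view aR κ (τ ⟨$⟩ʳ y))) ≤ v * (2 * q)
      auto = automorphism Kt aR c κ (block>0 (scale ℓ)) (typical h) (typical h′) (subst (λ z → Rel z κ x x′) (sym (take++drop≡id L a)) r)
      τ : Permutation′ q
      τ = proj₁ auto
      moved : X → Bool
      moved y = not (view aR 0ˢ y == view aR κ (τ ⟨$⟩ʳ y))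
      not-false : ∀ {b} → not b ≡ false → b ≡ true
      not-false {true} _ = refl
      most-τ : Most K₀ 1 (λ y → Rel aR κ y (τ ⟨$⟩ʳ y))
      most-τ = most moved small (λ y e → view⇒rel aR (==-true (not-false e)))
        where
        open ≤-Reasoning
        r₁ : ∀ v q → v * (2 * q) ≡ 2 * v * q
        r₁ = solve-∀
        small : K₀ * count moved ≤ 1 * q
        small = *-cancelˡ-≤ (suc (2 * v)) (begin
          suc (2 * v) * (K₀ * count moved)  ≡⟨ *-assoc (suc (2 * v)) K₀ (count moved) ⟨
          suc (2 * v) * K₀ * count moved  ≡⟨ cong (_* count moved) (*-comm (suc (2 * v)) K₀) ⟩
          K₀ * suc (2 * v) * count moved  ≤⟨ *-monoˡ-≤ (count moved) (≤-trans (m≤n+m _ (4 * v)) (n≤1+n _)) ⟩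
          Kt * count moved  ≤⟨ proj₂ auto ⟩
          v * (2 * q)  ≡⟨ r₁ v q ⟩
          2 * v * q  ≤⟨ *-monoˡ-≤ q (n≤1+n (2 * v)) ⟩
          suc (2 * v) * q  ≡⟨ cong (suc (2 * v) *_) (*-identityˡ q) ⟨
          suc (2 * v) * (1 * q)  ∎)

  determination : ∀ j → Determination j
  -- A 0-fold difference is the value itself, so the empty tuple determines f.
  determination zero K E = 0 , λ {q} G f g 0<q close → record
    { bad  = λ _ _ → false
    ; rare = ≤-trans (≤-reflexive (trans (cong (K *_) (sum-zero {q} (λ _ → refl))) (*-zeroʳ K))) z≤n
    ; det  = λ a _ _ _ sd → sd [] [] }
  determination (suc ℓ) K E = Scales.scale ℓ K₀ K₂ m (suc ℓ) , λ G f g 0<q close →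
      let ih = proj₂ IH G f g 0<q (close-pred f g ℓ E close)
          open Step G f g 0<q ℓ K₀ K₂ 0<K₂ ih
      in record
      { bad  = bad
      ; rare = cancel (≤-trans (≤-reflexive (sym (*-assoc B (suc K) _))) bad-rare)
      ; det  = step-det E (n<1+n (E * wTotal ℓ)) close }
    where
    K₀ B K₂ : ℕ
    -- One more than `contradiction-bound` allows when κ b is nonzero.
    K₀ = suc (E * wTotal ℓ)
    -- By `bad-rare`: ℓ + 1 ways for the tuple to fail, each of weight K₀, and two exceptional sets
    -- of points.
    B = suc ℓ * K₀ + 2
    K₂ = B * suc K
    B>0 : 0 < B
    B>0 = ≤-trans (s≤s z≤n) (m≤n+m 2 (suc ℓ * K₀))
    0<K₂ : 0 < K₂
    0<K₂ = *-mono-≤ B>0 (s≤s {0} {K} z≤n)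
    IH : ∃ λ N → _
    IH = determination ℓ K₂ (E * deltaDen (suc ℓ))
    m : ℕ
    m = proj₁ IH
    cancel : ∀ {s t} → B * (suc K * s) ≤ B * t → K * s ≤ t
    cancel {s} h = ≤-trans (m≤n+m (K * s) s) (*-cancelˡ-≤ B {{>-nonZero B>0}} h)

  -- Coordinates on Fⁿ and the number of functions of bounded degree

  toFin : ∀ n → Vec F n → Fin (p ^ n)
  toFin zero    []      = zero
  toFin (suc n) (x ∷ v) = combine x (toFin n v)

  fromFin : ∀ n → Fin (p ^ n) → Vec F n
  fromFin zero    i = []
  fromFin (suc n) i = proj₁ (remQuot {p} (p ^ n) i) ∷ fromFin n (proj₂ (remQuot {p} (p ^ n) i))

  from-to : ∀ n v → fromFin n (toFin n v) ≡ v
  from-to zero    []      = refl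
  from-to (suc n) (x ∷ v) = cong₂ _∷_ (cong proj₁ (remQuot-combine x (toFin n v))) (trans (cong (fromFin n ∘ proj₂) (remQuot-combine x (toFin n v))) (from-to n v))

  to-from : ∀ n i → toFin n (fromFin n i) ≡ i
  to-from zero    zero = refl
  to-from (suc n) i    = trans (cong (combine (proj₁ (remQuot {p} (p ^ n) i))) (to-from n (proj₂ (remQuot {p} (p ^ n) i)))) (combine-remQuot {p} (p ^ n) i)

  sum-↑ : ∀ a b (φ : Fin (a + b) → ℕ) → sum φ ≡ sum (λ i → φ (i ↑ˡ b)) + sum (λ i → φ (a ↑ʳ i))
  sum-↑ zero    b φ = refl
  sum-↑ (suc a) b φ = trans (cong (φ zero +_) (sum-↑ a b (φ ∘ suc))) (sym (+-assoc (φ zero) _ _))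

  sum-combine : ∀ m n (φ : Fin (m * n) → ℕ) → sum φ ≡ sum (λ (i : Fin m) → sum (λ (j : Fin n) → φ (combine i j)))
  sum-combine zero    n φ = refl
  sum-combine (suc m) n φ = trans (sum-↑ n (m * n) φ) (cong (sum (λ j → φ (j ↑ˡ (m * n))) +_) (sum-combine m n (λ i → φ (n ↑ʳ i))))

  sum-fromFin : ∀ n (φ : Vec F n → ℕ) → sum (λ i → φ (fromFin n i)) ≡ sumT n φ
  sum-fromFin zero    φ = +-identityʳ (φ [])
  sum-fromFin (suc n) φ = trans (sum-combine p (p ^ n) (λ i → φ (fromFin (suc n) i)))
    (sum-cong-≗ {p} (λ x → trans (sum-cong-≗ {p ^ n} (λ i → cong (λ (y , j) → φ (y ∷ fromFin n j)) (remQuot-combine {p} x i))) (sum-fromFin n (λ v → φ (x ∷ v)))))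

  finGroup : ∀ n → VectorGroup (Fin (p ^ n))
  finGroup n = record
    { _∙_ = λ i j → to (from i ∙ from j) ; ε = to ε ; inv = λ i → to (inv (from i))
    ; ∙-assoc = λ x y z → cong to (trans (cong (_∙ from z) (from-to n _)) (trans (∙-assoc (from x) (from y) (from z)) (cong (from x ∙_) (sym (from-to n _)))))
    ; ∙-comm = λ x y → cong to (∙-comm (from x) (from y))
    ; ∙-idʳ = λ x → trans (cong to (trans (cong (from x ∙_) (from-to n ε)) (∙-idʳ (from x)))) (to-from n x)
    ; ∙-invʳ = λ x → cong to (trans (cong (from x ∙_) (from-to n _)) (∙-invʳ (from x)))
    ; torsion = λ x → trans (mul-to p x) (cong to (torsion (from x))) }
    where
    open VectorGroup (vecGroup n)
    to : Vec F n → Fin (p ^ n)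
    to = toFin n
    from : Fin (p ^ n) → Vec F n
    from = fromFin n
    mul-to : ∀ l x → mul (λ i j → to (from i ∙ from j)) (to ε) l x ≡ to (mul _∙_ ε l (from x))
    mul-to zero    x = refl
    mul-to (suc l) x = cong (λ z → to (from x ∙ z)) (trans (cong from (mul-to l x)) (from-to n _))

  D-fromFin : ∀ n {k} (b : Vec (Fin (p ^ n)) k) (f : Vec F n → F) y →
    Linear.D (finGroup n) b (f ∘ fromFin n) y ≡ Linear.D (vecGroup n) (map (fromFin n) b) f (fromFin n y)
  D-fromFin n []      f y = refl
  D-fromFin n (v ∷ b) f y = cong₂ _⊝_ (trans (D-fromFin n b f _) (cong (Linear.D (vecGroup n) (map (fromFin n) b) f) (from-to n _))) (D-fromFin n b f y)

  -- Equal to p^(1 + n + ... + n^(m-1)): a function of degree below m is coded by its value at the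
  -- origin and its n partial differences, each of degree one less. This overcounts, but the
  -- exponent has the right order in n.
  polyCount : ℕ → ℕ → ℕ
  polyCount n zero    = 1
  polyCount n (suc m) = p * polyCount n m ^ n

  basis : ∀ n → Vec (Vec F n) n
  basis zero    = []
  basis (suc n) = (1F ∷ replicate n 0F) ∷ map (0F ∷_) (basis n)

  lincomb-basis : ∀ n (s : Vec F n) → Linear.lincomb (vecGroup n) (basis n) s ≡ s
  lincomb-basis zero    []      = refl
  lincomb-basis (suc n) (x ∷ s) = trans (cong₂ (zipWith _⊕_) (trans (mul-unit (toℕ x)) (cong (_∷ replicate n 0F) ([]-toℕ x))) (trans (lincomb-0∷ (basis n) s) (cong (0F ∷_) (lincomb-basis n s))))
      (cong₂ _∷_ (⊕-0ʳ x) (V.∙-idˡ s))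
    where
    module V = Linear (vecGroup n)
    module V⁺ = Linear (vecGroup (suc n))
    mul-unit : ∀ l → l V⁺.· (1F ∷ replicate n 0F) ≡ [ l ] ∷ replicate n 0F
    mul-unit zero    = refl
    mul-unit (suc l) = trans (cong (zipWith _⊕_ (1F ∷ replicate n 0F)) (mul-unit l)) (cong₂ _∷_ (sym ([]-+ 1 l)) (V.∙-idʳ (replicate n 0F)))
    mul-0∷ : ∀ l v → l V⁺.· (0F ∷ v) ≡ 0F ∷ l V.· v
    mul-0∷ zero    v = refl
    mul-0∷ (suc l) v = trans (cong (zipWith _⊕_ (0F ∷ v)) (mul-0∷ l v)) (cong (_∷ (v V.∙ l V.· v)) (⊕-0ʳ 0F))
    lincomb-0∷ : ∀ {t} (b : Vec (Vec F n) t) s → V⁺.lincomb (map (0F ∷_) b) s ≡ 0F ∷ V.lincomb b s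
    lincomb-0∷ []      []      = refl
    lincomb-0∷ (v ∷ b) (y ∷ s) = trans (cong₂ (zipWith _⊕_) (mul-0∷ (toℕ y) v) (lincomb-0∷ b s)) (cong (_∷ (toℕ y V.· v V.∙ V.lincomb b s)) (⊕-0ʳ 0F))

  module _ (n : ℕ) where
    open Linear (vecGroup n)

    degLt-⊝ : ∀ m {f g} → DegLt m f → DegLt m g → DegLt m (λ x → f x ⊝ g x)
    degLt-⊝ m {f} {g} hf hg b y = trans (D-⊝ b f g y) (trans (cong₂ _⊝_ (hf b y) (hg b y)) (⊝-self 0F))

    degLt-D : ∀ m {f} v → DegLt (suc m) f → DegLt m (λ x → f (x ∙ v) ⊝ f x)
    degLt-D m {f} v h b y = trans (D-inner b f v y) (h (v ∷ b) y)

    degLt-Ds : ∀ {m k f} (b : Vec (Vec F n) k) → DegLt (k + m) f → DegLt m (D b f)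
    degLt-Ds {m} {f = f} []      h = h
    degLt-Ds {m} {suc k} {f} (v ∷ b) h c y = trans (D-cong c (λ y → sym (D-inner b f v y)) y) (degLt-Ds b (degLt-D (k + m) v h) c y)

    invariant-lincomb : ∀ {t} (h : Vec F n → F) (b : Vec (Vec F n) t) → (∀ i y → h (y ∙ lookup b i) ≡ h y) → ∀ s y → h (y ∙ lincomb b s) ≡ h y
    invariant-lincomb h []      per []      y = cong h (∙-idʳ y)
    invariant-lincomb h (v ∷ b) per (x ∷ s) y = trans (cong h (sym (∙-assoc y (toℕ x · v) (lincomb b s)))) (trans (invariant-lincomb h b (per ∘ suc) s _) (multiple (toℕ x) y))
      where
      multiple : ∀ l y → h (y ∙ l · v) ≡ h y
      multiple zero    y = cong h (∙-idʳ y)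
      multiple (suc l) y = trans (cong h (sym (∙-assoc y v (l · v)))) (trans (multiple l (y ∙ v)) (per zero y))

    encode : ∀ m → (Vec F n → F) → Fin (polyCount n m)
    encode zero    f = zero
    encode (suc m) f = combine (f ε) (funToFin (λ i → encode m (λ x → f (x ∙ lookup (basis n) i) ⊝ f x)))

    -- By induction f and g have equal partial differences, so f - g is invariant under the basis
    -- vectors and hence constant; it vanishes at the origin.
    encode-injective : ∀ m {f g} → DegLt m f → DegLt m g → encode m f ≡ encode m g → ∀ x → f x ≡ g x
    encode-injective zero    hf hg e x = trans (hf [] x) (sym (hg [] x))
    encode-injective (suc m) {f} {g} hf hg e x = ⊝-≡0 (trans (cong h (sym (trans (∙-idˡ _) (lincomb-basis n x)))) (trans (invariant-lincomb h (basis n) periodic x ε) (trans (cong (_⊝ g ε) (proj₁ split)) (⊝-self (g ε)))))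
      where
      Δ : (Vec F n → F) → Fin n → Vec F n → F
      Δ φ i x = φ (x ∙ lookup (basis n) i) ⊝ φ x
      split = combine-injective (f ε) (funToFin (λ i → encode m (Δ f i))) (g ε) (funToFin (λ i → encode m (Δ g i))) e
      h : Vec F n → F
      h y = f y ⊝ g y
      same-Δ : ∀ i y → Δ f i y ≡ Δ g i y
      same-Δ i = encode-injective m (degLt-D m (lookup (basis n) i) hf) (degLt-D m (lookup (basis n) i) hg) (Codable.code-inj (codable-Fin n) (proj₂ split) i)
      periodic : ∀ i y → h (y ∙ lookup (basis n) i) ≡ h y
      periodic i y = ⊝-≡0 (trans (⊝-interchange (f (y ∙ lookup (basis n) i)) _ (f y) _) (trans (cong (_⊝ Δ g i y) (same-Δ i y)) (⊝-self _)))

  ^-distrib-* : ∀ a b n → (a * b) ^ n ≡ a ^ n * b ^ n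
  ^-distrib-* a b zero    = refl
  ^-distrib-* a b (suc n) = trans (cong (a * b *_) (^-distrib-* a b n)) (r a b (a ^ n) (b ^ n))
    where
    r : ∀ a b c d → a * b * (c * d) ≡ a * c * (b * d)
    r = solve-∀

  m≤m^n : ∀ m {n} → 1 ≤ m → 1 ≤ n → m ≤ m ^ n
  m≤m^n m {suc n} 1≤m _ = ≤-trans (≤-reflexive (sym (*-identityʳ m))) (*-monoʳ-≤ m (m^n>0 m {{>-nonZero 1≤m}} n))

  n^m>0 : ∀ {n} m → 1 ≤ n → 1 ≤ n ^ m
  n^m>0 {n} m 1≤n = m^n>0 n {{>-nonZero 1≤n}} m

  polyCount-≤ : ∀ n m → 1 ≤ n → polyCount n (suc m) ≤ (p ^ suc m) ^ (n ^ m)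
  polyCount-≤ n zero    1≤n = ≤-reflexive (trans (cong (p *_) (^-zeroˡ n)) (sym (trans (*-identityʳ (p * 1)) refl)))
  polyCount-≤ n (suc m) 1≤n = begin
    p * polyCount n (suc m) ^ n  ≤⟨ *-mono-≤ (m≤m^n p {n ^ suc m} (s≤s z≤n) (n^m>0 (suc m) 1≤n)) (^-monoˡ-≤ n (polyCount-≤ n m 1≤n)) ⟩
    p ^ (n ^ suc m) * ((p ^ suc m) ^ (n ^ m)) ^ n  ≡⟨ cong (p ^ (n ^ suc m) *_) (trans (^-*-assoc (p ^ suc m) (n ^ m) n) (cong ((p ^ suc m) ^_) (*-comm (n ^ m) n))) ⟩
    p ^ (n ^ suc m) * (p ^ suc m) ^ (n ^ suc m)  ≡⟨ ^-distrib-* p (p ^ suc m) (n ^ suc m) ⟨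
    (p ^ suc (suc m)) ^ (n ^ suc m)  ∎
    where open ≤-Reasoning

  -- Keys of the listed functions and the length of the list

  allPairs-lookup : ∀ {A : Set} {R : A → A → Set} {xs : List A} → AllPairs R xs → ∀ {i j} → toℕ i < toℕ j → R (List.lookup xs i) (List.lookup xs j)
  allPairs-lookup (h ∷ hs) {zero}  {suc j} lt       = All.lookup h (∈-lookup j)
  allPairs-lookup (h ∷ hs) {suc i} {suc j} (s≤s lt) = allPairs-lookup hs lt

  count-unique : ∀ {n} (χ : Fin n → Bool) → (∀ {i j} → χ i ≡ true → χ j ≡ true → i ≡ j) → count χ ≤ 1
  count-unique {zero}  χ h = z≤n
  count-unique {suc n} χ h with χ zero in e
  ... | false = count-unique (χ ∘ suc) (λ a b → suc-injective (h a b))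
  ... | true  = s≤s (≤-reflexive (count-zero none))
    where
    none : ∀ i → χ (suc i) ≡ false
    none i with χ (suc i) in e′
    ... | false = refl
    ... | true with () ← h e e′

  count-keys : ∀ {n B} (χ : Fin n → Bool) (key : Fin n → Fin B) → (∀ {i j} → χ i ≡ true → χ j ≡ true → key i ≡ key j → i ≡ j) → count χ ≤ B
  count-keys {n} {B} χ key h = begin
    count χ  ≡⟨ sum-cong-≗ pw ⟨
    sum (λ i → sum (λ v → ind (χ i ∧ (key i == v))))  ≡⟨ ∑-comm (λ i v → ind (χ i ∧ (key i == v))) ⟩
    sum (λ v → count (λ i → χ i ∧ (key i == v)))  ≤⟨ sum-≤-const 1 (λ v → count-unique (λ i → χ i ∧ (key i == v)) (uniq v)) ⟩
    B * 1  ≡⟨ *-identityʳ B ⟩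
    B  ∎
    where
    open ≤-Reasoning
    pw : ∀ i → sum (λ v → ind (χ i ∧ (key i == v))) ≡ ind (χ i)
    pw i with χ i
    ... | true  = sum-point (key i)
    ... | false = sum-zero {B} (λ _ → refl)
    ∧-true : ∀ {a b} → a ∧ b ≡ true → a ≡ true × b ≡ true
    ∧-true {true} {true} _ = refl , refl
    uniq : ∀ v {i j} → χ i ∧ (key i == v) ≡ true → χ j ∧ (key j == v) ≡ true → i ≡ j
    uniq v {i} {j} a b = let (a₁ , a₂) = ∧-true {χ i} a ; (b₁ , b₂) = ∧-true {χ j} b in h a₁ b₁ (trans (==-true a₂) (sym (==-true b₂)))

  average : ∀ {q} N B (φ : Vec (Fin q) N → ℕ) → 0 < q → 2 * sumT N φ ≤ B * q ^ N → ∃ λ a → 2 * φ a ≤ B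
  average {q} N B φ 0<q h with findT N (λ a → does (2 * φ a ≤? B))
  ... | inj₁ (a , e) = a , does-true (2 * φ a ≤? B) e
  ... | inj₂ none = contradiction h (<⇒≱ (begin-strict
    B * q ^ N  <⟨ *-monoˡ-< (q ^ N) {{m^n≢0 q N {{>-nonZero 0<q}}}} (n<1+n B) ⟩
    suc B * q ^ N  ≡⟨ *-comm (suc B) (q ^ N) ⟩
    q ^ N * suc B  ≡⟨ sumT-const N (suc B) ⟨
    sumT N (λ _ → suc B)  ≤⟨ sumT-mono N (λ a → ≰⇒> (does-false (2 * φ a ≤? B) (none a))) ⟩
    sumT N (λ a → 2 * φ a)  ≡⟨ sumT-*ˡ N 2 φ ⟩
    2 * sumT N φ  ∎))
    where open ≤-Reasoning

  -- The exponent depends only on the index set, which stays bounded, while the alphabet W will be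
  -- `polyCount n m` and grows with n.
  Power : ∀ {I} → Codable I → Set
  Power A = ∃ λ c → ∀ W → Codable.size A W ≡ W ^ c

  power-Vec : ∀ {I} (A : Codable I) → Power A → ∀ n → Power (codable-Vec A n)
  power-Vec A P       zero    = 1 , λ W → sym (*-identityʳ W)
  power-Vec A (c , e) (suc n) = let (c′ , e′) = power-Vec A (c , e) n in c′ * c , λ W → trans (e _) (trans (cong (_^ c) (e′ W)) (^-*-assoc W c′ c))

  abstract
    codable-Dirs : ∀ N e → Codable (Vec (Vec F N) e)
    codable-Dirs N e = codable-Vec (codable-Vec (codable-Fin p) N) e

    power-Dirs : ∀ N e → Power (codable-Dirs N e)
    power-Dirs N e = power-Vec (codable-Vec (codable-Fin p) N) (power-Vec (codable-Fin p) (p , λ W → refl) N) e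

    codable-Local : ∀ N e → Codable (Vec F N ⊎ Vec (Vec F N) e)
    codable-Local N e = codable-⊎ (codable-Vec (codable-Fin p) N) (codable-Dirs N e)

  locals : ℕ → ℕ → ℕ
  locals N e = Codable.size (codable-Local N e) p

  CloseV : ∀ {n} → (Vec F n → F) → (Vec F n → F) → ℕ → ℕ → Set
  CloseV {n} f g e E = E * (deltaDen e * weight n (λ x → f x ⊝ g x)) + p ^ n ≤ E * (deltaNum e * p ^ n)

  module Keys (n e m N : ℕ) (g : Vec F n → F) (a : Vec (Fin (p ^ n)) N) where
    q : ℕ
    q = p ^ n
    open Linear (finGroup n)
    private module V = Linear (vecGroup n)

    dir : Vec F N → Fin q
    dir = lincomb a

    dirs : Vec (Vec F N) e → Vec (Vec F n) e
    dirs σ = map (fromFin n) (map dir σ)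

    derivatives : (Vec F n → F) → Fin (Codable.size (codable-Dirs N e) (polyCount n m))
    derivatives f = Codable.code (codable-Dirs N e) (λ σ → encode n m (V.D (dirs σ) f))

    local-table : (Vec F n → F) → Fin q → Vec F N ⊎ Vec (Vec F N) e → F
    local-table f x (inj₁ s) = g (fromFin n (x ∙ dir s))
    local-table f x (inj₂ σ) = D (map dir σ) (f ∘ fromFin n) x

    local : (Vec F n → F) → Fin q → Fin (locals N e)
    local f x = Codable.code (codable-Local N e) (local-table f x)

    module _ (f : Vec F n → F) (K : ℕ) (d : Determined (finGroup n) (f ∘ fromFin n) (g ∘ fromFin n) e N K) where
      open Determined d

      Found : Fin (locals N e) → Set
      Found w = ∃ λ x → bad a x ≡ false × local f x ≡ w

      found? : ∀ w → Dec (Found w)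
      found? w = any? (λ x → (bad a x ≟ᵇ false) ×-dec (local f x ≟ w))

      value : ∀ {w} → Dec (Found w) → F
      value (yes (x , _)) = f (fromFin n x)
      -- A colour that no point outside the bad set has; any value does, as `value-correct` starts
      -- from such a point.
      value (no _)        = 0F

      lookup-value : Fin (locals N e) → F
      lookup-value w = value (found? w)

      value-correct : ∀ x → bad a x ≡ false → (d : Dec (Found (local f x))) → value d ≡ f (fromFin n x)
      value-correct x h (no none) = contradiction (x , h , refl) none
      value-correct x h (yes (x′ , h′ , e′)) = det a h′ h sg sd
        where
        pw : ∀ i → local-table f x′ i ≡ local-table f x i
        pw = Codable.code-inj (codable-Local N e) e′
        sg : ∀ {v} → Span a v → g (fromFin n (x′ ∙ v)) ≡ g (fromFin n (x ∙ v))
        sg (coeffs s refl) = pw (inj₁ s)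
        sd : ∀ (b : Vec (Fin q) e) → Allᵛ (Span a) b → D b (f ∘ fromFin n) x′ ≡ D b (f ∘ fromFin n) x
        sd b hb = let (σ , eq) = All-span hb in subst (λ c → D c (f ∘ fromFin n) x′ ≡ D c (f ∘ fromFin n) x) eq (pw (inj₂ σ))

      lookup-correct : ∀ x → bad a x ≡ false → lookup-value (local f x) ≡ f (fromFin n x)
      lookup-correct x h = value-correct x h (found? (local f x))

    -- The colour of x involves f only through e-fold differences along the span. These have degree
    -- below m, so `derivatives` records them completely, and equal codes make the two lookup tables
    -- refer to the same colours.
    same-local : ∀ f f′ → V.DegLt (e + m) f → V.DegLt (e + m) f′ → derivatives f ≡ derivatives f′ → ∀ x → local f x ≡ local f′ x
    same-local f f′ hf hf′ eq x = Codable.code-cong (codable-Local N e) pw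
      where
      pw : ∀ i → local-table f x i ≡ local-table f′ x i
      pw (inj₁ s) = refl
      pw (inj₂ σ) = trans (D-fromFin n (map dir σ) f x) (trans
        (encode-injective n m (degLt-Ds n (dirs σ) hf) (degLt-Ds n (dirs σ) hf′) (Codable.code-inj (codable-Dirs N e) eq σ) (fromFin n x))
        (sym (D-fromFin n (map dir σ) f′ x)))

  deltaNum>0 : ∀ j → 1 ≤ deltaNum j
  deltaNum>0 j = m<n⇒0<n∸m (<-trans (m%n<n j p-1) (n<1+n p-1))

  ind-≤-+ : ∀ a b {c} → (a ≡ false → b ≡ false → c ≡ false) → ind c ≤ ind a + ind b
  ind-≤-+ true  b     {c} h = ≤-trans (ind-≤1 c) (m≤m+n 1 (ind b))
  ind-≤-+ false true  {c} h = ind-≤1 c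
  ind-≤-+ false false {c} h = ≤-reflexive (cong ind (h refl refl))

  module Separation (d e E N n : ℕ) (e≤d : e ≤ d)
    (determine : ∀ {q} (G : VectorGroup (Fin q)) (f g : Fin q → F) → 0 < q → Close f g e E → Determined G f g e N (2 * suc (2 * deltaDen d)))
    (g : Vec F n → F) (fs : List (Vec F n → F)) (distinct : AllPairs Distinct fs)
    (props : All (λ f → Linear.DegLt (vecGroup n) (suc d) f × CloseV f g e E) fs) where
    open ≤-Reasoning

    K₁ K m W q B : ℕ
    -- Functions with equal keys agree outside two sets of density at most 1/K₁ each, and 2/K₁ is
    -- less than 1/`deltaDen d` ≤ δ(d), the least density on which distinct functions of degree ≤ d
    -- differ. The further factor 2 in K lets each function fail for at most half of the tuples.
    K₁ = suc (2 * deltaDen d)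
    K = 2 * K₁
    m = suc (d ∸ e)
    W = locals N e
    q = p ^ n
    B = Codable.size (codable-Dirs N e) (polyCount n m) * p ^ W
    e+m : suc d ≡ e + m
    e+m = sym (trans (+-suc e (d ∸ e)) (cong suc (m+[n∸m]≡n e≤d)))
    0<q : 0 < q
    0<q = m^n>0 p n
    fn : Fin (length fs) → Vec F n → F
    fn = List.lookup fs
    prop : ∀ i → Linear.DegLt (vecGroup n) (suc d) (fn i) × CloseV (fn i) g e E
    prop i = All.lookup props (∈-lookup i)
    det : ∀ i → Determined (finGroup n) (fn i ∘ fromFin n) (g ∘ fromFin n) e N K
    det i = determine (finGroup n) (fn i ∘ fromFin n) (g ∘ fromFin n) 0<q
      (subst (λ z → E * (deltaDen e * z) + q ≤ E * (deltaNum e * q)) (sym (sum-fromFin n (λ x → ind (nz (fn i x ⊝ g x))))) (proj₂ (prop i)))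
    fail : Fin (length fs) → Vec (Fin q) N → Bool
    fail i a = does (q <? K₁ * count (Determined.bad (det i) a))
    fail-rare : ∀ i → 2 * sumT N (λ a → ind (fail i a)) ≤ q ^ N
    fail-rare i = *-cancelˡ-≤ K₁ (≤-trans (≤-reflexive (r K₁ (sumT N (λ a → ind (fail i a))))) (sections K₁ K N (Determined.bad (det i)) 0<q (Determined.rare (det i))))
      where
      r : ∀ k s → k * (2 * s) ≡ 2 * k * s
      r = solve-∀
    choice : ∃ λ a → 2 * count (λ i → fail i a) ≤ length fs
    choice = average N (length fs) (λ a → count (λ i → fail i a)) 0<q (begin
      2 * sumT N (λ a → count (λ i → fail i a))  ≡⟨ cong (2 *_) (sumT-sum N (λ a i → ind (fail i a))) ⟩
      2 * sum (λ i → sumT N (λ a → ind (fail i a)))  ≡⟨ sum-*ˡ 2 (λ i → sumT N (λ a → ind (fail i a))) ⟨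
      sum (λ i → 2 * sumT N (λ a → ind (fail i a)))  ≤⟨ sum-≤-const (q ^ N) fail-rare ⟩
      length fs * q ^ N  ∎)
    a : Vec (Fin q) N
    a = proj₁ choice
    good : Fin (length fs) → Bool
    good i = not (fail i a)
    open Keys n e m N g a hiding (q)
    key : Fin (length fs) → Fin B
    key i = combine (derivatives (fn i)) (funToFin (lookup-value (fn i) K (det i)))
    not-true : ∀ {b} → not b ≡ true → b ≡ false
    not-true {false} _ = refl
    agree : ∀ {i j} → good i ≡ true → good j ≡ true → key i ≡ key j → ∀ x → fn i x ≡ fn j x
    agree {i} {j} gi gj ek x₀ = decidable-stable (fn i x₀ ≟ fn j x₀) (λ ne → contradiction (K₁-small (ne ∘ ⊝-≡0)) (<⇒≱ (n<1+n (2 * deltaDen d))))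
      where
      keys = combine-injective (derivatives (fn i)) (funToFin (lookup-value (fn i) K (det i))) (derivatives (fn j)) (funToFin (lookup-value (fn j) K (det j))) ek
      bi bj : Fin q → Bool
      bi = Determined.bad (det i) a
      bj = Determined.bad (det j) a
      loc : ∀ x → local (fn i) x ≡ local (fn j) x
      loc = same-local (fn i) (fn j) (subst (λ z → Linear.DegLt (vecGroup n) z (fn i)) e+m (proj₁ (prop i))) (subst (λ z → Linear.DegLt (vecGroup n) z (fn j)) e+m (proj₁ (prop j))) (proj₁ keys)
      values : ∀ w → lookup-value (fn i) K (det i) w ≡ lookup-value (fn j) K (det j) w
      values = Codable.code-inj (codable-Fin W) (proj₂ keys)
      equal : ∀ x → bi x ≡ false → bj x ≡ false → fn i (fromFin n x) ≡ fn j (fromFin n x)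
      equal x hi hj = trans (sym (lookup-correct (fn i) K (det i) x hi)) (trans (values (local (fn i) x))
        (trans (cong (lookup-value (fn j) K (det j)) (loc x)) (lookup-correct (fn j) K (det j) x hj)))
      Δw : ℕ
      Δw = weight n (λ x → fn i x ⊝ fn j x)
      pw : ∀ x → ind (nz (fn i (fromFin n x) ⊝ fn j (fromFin n x))) ≤ ind (bi x) + ind (bj x)
      pw x = ind-≤-+ (bi x) (bj x) (λ hi hj → cong not (trans (cong (_== 0F) (trans (cong (_⊝ fn j (fromFin n x)) (equal x hi hj)) (⊝-self _))) (==-refl 0F)))
      Δw-≤ : Δw ≤ count bi + count bj
      Δw-≤ = ≤-trans (≤-reflexive (sym (sum-fromFin n (λ x → ind (nz (fn i x ⊝ fn j x)))))) (≤-trans (sum-mono pw) (≤-reflexive (∑-distrib-+ (ind ∘ bi) (ind ∘ bj))))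
      nice : ∀ {l} → good l ≡ true → K₁ * count (Determined.bad (det l) a) ≤ q
      nice {l} gl = ≮⇒≥ (does-false (q <? K₁ * count (Determined.bad (det l) a)) (not-true gl))
      r : ∀ d q → d * (q + q) ≡ 2 * d * q
      r = solve-∀
      r′ : ∀ k d w → k * (d * w) ≡ d * (k * w)
      r′ = solve-∀
      K₁-small : fn i x₀ ⊝ fn j x₀ ≢ 0F → K₁ ≤ 2 * deltaDen d
      K₁-small ne = *-cancelʳ-≤ K₁ (2 * deltaDen d) q {{>-nonZero 0<q}} (begin
        K₁ * q  ≤⟨ *-monoʳ-≤ K₁ (≤-trans (≤-reflexive (sym (*-identityˡ q))) (*-monoˡ-≤ q (deltaNum>0 d))) ⟩
        K₁ * (deltaNum d * q)  ≤⟨ *-monoʳ-≤ K₁ (weight-bound n d (λ x → fn i x ⊝ fn j x) (degLt-⊝ n (suc d) (proj₁ (prop i)) (proj₁ (prop j))) x₀ ne) ⟩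
        K₁ * (deltaDen d * Δw)  ≡⟨ r′ K₁ (deltaDen d) Δw ⟩
        deltaDen d * (K₁ * Δw)  ≤⟨ *-monoʳ-≤ (deltaDen d) (≤-trans (*-monoʳ-≤ K₁ Δw-≤) (≤-trans (≤-reflexive (*-distribˡ-+ K₁ (count bi) (count bj))) (+-mono-≤ (nice gi) (nice gj)))) ⟩
        deltaDen d * (q + q)  ≡⟨ r (deltaDen d) q ⟩
        2 * deltaDen d * q  ∎)
    injective : ∀ {i j} → good i ≡ true → good j ≡ true → key i ≡ key j → i ≡ j
    injective {i} {j} gi gj ek = order (<-cmp i j)
      where
      order : Tri (toℕ i < toℕ j) (i ≡ j) (toℕ j < toℕ i) → i ≡ j
      order (tri< lt _ _) = let (x , ne) = allPairs-lookup distinct lt in contradiction (agree gi gj ek x) ne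
      order (tri≈ _ e _)  = e
      order (tri> _ _ gt) = let (x , ne) = allPairs-lookup distinct gt in contradiction (sym (agree gi gj ek x)) ne
    half : length fs ≤ 2 * B
    half = +-cancelˡ-≤ (length fs) _ _ (begin
      length fs + length fs  ≡⟨ r (length fs) ⟩
      2 * length fs  ≡⟨ cong (2 *_) (count-not (λ i → fail i a)) ⟨
      2 * (count (λ i → fail i a) + count good)  ≡⟨ *-distribˡ-+ 2 (count (λ i → fail i a)) (count good) ⟩
      2 * count (λ i → fail i a) + 2 * count good  ≤⟨ +-mono-≤ (proj₂ choice) (*-monoʳ-≤ 2 (count-keys good key injective)) ⟩
      length fs + 2 * B  ∎)
      where
      r : ∀ l → l + l ≡ 2 * l
      r = solve-∀

  -- The only factor that grows with n is the code of the derivatives, a bounded power of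
  -- `polyCount n m` with m = d - e + 1. The bounded factors may be raised to the exponent n^(d-e)
  -- as well, which is at least 1.
  list-bound : ∀ d e E → e ≤ d → ∃ λ C → ∀ n → 1 ≤ n → (g : Vec F n → F) (fs : List (Vec F n → F)) →
    AllPairs Distinct fs → All (λ f → Linear.DegLt (vecGroup n) (suc d) f × CloseV f g e E) fs → length fs ≤ C ^ (n ^ (d ∸ e))
  list-bound d e E e≤d = 2 * (p ^ m) ^ c * p ^ W , λ n 1≤n g fs distinct props →
      ≤-trans (Separation.half d e E N n e≤d (proj₂ (determination e (2 * suc (2 * deltaDen d)) E)) g fs distinct props) (arithmetic n 1≤n)
    where
    open ≤-Reasoning
    N m W c : ℕ
    N = proj₁ (determination e (2 * suc (2 * deltaDen d)) E)
    m = suc (d ∸ e)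
    W = locals N e
    c = proj₁ (power-Dirs N e)
    arithmetic : ∀ n → 1 ≤ n → 2 * (Codable.size (codable-Dirs N e) (polyCount n m) * p ^ W) ≤ (2 * (p ^ m) ^ c * p ^ W) ^ (n ^ (d ∸ e))
    arithmetic n 1≤n = begin
      2 * (Codable.size (codable-Dirs N e) (polyCount n m) * p ^ W)  ≤⟨ *-monoʳ-≤ 2 (*-monoˡ-≤ (p ^ W) (≤-trans (≤-reflexive (proj₂ (power-Dirs N e) (polyCount n m))) (^-monoˡ-≤ c (polyCount-≤ n (d ∸ e) 1≤n)))) ⟩
      2 * (((p ^ m) ^ h) ^ c * p ^ W)  ≡⟨ cong (λ z → 2 * (z * p ^ W)) (trans (^-*-assoc (p ^ m) h c) (trans (cong ((p ^ m) ^_) (*-comm h c)) (sym (^-*-assoc (p ^ m) c h)))) ⟩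
      2 * (((p ^ m) ^ c) ^ h * p ^ W)  ≡⟨ *-assoc 2 (((p ^ m) ^ c) ^ h) (p ^ W) ⟨
      2 * ((p ^ m) ^ c) ^ h * p ^ W  ≤⟨ *-mono-≤ (*-monoˡ-≤ (((p ^ m) ^ c) ^ h) (m≤m^n 2 (s≤s z≤n) 1≤h)) (m≤m^n (p ^ W) (m^n>0 p W) 1≤h) ⟩
      2 ^ h * ((p ^ m) ^ c) ^ h * (p ^ W) ^ h  ≡⟨ cong (_* (p ^ W) ^ h) (^-distrib-* 2 ((p ^ m) ^ c) h) ⟨
      (2 * (p ^ m) ^ c) ^ h * (p ^ W) ^ h  ≡⟨ ^-distrib-* (2 * (p ^ m) ^ c) (p ^ W) h ⟨
      (2 * (p ^ m) ^ c * p ^ W) ^ h  ∎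
      where
      h : ℕ
      h = n ^ (d ∸ e)
      1≤h : 1 ≤ h
      1≤h = n^m>0 (d ∸ e) 1≤n

  -- From polynomials and rational distances to differences and counts

  module _ {n : ℕ} where
    open Linear (vecGroup n)

    degLt-cong : ∀ m {f g} → (∀ x → f x ≡ g x) → DegLt m f → DegLt m g
    degLt-cong m h d b y = trans (D-cong b (λ x → sym (h x)) y) (d b y)

    degLt-zero : ∀ {m f} → (∀ x → f x ≡ 0F) → DegLt m f
    degLt-zero h []      y = h y
    degLt-zero h (v ∷ b) y = trans (cong₂ _⊝_ (degLt-zero h b (y ∙ v)) (degLt-zero h b y)) (⊝-self 0F)

    degLt-suc : ∀ {m f} → DegLt m f → DegLt (suc m) f
    degLt-suc d (v ∷ b) y = trans (cong₂ _⊝_ (d b (y ∙ v)) (d b y)) (⊝-self 0F)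

    degLt-mono : ∀ {m m′ f} → m ≤ m′ → DegLt m f → DegLt m′ f
    degLt-mono {m} {m′} {f} le d = subst (λ z → DegLt z f) (m∸n+n≡m le) (raise (m′ ∸ m))
      where
      raise : ∀ r → DegLt (r + m) f
      raise zero    = d
      raise (suc r) = degLt-suc (raise r)

    degLt-⊕ : ∀ m {f g} → DegLt m f → DegLt m g → DegLt m (λ x → f x ⊕ g x)
    degLt-⊕ m {f} {g} hf hg b y = trans (D-⊕ b f g y) (trans (cong₂ _⊕_ (hf b y) (hg b y)) (⊕-0ʳ 0F))

    degLt-shift : ∀ m {f} s → DegLt m f → DegLt m (λ x → f (x ∙ s))
    degLt-shift m {f} s h b y = trans (D-shift b f s y) (h b (y ∙ s))

    -- By the Leibniz rule a difference of the product is a sum of two products in which one factor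
    -- has lost a degree, the other being at most translated. A factor of degree below 1 has zero
    -- difference, which ends the recursion in `left` and `right`.
    degLt-⊗ : ∀ m l {f g} → DegLt (suc m) f → DegLt (suc l) g → DegLt (suc (m + l)) (λ x → f x ⊗ g x)
    degLt-⊗ m l {f} {g} hf hg (v ∷ b) y = trans (sym (D-inner b (λ x → f x ⊗ g x) v y)) (trans (D-cong b (λ x → ⊗-leibniz (f (x ∙ v)) (g (x ∙ v)) (f x) (g x)) y)
        (degLt-⊕ (m + l) (left l hg) (right m hf) b y))
      where
      left : ∀ l → DegLt (suc l) g → DegLt (m + l) (λ x → f (x ∙ v) ⊗ (g (x ∙ v) ⊝ g x))
      left zero    hg = degLt-zero (λ x → trans (cong (f (x ∙ v) ⊗_) (degLt-D n 0 v hg [] x)) (⊗-zeroʳ (f (x ∙ v))))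
      left (suc l) hg = subst (λ z → DegLt z (λ x → f (x ∙ v) ⊗ (g (x ∙ v) ⊝ g x))) (sym (+-suc m l)) (degLt-⊗ m l (degLt-shift (suc m) v hf) (degLt-D n (suc l) v hg))
      right : ∀ m → DegLt (suc m) f → DegLt (m + l) (λ x → (f (x ∙ v) ⊝ f x) ⊗ g x)
      right zero    hf = degLt-zero (λ x → trans (cong (_⊗ g x) (degLt-D n 0 v hf [] x)) (⊗-zeroˡ (g x)))
      right (suc m) hf = degLt-⊗ m l (degLt-D n (suc m) v hf) hg

    degLt-const : ∀ c → DegLt 1 (λ _ → c)
    degLt-const c (v ∷ []) y = ⊝-self c

  degLt-tail : ∀ {n} m {φ : Vec F n → F} → Linear.DegLt (vecGroup n) m φ → Linear.DegLt (vecGroup (suc n)) m (φ ∘ Vec.tail)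
  degLt-tail {n} m {φ} h b y = trans (pull b y) (h (Vec.map Vec.tail b) (Vec.tail y))
    where
    pull : ∀ {k} (b : Vec (Vec F (suc n)) k) y → Linear.D (vecGroup (suc n)) b (φ ∘ Vec.tail) y ≡ Linear.D (vecGroup n) (Vec.map Vec.tail b) φ (Vec.tail y)
    pull []            y        = refl
    pull ((v ∷ w) ∷ b) (x ∷ y)  = cong₂ _⊝_ (pull b _) (pull b (x ∷ y))

  degLt-head : ∀ {n} → Linear.DegLt (vecGroup (suc n)) 2 Vec.head
  degLt-head {n} ((u ∷ _) ∷ (v ∷ _) ∷ []) (x ∷ _) = trans (cong₂ _⊝_ (shift (x ⊕ u)) (shift x)) (⊝-self v)
    where
    shift : ∀ x → (x ⊕ v) ⊝ x ≡ v
    shift x = trans (cong (_⊝ x) (⊕-comm x v)) (⊕-cancel-⊝ v x)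

  degLt-power : ∀ {n} e → Linear.DegLt (vecGroup (suc n)) (suc e) (λ x → [ toℕ (Vec.head x) ^ e ])
  degLt-power zero    = degLt-const [ 1 ]
  degLt-power (suc e) = degLt-cong (suc (suc e)) (λ x → trans (cong (_⊗ [ toℕ (Vec.head x) ^ e ]) (sym ([]-toℕ (Vec.head x)))) (sym ([]-* (toℕ (Vec.head x)) (toℕ (Vec.head x) ^ e))))
    (degLt-⊗ 1 e degLt-head (degLt-power e))

  degLt-monomial : ∀ {n} (es : Vec ℕ n) → Linear.DegLt (vecGroup n) (suc (sumV es)) (λ x → [ monVal es x ])
  degLt-monomial []       = degLt-cong 1 (λ { [] → refl }) (degLt-const [ 1 ])
  degLt-monomial (e ∷ es) = degLt-cong (suc (e + sumV es)) (λ { (x ∷ y) → sym ([]-* (toℕ x ^ e) (monVal es y)) })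
    (degLt-⊗ e (sumV es) (degLt-power e) (degLt-tail (suc (sumV es)) (degLt-monomial es)))

  degLt-poly : ∀ {n} d (P : Poly n) → DegLe d P → Linear.DegLt (vecGroup n) (suc d) (λ x → [ evalℕ P x ])
  degLt-poly d []             h        = degLt-zero (λ _ → refl)
  degLt-poly d ((c , es) ∷ P) (h , hs) = degLt-cong (suc d)
    (λ x → sym (trans ([]-+ (c * monVal es x) (evalℕ P x)) (cong (_⊕ [ evalℕ P x ]) ([]-* c (monVal es x)))))
    (degLt-⊕ (suc d) (degLt-mono (s≤s h) (degLt-⊗ 0 (sumV es) (degLt-const [ c ]) (degLt-monomial es))) (degLt-poly d P hs))

  degLt-InPd : ∀ {n d f} → InPd p n d f → Linear.DegLt (vecGroup n) (suc d) f
  degLt-InPd {n} {d} (P , h , e) = degLt-cong (suc d) (λ x → sym (toℕ-injective (trans (e x) (sym (toℕ-[] (evalℕ P x)))))) (degLt-poly d P h)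

  countˡ : ∀ {A : Set} {P : A → Set} → (∀ x → Dec (P x)) → List A → ℕ
  countˡ P? xs = length (List.filter P? xs)

  countˡ-++ : ∀ {A : Set} {P : A → Set} (P? : ∀ x → Dec (P x)) xs ys → countˡ P? (xs List.++ ys) ≡ countˡ P? xs + countˡ P? ys
  countˡ-++ P? xs ys = trans (cong length (filter-++ P? xs ys)) (length-++ (List.filter P? xs))

  countˡ-map : ∀ {A B : Set} {P : B → Set} (P? : ∀ x → Dec (P x)) (h : A → B) xs → countˡ P? (List.map h xs) ≡ countˡ (P? ∘ h) xs
  countˡ-map P? h []       = refl
  countˡ-map P? h (x ∷ xs) with does (P? (h x))
  ... | true  = cong suc (countˡ-map P? h xs)
  ... | false = countˡ-map P? h xs

  countˡ-concat : ∀ {A : Set} {P : A → Set} (P? : ∀ x → Dec (P x)) {r m} (h : Fin r → Fin m) (L : Fin m → List A) →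
    countˡ P? (List.concatMap L (List.tabulate h)) ≡ sum (λ i → countˡ P? (L (h i)))
  countˡ-concat P? {zero}  h L = refl
  countˡ-concat P? {suc r} h L = trans (countˡ-++ P? (L (h zero)) _) (cong (countˡ P? (L (h zero)) +_) (countˡ-concat P? (h ∘ suc) L))

  countˡ-points : ∀ n {P : Vec F n → Set} (P? : ∀ x → Dec (P x)) → countˡ P? (points p n) ≡ sumT n (λ x → ind (does (P? x)))
  countˡ-points zero    P? with does (P? [])
  ... | true  = refl
  ... | false = refl
  countˡ-points (suc n) P? = trans (countˡ-concat P? id (λ a → List.map (a ∷_) (points p n)))
    (sum-cong-≗ {p} (λ a → trans (countˡ-map P? (a ∷_) (points p n)) (countˡ-points n (P? ∘ (a ∷_)))))

  disagree-weight : ∀ {n} (f g : Vec F n → F) → disagree f g ≡ weight n (λ x → f x ⊝ g x)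
  disagree-weight {n} f g = trans (countˡ-points n _) (sumT-cong n (λ x → cong (ind ∘ not) (eq (f x) (g x))))
    where
    eq : ∀ a b → (a == b) ≡ ((a ⊝ b) == 0F)
    eq a b with a ≟ b
    ... | yes refl = sym (trans (cong (_== 0F) (⊝-self a)) (==-refl 0F))
    ... | no ne    = sym (==-false (ne ∘ ⊝-≡0))

  module _ where
    open import Data.Integer using (+_)

    -- The hypothesis is the cross-multiplied form of the rational inequality. Moved to the left,
    -- the ε term is a positive integer multiple of `suc Q`, of which one copy is kept as the slack.
    clear-denominators : ∀ dis Q A b v u P →
      + dis ℤ.* + (suc A * (1 * suc P) * suc v) ℤ.≤ ((+ 1 ℤ.* (+ 1 ℤ.* + suc P ℤ.+ ℤ.- (+ b) ℤ.* + 1)) ℤ.* + suc v ℤ.+ ℤ.- (+ suc u) ℤ.* + (suc A * (1 * suc P))) ℤ.* + suc Q →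
      b ≤ suc P → suc v * (suc P * suc A * dis) + suc Q ≤ suc v * ((suc P ∸ b) * suc Q)
    clear-denominators dis Q A b v u P h b≤P = ≤-trans (+-monoʳ-≤ (suc v * (suc P * suc A * dis)) (m≤m+n (suc Q) _)) (ℤ.drop‿+≤+ (subst₂ ℤ._≤_ lhs rhs (ℤ.+-monoˡ-≤ (+ suc u ℤ.* + (suc A * (1 * suc P)) ℤ.* + suc Q) h)))
      where
      X : ℕ
      X = suc A * (1 * suc P)
      r₁ : ∀ d A P v u Q → d * (A * (1 * P) * v) + u * (A * (1 * P)) * Q ≡ v * (P * A * d) + u * (A * (1 * P)) * Q
      r₁ = solve-∀
      r₂ : ∀ P b V U X Q → ((+ 1 ℤ.* (+ 1 ℤ.* P ℤ.+ ℤ.- b ℤ.* + 1)) ℤ.* V ℤ.+ ℤ.- U ℤ.* X) ℤ.* Q ℤ.+ U ℤ.* X ℤ.* Q ≡ V ℤ.* ((P ℤ.- b) ℤ.* Q)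
      r₂ = ℤ.solve-∀
      lhs : + dis ℤ.* + (X * suc v) ℤ.+ + suc u ℤ.* + X ℤ.* + suc Q ≡ + (suc v * (suc P * suc A * dis) + suc u * X * suc Q)
      lhs = trans (cong₂ ℤ._+_ (sym (ℤ.pos-* dis (X * suc v))) (trans (cong (ℤ._* + suc Q) (sym (ℤ.pos-* (suc u) X))) (sym (ℤ.pos-* (suc u * X) (suc Q)))))
        (trans (sym (ℤ.pos-+ (dis * (X * suc v)) (suc u * X * suc Q))) (cong +_ (r₁ dis (suc A) (suc P) (suc v) (suc u) (suc Q))))
      rhs : ((+ 1 ℤ.* (+ 1 ℤ.* + suc P ℤ.+ ℤ.- (+ b) ℤ.* + 1)) ℤ.* + suc v ℤ.+ ℤ.- (+ suc u) ℤ.* + X) ℤ.* + suc Q ℤ.+ + suc u ℤ.* + X ℤ.* + suc Q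
          ≡ + (suc v * ((suc P ∸ b) * suc Q))
      rhs = trans (r₂ (+ suc P) (+ b) (+ suc v) (+ suc u) (+ X) (+ suc Q))
        (trans (cong (λ z → + suc v ℤ.* (z ℤ.* + suc Q)) (trans (ℤ.m-n≡m⊖n (suc P) b) (ℤ.⊖-≥ b≤P)))
          (trans (cong (+ suc v ℤ.*_) (sym (ℤ.pos-* (suc P ∸ b) (suc Q)))) (sym (ℤ.pos-* (suc v) ((suc P ∸ b) * suc Q)))))

    close-ℚ : ∀ ε → 0ℚ ℚ.< ε → ∀ dis Q A b → .{{_ : NonZero Q}} → .{{_ : NonZero A}} → b ≤ p →
      ratio dis Q ℚ.≤ ratio 1 A ℚ.* (1ℚ ℚ.- ratio b p) ℚ.- ε → ↧ₙ ε * (p * A * dis) + Q ≤ ↧ₙ ε * ((p ∸ b) * Q)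
    close-ℚ (mkℚ (+ 0) v _) (ℚ.*<* (ℤ.+<+ ()))
    close-ℚ (mkℚ -[1+ _ ] v _) (ℚ.*<* ())
    close-ℚ ε@(mkℚ (+ suc u) v _) _ dis (suc Q) (suc A) b b≤p h = clear-denominators dis Q A b v u p-1 (ℚᵘ.drop-*≤* (ℚᵘ.≤-respʳ-≃ right (ℚᵘ.≤-respˡ-≃ (ℚ.toℚᵘ-fromℚᵘ x) (ℚ.toℚᵘ-mono-≤ h)))) b≤p
      where
      x α β ε′ : ℚᵘ
      x = mkℚᵘ (+ dis) Q
      α = mkℚᵘ (+ 1) A
      β = mkℚᵘ (+ b) p-1
      ε′ = mkℚᵘ (+ suc u) v
      one-β : toℚᵘ (1ℚ ℚ.- ratio b p) ℚᵘ.≃ ℚᵘ.1ℚᵘ ℚᵘ.- β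
      one-β = ℚᵘ.≃-trans (ℚ.toℚᵘ-homo-+ 1ℚ (ℚ.- ratio b p)) (ℚᵘ.+-congʳ ℚᵘ.1ℚᵘ (ℚᵘ.≃-trans (ℚ.toℚᵘ-homo‿- (ratio b p)) (ℚᵘ.-‿cong (ℚ.toℚᵘ-fromℚᵘ β))))
      right : toℚᵘ (ratio 1 (suc A) ℚ.* (1ℚ ℚ.- ratio b p) ℚ.- ε) ℚᵘ.≃ α ℚᵘ.* (ℚᵘ.1ℚᵘ ℚᵘ.- β) ℚᵘ.- ε′
      right = ℚᵘ.≃-trans (ℚ.toℚᵘ-homo-+ (ratio 1 (suc A) ℚ.* (1ℚ ℚ.- ratio b p)) (ℚ.- ε))
        (ℚᵘ.+-cong (ℚᵘ.≃-trans (ℚ.toℚᵘ-homo-* (ratio 1 (suc A)) (1ℚ ℚ.- ratio b p)) (ℚᵘ.*-cong (ℚ.toℚᵘ-fromℚᵘ α) one-β)) (ℚ.toℚᵘ-homo‿- ε))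

  -- E is the denominator of ε: being positive, ε is at least 1/E, hence at least the slack 1/(E ·
  -- `deltaDen e`) of `CloseV`.
  closeV : ∀ ε → 0ℚ ℚ.< ε → ∀ n e (f g : Vec F n → F) → dist f g ℚ.≤ deltaF p e ℚ.- ε → CloseV f g e (↧ₙ ε)
  closeV ε ε>0 n e f g h = subst (λ z → ↧ₙ ε * (deltaDen e * z) + p ^ n ≤ ↧ₙ ε * (deltaNum e * p ^ n)) (disagree-weight f g)
    (close-ℚ ε ε>0 (disagree f g) (p ^ n) (p ^ (e / p-1)) (e % p-1) {{m^n≢0 p n}} {{m^n≢0 p (e / p-1)}} (<⇒≤ (<-trans (m%n<n e p-1) (n<1+n p-1))) h)

  -- The final constant must be independent of e, of which finitely many values occur; the maximum
  -- of their constants works for every exponent.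
  max-below : ∀ d (c : ℕ → ℕ) → ∃ λ C → ∀ e → e ≤ d → ∀ h → c e ^ h ≤ C ^ h
  max-below zero c = c 0 , λ { .0 z≤n h → ≤-refl }
  max-below (suc d) c = let (C , le) = max-below d c in c (suc d) ⊔ C , λ e e≤ h → bound C le e e≤ h (m≤n⇒m<n∨m≡n e≤)
    where
    bound : ∀ C → (∀ e → e ≤ d → ∀ h → c e ^ h ≤ C ^ h) → ∀ e → e ≤ suc d → ∀ h → e < suc d ⊎ e ≡ suc d → c e ^ h ≤ (c (suc d) ⊔ C) ^ h
    bound C le e e≤ h (inj₁ (s≤s lt)) = ≤-trans (le e lt h) (^-monoˡ-≤ h (m≤n⊔m (c (suc d)) C))
    bound C le e e≤ h (inj₂ refl)     = ^-monoˡ-≤ h (m≤m⊔n (c (suc d)) C)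

  listSize-bound : (ε : ℚ) → 0ℚ ℚ.< ε → (d : ℕ) → 1 ≤ d →
    ∃ λ (C : ℕ) → (e n : ℕ) → 1 ≤ e → e ≤ d → 1 ≤ n →
      (g : Vec (Fin p) n → Fin p) → (fs : List (Vec (Fin p) n → Fin p)) →
      AllPairs Distinct fs →
      All (λ f → InPd p n d f × (dist f g ℚ.≤ (deltaF p e ℚ.- ε))) fs →
      length fs ≤ C ^ (n ^ (d ∸ e))
  listSize-bound ε ε>0 d _ = proj₁ maximal , λ e n _ e≤d 1≤n g fs distinct props →
      ≤-trans (proj₂ (bounds e) e≤d n 1≤n g fs distinct (All.map (λ {f} (h , c) → degLt-InPd h , closeV ε ε>0 n e f g c) props)) (proj₂ maximal e e≤d (n ^ (d ∸ e)))
    where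
    Bounded : ℕ → ℕ → Set
    Bounded e C = e ≤ d → ∀ n → 1 ≤ n → (g : Vec F n → F) (fs : List (Vec F n → F)) → AllPairs Distinct fs →
      All (λ f → Linear.DegLt (vecGroup n) (suc d) f × CloseV f g e (↧ₙ ε)) fs → length fs ≤ C ^ (n ^ (d ∸ e))
    bounds : ∀ e → ∃ (Bounded e)
    bounds e with e ≤? d
    ... | yes e≤d = let (C , h) = list-bound d e (↧ₙ ε) e≤d in C , λ _ → h
    -- A placeholder that makes the constant a total function of e, as `max-below` expects.
    ... | no e≰d  = 0 , λ e≤d → contradiction e≤d e≰d
    maximal : ∃ λ C → ∀ e → e ≤ d → ∀ h → proj₁ (bounds e) ^ h ≤ C ^ h
    maximal = max-below d (λ e → proj₁ (bounds e))

theorem2 : (p : ℕ) → Prime p → (ε : ℚ) → 0ℚ <ℚ ε → (d : ℕ) → 1 ≤ d →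
    ∃ λ (C : ℕ) → (e n : ℕ) → 1 ≤ e → e ≤ d → 1 ≤ n →
    (g : Vec (Fin p) n → Fin p) → (fs : List (Vec (Fin p) n → Fin p)) →
    AllPairs Distinct fs →
    All (λ f → InPd p n d f × (dist f g ≤ℚ (deltaF p e - ε))) fs →
    length fs ≤ C ^ (n ^ (d ∸ e))
theorem2 zero          pr = contradiction pr ¬prime[0]
theorem2 (suc zero)    pr = contradiction pr ¬prime[1]
theorem2 (suc (suc k)) pr = ListDecoding.listSize-bound k pr
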